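{- Let $k \geq 6$ and $r \geq 3$ be integers. Every minimal graph $G$ with average degree at least $\tfrac{4}{3}kr$ contains a set of $k$ pairwise vertex-disjoint cycles, each with at least $r$ vertices.
   Context: Graphs are finite and simple. The average degree of a graph $G$ is $d(G) = 2|E(G)|/|V(G)|$. A graph $G$ is called minimal if every vertex deletion and every edge contraction (removing any resulting parallel edges) produces a graph with strictly smaller average degree than $d(G)$. -}

module Defs where

open import Data.Nat using (ℕ; zero; suc; _+_; _*_; _≤_; _<_; _<ᵇ_)
open import Data.Bool using (Bool; true; false; _∧_; _∨_; not; if_then_else_)
open import Data.Fin using (Fin; zero; suc; toℕ; punchIn; inject₁; fromℕ; _≟_)
open import Relation.Nullary.Decidable using (⌊_⌋)
open import Relation.Binary.PropositionalEquality using (_≡_; _≢_)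
open import Function.Definitions using (Injective)

Adj : ℕ → Set
Adj n = Fin n → Fin n → Bool

record Graph (n : ℕ) : Set where
  field
    adj    : Adj n
    sym    : ∀ i j → adj i j ≡ adj j i
    irrefl : ∀ i → adj i i ≡ false
open Graph public

sumFin : (n : ℕ) → (Fin n → ℕ) → ℕ
sumFin zero    f = 0
sumFin (suc n) f = f zero + sumFin n (λ i → f (suc i))

edgeCount : {n : ℕ} → Adj n → ℕ
edgeCount {n} a =
  sumFin n (λ i → sumFin n (λ j → if (toℕ i <ᵇ toℕ j) ∧ a i j then 1 else 0))

deleteVertex : {m : ℕ} → Adj (suc m) → Fin (suc m) → Adj m
deleteVertex a v x y = a (punchIn v x) (punchIn v y)

-- Contracting the edge uv: v is removed, u becomes the merged vertex, which is
-- adjacent to everything adjacent to u or to v (parallel edges and loops removed).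
contractEdge : {m : ℕ} → Adj (suc m) → Fin (suc m) → Fin (suc m) → Adj m
contractEdge a u v x y =
  not ⌊ x ≟ y ⌋ ∧
  ( a (punchIn v x) (punchIn v y)
  ∨ (⌊ punchIn v x ≟ u ⌋ ∧ a v (punchIn v y))
  ∨ (⌊ punchIn v y ≟ u ⌋ ∧ a v (punchIn v x)) )

-- d(H) < d(G) for H with n' vertices, e' edges and G with n vertices, e edges
-- (2e'/n' < 2e/n, cross-multiplied; n, n' as vertex counts).
AvgDegLess : (n' e' n e : ℕ) → Set
AvgDegLess n' e' n e = e' * n < e * n'

Minimal : {m : ℕ} → Graph (suc m) → Set
Minimal {m} G =
  (∀ (v : Fin (suc m)) →
     AvgDegLess m (edgeCount (deleteVertex (adj G) v)) (suc m) (edgeCount (adj G)))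
  × (∀ (u v : Fin (suc m)) → adj G u v ≡ true →
     AvgDegLess m (edgeCount (contractEdge (adj G) u v)) (suc m) (edgeCount (adj G)))
  where open import Data.Product using (_×_)

record Cycle {n : ℕ} (G : Graph n) : Set where
  field
    len     : ℕ
    long    : 2 ≤ len
    vert    : Fin (suc len) → Fin n
    inj     : Injective _≡_ _≡_ vert
    step    : ∀ (i : Fin len) → adj G (vert (inject₁ i)) (vert (suc i)) ≡ true
    closing : adj G (vert (fromℕ len)) (vert zero) ≡ true
open Cycle public

cycleSize : {n : ℕ} {G : Graph n} → Cycle G → ℕ
cycleSize C = suc (len C)

Disjoint : {n : ℕ} {G : Graph n} → Cycle G → Cycle G → Set
Disjoint C D = ∀ a b → vert C a ≢ vert D b

{-# OPTIONS --safe #-}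
module Submission where

-- Minimality gives every vertex more than 2kr/3 neighbours and every edge at least that many
-- triangles, up to an additive constant.  Keep a family of t < k disjoint cycles with between r and
-- 4r/3 vertices, and outside of it a partial cycle P (a vertex, an edge or a cycle) with fewer than r
-- vertices; improve it lexicographically: increase t, decrease the number of vertices of the family,
-- increase |P|.  A cycle with more than r vertices can be shortened by any outside vertex adjacent
-- to more than half of it.  If no common neighbour of the closing edge of P extends P, these
-- neighbours lie in the family, and counting shows that a vertex w outside can be exchanged with a
-- vertex entering P unless w has many neighbours outside the family.  In the latter case the
-- remaining graph has large minimum degree, so it contains the missing k − t cycles (each chosen
-- shortest, hence with at most r neighbours of any vertex) except perhaps for the last one; the end
-- of a maximal path in what is left yields a second partial cycle P′ with |P| + |P′| large.
-- Averaging over the family finds an r-cycle C on which the common neighbours of the closing edges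
-- of P and of P′ are so frequent that C, P and P′ can be recombined: either into two cycles of
-- lengths in [r, 4r/3], or into one r-cycle and a longer partial cycle.
open import Defs hiding (len; long; vert; inj; step; closing) renaming (sym to adj-sym; irrefl to adj-irrefl)
open import Data.Bool using (Bool; true; false; _∧_; _∨_; not; if_then_else_)
open import Data.Bool.Properties using (∨-comm; ∧-zeroʳ; ∧-idem) renaming (_≟_ to _≟ᵇ_)
open import Data.Empty using (⊥; ⊥-elim)
open import Data.Fin using (Fin; toℕ; punchIn; punchOut; inject₁; fromℕ) renaming (_≟_ to _≟ᶠ_)
open import Data.Fin.Properties using (punchIn-punchOut; punchIn-injective; punchInᵢ≢i; toℕ-injective; any?; injective⇒≤)
open import Data.List using (List; []; _∷_; _++_; length; concat; reverse; lookup)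
open import Data.List.Membership.Propositional using (_∈_; _∉_)
open import Data.List.Membership.Propositional.Properties using (∈-++⁺ˡ; ∈-++⁺ʳ; ∈-++⁻; ∈-∃++; ∈-concat⁺′)
open import Data.List.Properties using (unfold-reverse; length-++; length-reverse; concat-++)
open import Data.List.Relation.Binary.Permutation.Propositional using (_↭_; ↭-refl; ↭-sym; ↭-trans; ↭⇒↭ₛ; ↭-reflexive)
open import Data.List.Relation.Binary.Permutation.Propositional.Properties as ↭ using (++-commutativeMonoid; ++⁺ˡ; ++⁺ʳ; ++⁺; shift; shifts; ∷↭∷ʳ; ∈-resp-↭; All-resp-↭; ↭-reverse; ↭-length)
import Data.List.Relation.Binary.Permutation.Setoid.Properties as ↭ₛ
open import Data.List.Relation.Unary.All as All using (All)
import Data.List.Relation.Unary.All.Properties as AllP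
import Data.List.Relation.Unary.AllPairs as AP
open import Data.List.Relation.Unary.Any as Any using (here; there)
open import Data.List.Relation.Unary.Unique.Propositional using (Unique)
import Data.List.Relation.Unary.Unique.Propositional.Properties as Unique
open import Data.Nat using (ℕ; zero; suc; _+_; _*_; _∸_; _/_; _%_; _≤_; _<_; _≤?_; _<?_; _<ᵇ_; z≤n; s≤s; NonZero; >-nonZero; ≢-nonZero⁻¹)
open import Data.Nat.DivMod using (m%n<n; [m+n]%n≡m%n; [m+kn]%n≡m%n; m<n⇒m%n≡m; n%n≡0; m≡m%n+[m/n]*n; m<n*o⇒m/o<n)
open import Data.Nat.Induction using (<-wellFounded)
open import Data.Nat.Properties
open import Data.Nat.Tactic.RingSolver using (solve)
open import Data.Product using (Σ; ∃; _×_; _,_; proj₁; proj₂)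
open import Data.Sum using (_⊎_; inj₁; inj₂)
open import Function using (_∘_; case_of_)
open import Induction.WellFounded using (Acc; acc)
open import Relation.Binary.Definitions using (tri<; tri≈; tri>)
open import Relation.Binary.PropositionalEquality using (_≡_; _≢_; refl; sym; trans; cong; cong₂; subst; subst₂; setoid; module ≡-Reasoning)
open import Relation.Nullary using (¬_; Dec; yes; no; ¬?; contradiction)
open import Relation.Nullary.Decidable using (_×-dec_; _⊎-dec_; ⌊_⌋; decidable-stable)

-- The size limit 4r/3 balances two demands. On a family cycle C with more than r vertices, an
-- outside vertex sees at most half of C, and so do the common neighbours of the closing edge; the
-- exchange inequality with bound 2r then needs 3|C|/2 ≤ 2r. A recombined cycle, on the other hand,
-- needs freedom in its length, and a range of about r/3 is just enough because three gaps longer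
-- than that do not fit on r positions. The condition k ≥ 6 comes from averaging: the common
-- neighbours of the closing edge occupy more than (2k/3 - 1)r places on at most k - 1 cycles, and
-- (2k/3 - 1)/(k - 1) ≥ 3/5 exactly when k ≥ 6. The share 3/5 exceeds 4/7, and a set of more than
-- 4r/7 positions on a cycle of length at most 4r/3 contains two at distance 3 or 4; this forces the
-- chosen cycle to have exactly r vertices. No extremal configuration is chosen. `Goal` is kept
-- abstract, and each step returns either `Goal` or the inequality that blocks the improvement.

infixr 5 _⊕_
infixr 6 _⊗_

_⊕_ : ∀ {a b c d} → a ≤ b → c ≤ d → a + c ≤ b + d
_⊕_ = +-mono-≤

_⊗_ : ∀ {a b} m → a ≤ b → m * a ≤ m * b
m ⊗ a≤b = *-monoʳ-≤ m a≤b

-- Every linear inequality below is proved by a certificate: l ≤ r is a sum of multiples of the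
-- hypotheses and c ≥ 0 is the slack  (y − x) − (r − l).
linear : ∀ {l r x y} c → l ≤ r → x + r + c ≡ y + l → x ≤ y
linear {l} {r} {x} {y} c l≤r eq = +-cancelʳ-≤ l x y
  (≤-trans (+-monoʳ-≤ x l≤r) (≤-trans (m≤m+n (x + r) c) (≤-reflexive eq)))

opaque
  ≤⇒∃ : ∀ {m n} → m ≤ n → ∃ λ o → m + o ≡ n
  ≤⇒∃ m≤n = m≤n⇒∃[o]m+o≡n m≤n

1≰0 : ¬ 1 ≤ 0
1≰0 ()

⟦_⟧ : Bool → ℕ
⟦ true ⟧  = 1
⟦ false ⟧ = 0

⟦⟧≤1 : ∀ b → ⟦ b ⟧ ≤ 1
⟦⟧≤1 true  = s≤s z≤n
⟦⟧≤1 false = z≤n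

⟦⟧>0 : ∀ {b} → 0 < ⟦ b ⟧ → b ≡ true
⟦⟧>0 {true} _ = refl

≢true : ∀ {b} → b ≢ true → b ≡ false
≢true {true}  b≢ = contradiction refl b≢
≢true {false} _  = refl

true≢false : ∀ {b} → b ≡ true → b ≡ false → ⊥
true≢false refl ()

-- Sums over windows of ℕ

-- Windows may start anywhere and run past the period: an arc of a cycle that crosses the base point
-- is then an ordinary interval of ℕ, and no case distinction for wrapping around arises.
win : (ℕ → ℕ) → ℕ → ℕ → ℕ
win g u zero    = 0
win g u (suc m) = g u + win g (suc u) m

win-mono : ∀ {g h} u m → (∀ x → u ≤ x → x < m + u → g x ≤ h x) → win g u m ≤ win h u m
win-mono u zero    _   = z≤n
win-mono u (suc m) g≤h = +-mono-≤ (g≤h u ≤-refl (s≤s (m≤n+m u m)))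
  (win-mono (suc u) m λ x u<x x< → g≤h x (<⇒≤ u<x) (subst (x <_) (+-suc m u) x<))

opaque
  +-interchange : ∀ a b c d → (a + b) + (c + d) ≡ (a + c) + (b + d)
  +-interchange a b c d = solve (a ∷ b ∷ c ∷ d ∷ [])

win-+ : ∀ g h u m → win (λ x → g x + h x) u m ≡ win g u m + win h u m
win-+ g h u zero    = refl
win-+ g h u (suc m) = trans (cong (g u + h u +_) (win-+ g h (suc u) m))
  (+-interchange (g u) (h u) (win g (suc u) m) (win h (suc u) m))

win-const : ∀ c u m → win (λ _ → c) u m ≡ m * c
win-const c u zero    = refl
win-const c u (suc m) = cong (c +_) (win-const c (suc u) m)

win-++ : ∀ g u m m′ → win g u (m + m′) ≡ win g u m + win g (m + u) m′
win-++ g u zero    m′ = refl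
win-++ g u (suc m) m′ = trans (cong (g u +_)
    (trans (win-++ g (suc u) m m′) (cong (λ v → win g (suc u) m + win g v m′) (+-suc m u))))
  (sym (+-assoc (g u) (win g (suc u) m) (win g (suc m + u) m′)))

win-shift : ∀ g d u m → win (λ x → g (d + x)) u m ≡ win g (d + u) m
win-shift g d u zero    = refl
win-shift g d u (suc m) = cong (g (d + u) +_)
  (trans (win-shift g d (suc u) m) (cong (λ v → win g v m) (+-suc d u)))

win-bound : ∀ {g} c u m → (∀ x → u ≤ x → x < m + u → g x ≤ c) → win g u m ≤ m * c
win-bound c u m g≤c = ≤-trans (win-mono u m g≤c) (≤-reflexive (win-const c u m))

win-exceeds : ∀ {g} c u m → m * c < win g u m → ∃ λ x → u ≤ x × x < m + u × c < g x
win-exceeds {g} c u (suc m) lt with suc c ≤? g u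
... | yes c<gu = u , ≤-refl , s≤s (m≤n+m u m) , c<gu
... | no  c≮gu with win-exceeds {g} c (suc u) m
                      (+-cancelˡ-< c _ _ (<-≤-trans lt (+-monoˡ-≤ _ (≮⇒≥ c≮gu))))
...   | x , u<x , x< , c<gx = x , <⇒≤ u<x , subst (x <_) (+-suc m u) x< , c<gx

-- Periodic functions

Periodic : ∀ {A : Set} → ℕ → (ℕ → A) → Set
Periodic ℓ g = ∀ x → g (ℓ + x) ≡ g x

win-suc : ∀ {g ℓ} → Periodic ℓ g → ∀ u → win g (suc u) ℓ ≡ win g u ℓ
win-suc {g} {ℓ} per u = +-cancelˡ-≡ (g u) _ _ (begin
  win g u (suc ℓ)               ≡⟨ cong (win g u) (+-comm 1 ℓ) ⟩
  win g u (ℓ + 1)               ≡⟨ win-++ g u ℓ 1 ⟩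
  win g u ℓ + (g (ℓ + u) + 0)   ≡⟨ cong (win g u ℓ +_) (trans (+-identityʳ _) (per u)) ⟩
  win g u ℓ + g u               ≡⟨ +-comm (win g u ℓ) (g u) ⟩
  g u + win g u ℓ               ∎)
  where open ≡-Reasoning

win-periodic : ∀ {g ℓ} → Periodic ℓ g → ∀ u → win g u ℓ ≡ win g 0 ℓ
win-periodic per zero    = refl
win-periodic per (suc u) = trans (win-suc per u) (win-periodic per u)

periodic-* : ∀ {A : Set} {g : ℕ → A} {ℓ} → Periodic ℓ g → ∀ q x → g (q * ℓ + x) ≡ g x
periodic-* per zero    x = refl
periodic-* {g = g} {ℓ} per (suc q) x =
  trans (cong g (+-assoc ℓ (q * ℓ) x)) (trans (per (q * ℓ + x)) (periodic-* per q x))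

periodic-% : ∀ {A : Set} {g : ℕ → A} {ℓ} .{{_ : NonZero ℓ}} → Periodic ℓ g → ∀ x → g x ≡ g (x % ℓ)
periodic-% {g = g} {ℓ} per x =
  trans (cong g (trans (m≡m%n+[m/n]*n x ℓ) (+-comm (x % ℓ) _))) (periodic-* per (x / ℓ) (x % ℓ))

-- Patterns in periodic sets, found by averaging

module Pattern {ℓ : ℕ} where

  count : (ℕ → Bool) → ℕ
  count α = win (λ x → ⟦ α x ⟧) 0 ℓ

  periodic-⟦⟧ : ∀ {α} → Periodic ℓ α → Periodic ℓ (λ x → ⟦ α x ⟧)
  periodic-⟦⟧ per x = cong ⟦_⟧ (per x)

  count-from : ∀ {α} → Periodic ℓ α → ∀ u → win (λ x → ⟦ α x ⟧) u ℓ ≡ count α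
  count-from per = win-periodic (periodic-⟦⟧ per)

  count-shift : ∀ {α} → Periodic ℓ α → ∀ d u → win (λ x → ⟦ α (d + x) ⟧) u ℓ ≡ count α
  count-shift {α} per d u = trans (win-shift (λ x → ⟦ α x ⟧) d u ℓ) (count-from per (d + u))

  count≤ : ∀ α → count α ≤ ℓ
  count≤ α = ≤-trans (win-bound 1 0 ℓ λ x _ _ → ⟦⟧≤1 (α x)) (≤-reflexive (*-identityʳ ℓ))

  pair? : ∀ b c → (b ≡ true × c ≡ true) ⊎ ⟦ b ⟧ + ⟦ c ⟧ ≤ 1
  pair? true  true  = inj₁ (refl , refl)
  pair? true  false = inj₂ ≤-refl
  pair? false c     = inj₂ (⟦⟧≤1 c)

  pair : ∀ {b c} → 1 < ⟦ b ⟧ + ⟦ c ⟧ → b ≡ true × c ≡ true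
  pair {b} {c} lt with pair? b c
  ... | inj₁ p = p
  ... | inj₂ q = contradiction q (<⇒≱ lt)

  triple : ∀ {b c d} → 2 < ⟦ b ⟧ + ⟦ c ⟧ + ⟦ d ⟧ → b ≡ true × c ≡ true × d ≡ true
  triple {true}  {true}  {true}  _ = refl , refl , refl
  triple {true}  {true}  {false} (s≤s (s≤s ()))
  triple {true}  {false} {true}  (s≤s (s≤s ()))
  triple {true}  {false} {false} (s≤s ())
  triple {false} {true}  {true}  (s≤s (s≤s ()))
  triple {false} {true}  {false} (s≤s ())
  triple {false} {false} {true}  (s≤s ())
  triple {false} {false} {false} ()

  module _ {α β : ℕ → Bool} (αᵖ : Periodic ℓ α) (βᵖ : Periodic ℓ β) where

    triple-sum : ∀ u → win (λ x → ⟦ α x ⟧ + ⟦ α (2 + x) ⟧ + ⟦ β (1 + x) ⟧) u ℓ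
                       ≡ count α + count α + count β
    triple-sum u = trans (win-+ (λ x → ⟦ α x ⟧ + ⟦ α (2 + x) ⟧) (λ x → ⟦ β (1 + x) ⟧) u ℓ)
      (cong₂ _+_ (trans (win-+ (λ x → ⟦ α x ⟧) (λ x → ⟦ α (2 + x) ⟧) u ℓ)
                        (cong₂ _+_ (count-from αᵖ u) (count-shift αᵖ 2 u)))
                 (count-shift βᵖ 1 u))

    find-triple : ℓ * 2 < count α + count α + count β →
                  ∃ λ u → α u ≡ true × β (1 + u) ≡ true × α (2 + u) ≡ true
    find-triple lt with win-exceeds 2 0 ℓ (subst (ℓ * 2 <_) (sym (triple-sum 0)) lt)
    ... | u , _ , _ , 2< with triple {α u} {α (2 + u)} 2<
    ...   | p , q , s = u , p , s , q

  module _ {α : ℕ → Bool} (αᵖ : Periodic ℓ α) where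

    pair-sum : ∀ d u → win (λ x → ⟦ α x ⟧ + ⟦ α (d + x) ⟧) u ℓ ≡ count α + count α
    pair-sum d u = trans (win-+ (λ x → ⟦ α x ⟧) (λ x → ⟦ α (d + x) ⟧) u ℓ)
      (cong₂ _+_ (count-from αᵖ u) (count-shift αᵖ d u))

    find-pair : ∀ d → ℓ * 1 < count α + count α → ∃ λ u → α u ≡ true × α (d + u) ≡ true
    find-pair d lt with win-exceeds 1 0 ℓ (subst (ℓ * 1 <_) (sym (pair-sum d 0)) lt)
    ... | u , _ , _ , 1< with pair {α u} 1<
    ...   | p , q = u , p , q

    seven-sum : win (λ x → win (λ y → ⟦ α y ⟧) x 7) 0 ℓ ≡ 7 * count α
    seven-sum = go 7 0
      where
      go : ∀ m d → win (λ x → win (λ y → ⟦ α y ⟧) (d + x) m) 0 ℓ ≡ m * count α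
      go zero    d = trans (win-const 0 0 ℓ) (*-zeroʳ ℓ)
      go (suc m) d = trans (win-+ (λ x → ⟦ α (d + x) ⟧) (λ x → win (λ y → ⟦ α y ⟧) (suc d + x) m) 0 ℓ)
        (cong₂ _+_ (count-shift αᵖ d 0) (go m (suc d)))

    opaque
      seven-bools : ∀ a b c d e f g → a + d ≤ 1 → d + g ≤ 1 → c + g ≤ 1 → c + f ≤ 1 → b + f ≤ 1 → b + e ≤ 1 →
        a + e ≤ 1 → 3 < a + (b + (c + (d + (e + (f + (g + 0)))))) → ⊥
      seven-bools a b c d e f g h1 h2 h3 h4 h5 h6 h7 h8 =
        1≰0 (linear 0 (h1 ⊕ h2 ⊕ h3 ⊕ h4 ⊕ h5 ⊕ h6 ⊕ h7 ⊕ 2 ⊗ h8) (solve (a ∷ b ∷ c ∷ d ∷ e ∷ f ∷ g ∷ [])))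

    -- Modulo 7 the differences 3 and 4 form a 7-cycle, whose independent sets have at most 3 elements.
    find-3-or-4 : ℓ * 3 < 7 * count α →
                  ∃ λ u → α u ≡ true × (α (3 + u) ≡ true ⊎ α (4 + u) ≡ true)
    find-3-or-4 lt with win-exceeds 3 0 ℓ (subst (ℓ * 3 <_) (sym seven-sum) lt)
    ... | u , _ , _ , 3< with pair? (α u) (α (3 + u)) | pair? (α (3 + u)) (α (6 + u))
                            | pair? (α (2 + u)) (α (6 + u)) | pair? (α (2 + u)) (α (5 + u))
                            | pair? (α (1 + u)) (α (5 + u)) | pair? (α (1 + u)) (α (4 + u))
                            | pair? (α u) (α (4 + u))
    ... | inj₁ (p , q) | _ | _ | _ | _ | _ | _ = u , p , inj₁ q
    ... | _ | inj₁ (p , q) | _ | _ | _ | _ | _ = 3 + u , p , inj₁ q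
    ... | _ | _ | inj₁ (p , q) | _ | _ | _ | _ = 2 + u , p , inj₂ q
    ... | _ | _ | _ | inj₁ (p , q) | _ | _ | _ = 2 + u , p , inj₁ q
    ... | _ | _ | _ | _ | inj₁ (p , q) | _ | _ = 1 + u , p , inj₂ q
    ... | _ | _ | _ | _ | _ | inj₁ (p , q) | _ = 1 + u , p , inj₁ q
    ... | _ | _ | _ | _ | _ | _ | inj₁ (p , q) = u , p , inj₂ q
    ... | inj₂ h1 | inj₂ h2 | inj₂ h3 | inj₂ h4 | inj₂ h5 | inj₂ h6 | inj₂ h7 = ⊥-elim
      (seven-bools ⟦ α u ⟧ ⟦ α (1 + u) ⟧ ⟦ α (2 + u) ⟧ ⟦ α (3 + u) ⟧ ⟦ α (4 + u) ⟧ ⟦ α (5 + u) ⟧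
        ⟦ α (6 + u) ⟧ h1 h2 h3 h4 h5 h6 h7 3<)

-- Searching in windows

⟦false⟧≤0 : ∀ {b} → b ≡ false → ⟦ b ⟧ ≤ 0
⟦false⟧≤0 refl = z≤n

find-in-window : ∀ {α : ℕ → Bool} u m → 0 < win (λ x → ⟦ α x ⟧) u m →
                 ∃ λ x → u ≤ x × x < m + u × α x ≡ true
find-in-window {α} u m lt with win-exceeds 0 u m (subst (_< win (λ x → ⟦ α x ⟧) u m) (sym (*-zeroʳ m)) lt)
... | x , u≤x , x< , pos = x , u≤x , x< , ⟦⟧>0 pos

find-first : ∀ (α : ℕ → Bool) d x → α (d + x) ≡ true →
             ∃ λ e → e ≤ d × α (e + x) ≡ true × (∀ e′ → e′ < e → α (e′ + x) ≡ false)
find-first α zero    x eq = 0 , z≤n , eq , λ _ ()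
find-first α (suc d) x eq with α x ≟ᵇ true
... | yes αx = 0 , z≤n , αx , λ _ ()
... | no ¬αx with find-first α d (suc x) (trans (cong α (+-suc d x)) eq)
...   | e , e≤d , αe , min = suc e , s≤s e≤d , trans (cong α (sym (+-suc e x))) αe , λ where
          zero     _        → ≢true ¬αx
          (suc e′) (s≤s lt) → trans (cong α (sym (+-suc e′ x))) (min e′ lt)

win-head : ∀ {α : ℕ → Bool} i v m → (∀ n → i ≤ n → n < m → α (n + v) ≡ false) →
           win (λ x → ⟦ α x ⟧) v m ≤ i
win-head {α} i v m none with ≤-total m i
... | inj₁ m≤i = ≤-trans (win-bound 1 v m λ x _ _ → ⟦⟧≤1 (α x))
                         (≤-trans (≤-reflexive (*-identityʳ m)) m≤i)
... | inj₂ i≤m with ≤⇒∃ i≤m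
...   | o , refl = begin
  win g v (i + o)               ≡⟨ win-++ g v i o ⟩
  win g v i + win g (i + v) o   ≤⟨ +-mono-≤ (win-bound 1 v i λ x _ _ → ⟦⟧≤1 (α x))
                                            (win-bound 0 (i + v) o zeros) ⟩
  i * 1 + o * 0                 ≡⟨ cong₂ _+_ (*-identityʳ i) (*-zeroʳ o) ⟩
  i + 0                         ≡⟨ +-identityʳ i ⟩
  i                             ∎
  where
  open ≤-Reasoning
  g = λ x → ⟦ α x ⟧
  zeros : ∀ x → i + v ≤ x → x < o + (i + v) → ⟦ α x ⟧ ≤ 0
  zeros x lo hi with ≤⇒∃ lo
  ... | d , refl = ⟦false⟧≤0 (trans (cong α (lemma i v d)) (none (i + d) (m≤m+n i d)
      (+-monoʳ-< i (+-cancelʳ-< (i + v) d o (subst (_< o + (i + v)) (+-comm (i + v) d) hi)))))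
    where
    opaque
      lemma : ∀ i v d → i + v + d ≡ i + d + v
      lemma i v d = solve (i ∷ v ∷ d ∷ [])

-- If no two elements of α span between i+1 and i+ρ+1 positions, then greedily
-- each stretch of i+ρ+1 positions after an element contains at most i of them.
find-span : ∀ (α : ℕ → Bool) i ρ c z v → z ≤ c * suc (i + ρ) → c * i < win (λ x → ⟦ α x ⟧) v z →
            ∃ λ x → ∃ λ n → v ≤ x × suc (n + x) ≤ z + v × i ≤ n × n ≤ i + ρ
                          × α x ≡ true × α (n + x) ≡ true
find-span α i ρ c zero    v z≤ ()
find-span α i ρ c (suc z) v z≤ lt with α v ≟ᵇ true
... | no ¬αv with find-span α i ρ c z (suc v) (<⇒≤ z≤)
                    (subst (λ b → c * i < ⟦ b ⟧ + win (λ x → ⟦ α x ⟧) (suc v) z) (≢true ¬αv) lt)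
...   | x , n , v<x , hi , rest = x , n , <⇒≤ v<x , subst (suc (n + x) ≤_) (+-suc z v) hi , rest
find-span α i ρ c (suc z) v z≤ lt | yes αv
  with anyUpTo? (λ n → (i ≤? n) ×-dec (n ≤? i + ρ) ×-dec (α (n + v) ≟ᵇ true)) (suc z)
... | yes (n , n<z , i≤n , n≤ , αn) = v , n , ≤-refl , +-monoˡ-≤ v n<z , i≤n , n≤ , αv , αn
find-span α i ρ zero    (suc z) v ()  lt | yes αv | no none
find-span α i ρ (suc c) (suc z) v z≤ lt | yes αv | no none with suc z ≤? suc (i + ρ)
... | yes z≤N = contradiction lt (≤⇒≯ (≤-trans
        (win-head i v (suc z) λ n i≤n n<z →
          ≢true λ αn → none (n , n<z , i≤n , ≤-pred (≤-trans n<z z≤N) , αn))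
        (m≤m+n i (c * i))))
... | no  z≰N with ≤⇒∃ (<⇒≤ (≰⇒> z≰N))
...   | o , eq with find-span α i ρ c o (suc (i + ρ) + v)
                      (+-cancelˡ-≤ (suc (i + ρ)) _ _ (subst (_≤ suc (i + ρ) + c * suc (i + ρ)) (sym eq) z≤))
                      (+-cancelˡ-< i _ _ (<-≤-trans lt (begin
                        win g v (suc z)                       ≡⟨ cong (win g v) (sym eq) ⟩
                        win g v (suc (i + ρ) + o)             ≡⟨ win-++ g v (suc (i + ρ)) o ⟩
                        win g v (suc (i + ρ)) + win g (suc (i + ρ) + v) o
                          ≤⟨ +-monoˡ-≤ _ (win-head i v (suc (i + ρ)) λ n i≤n n≤ →
                               ≢true λ αn → none (n , <-≤-trans n≤ (<⇒≤ (≰⇒> z≰N)) , i≤n , ≤-pred n≤ , αn)) ⟩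
                        i + win g (suc (i + ρ) + v) o         ∎)))
  where
  open ≤-Reasoning
  g = λ x → ⟦ α x ⟧
...     | x , n , lo , hi , rest = x , n , ≤-trans (m≤n+m v _) lo ,
            subst (suc (n + x) ≤_) (trans (lemma (suc (i + ρ)) o v) (cong (_+ v) eq)) hi , rest
  where
  opaque
    lemma : ∀ N o v → o + (N + v) ≡ N + o + v
    lemma N o v = solve (N ∷ o ∷ v ∷ [])

-- Periodic sets that avoid an interval of distances

opaque
  +-exchange : ∀ d ℓ x → d + (ℓ + x) ≡ ℓ + (d + x)
  +-exchange d ℓ x = solve (d ∷ ℓ ∷ x ∷ [])

  sumset-eq₁ : ∀ κ o → 1 + (κ * 0 + o * 1) + κ ≡ suc κ + o
  sumset-eq₁ κ o = solve (κ ∷ o ∷ [])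

  sumset-eq₂ : ∀ j u d → j + (suc u + d) ≡ j + suc d + u
  sumset-eq₂ j u d = solve (j ∷ u ∷ d ∷ [])

  +-pull : ∀ e j b → e + (j + b) ≡ j + e + b
  +-pull e j b = solve (e ∷ j ∷ b ∷ [])

  second-block-eq₁ : ∀ j e′ → 2 + (2 + j + (e′ + (2 + j))) ≡ 2 + j + (2 + e′ + (2 + j))
  second-block-eq₁ j e′ = solve (j ∷ e′ ∷ [])

  second-block-eq₂ : ∀ j e n → 2 + j + (e + (2 + j)) + n ≡ 2 + j + (e + (2 + j + n))
  second-block-eq₂ j e n = solve (j ∷ e ∷ n ∷ [])

  first-gap-eq₁ : ∀ j ρ o d → 2 + j + (ρ + o) + d ≡ d + (j + (2 + ρ + o))
  first-gap-eq₁ j ρ o d = solve (j ∷ ρ ∷ o ∷ d ∷ [])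

  first-gap-eq₂ : ∀ j ρ o d → 2 + (2 + j + (ρ + o) + d) ≡ 2 + d + (j + (2 + ρ + o))
  first-gap-eq₂ j ρ o d = solve (j ∷ ρ ∷ o ∷ d ∷ [])

  +-swapʳ : ∀ l o d → l + o + d ≡ l + (d + o)
  +-swapʳ l o d = solve (l ∷ o ∷ d ∷ [])

  last-gap-eq₁ : ∀ j e ρ o d → 2 + j + (e + (2 + j + (ρ + o))) + d ≡ d + (j + (2 + e + (j + (2 + ρ + o))))
  last-gap-eq₁ j e ρ o d = solve (j ∷ e ∷ ρ ∷ o ∷ d ∷ [])

  last-gap-eq₂ : ∀ j e ρ o d → 2 + (2 + j + (e + (2 + j + (ρ + o))) + d) ≡ 2 + d + (j + (2 + e + (j + (2 + ρ + o))))
  last-gap-eq₂ j e ρ o d = solve (j ∷ e ∷ ρ ∷ o ∷ d ∷ [])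

  last-gap-eq₃ : ∀ j e ρ o n → 2 + n + (j + (2 + e + (j + (2 + ρ + o)))) ≡ (2 + j + (e + (2 + j)) + n) + (2 + ρ + o)
  last-gap-eq₃ j e ρ o n = solve (j ∷ e ∷ ρ ∷ o ∷ n ∷ [])

  +-rotate : ∀ l q o → l + (q + o) ≡ l + o + q
  +-rotate l q o = solve (l ∷ q ∷ o ∷ [])

  first-block-eq₁ : ∀ e j b → 2 + e + (j + b) ≡ 2 + j + e + b
  first-block-eq₁ e j b = solve (e ∷ j ∷ b ∷ [])

  first-block-eq₂ : ∀ j e → 2 + j + e ≡ j + (2 + e)
  first-block-eq₂ j e = solve (j ∷ e ∷ [])

periodic-shift : ∀ {A : Set} {g : ℕ → A} {ℓ} → Periodic ℓ g → ∀ d → Periodic ℓ (λ x → g (d + x))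
periodic-shift {g = g} {ℓ} per d x = trans (cong g (lemma d ℓ x)) (per (d + x))
  where
  lemma = +-exchange

module Circle {ℓ : ℕ} .{{_ : NonZero ℓ}} where
  open Pattern {ℓ}

  -- The elements of β and their translates by j, …, j+κ are disjoint, and the union of
  -- the latter exceeds β by κ since some element has a gap of length κ behind it.
  sumset : ∀ {β : ℕ → Bool} → Periodic ℓ β → ∀ j κ → j ≤ ℓ → suc κ ≤ ℓ → 0 < count β →
           (∀ u m → j ≤ m → m ≤ j + κ → β u ≡ true → β (m + u) ≡ false) →
           count β + count β + κ ≤ ℓ
  sumset {β} βᵖ j κ j≤ℓ κ<ℓ pos avoid
    with anyUpTo? (λ u → (β u ≟ᵇ true) ×-dec allUpTo? (λ e → β (suc e + u) ≟ᵇ false) κ) ℓ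
  ... | yes (u , _ , βu , gap) with ≤⇒∃ κ<ℓ
  ...   | o , refl = begin
    count β + count β + κ                                      ≡⟨ cong (_+ κ) (sym (pair-sum βᵖ j u)) ⟩
    win g u (1 + (κ + o)) + κ                                  ≡⟨ cong (λ s → g u + s + κ) (win-++ g (suc u) κ o) ⟩
    g u + (win g (suc u) κ + win g (κ + suc u) o) + κ
      ≤⟨ +-monoˡ-≤ κ (+-mono-≤ (one u) (+-mono-≤ (win-bound 0 (suc u) κ zeros) (win-bound 1 (κ + suc u) o λ x _ _ → one x))) ⟩
    1 + (κ * 0 + o * 1) + κ                                    ≡⟨ arith κ o ⟩
    suc κ + o                                                  ∎
    where
    open ≤-Reasoning
    g = λ x → ⟦ β x ⟧ + ⟦ β (j + x) ⟧
    arith = sumset-eq₁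
    one : ∀ x → g x ≤ 1
    one x with pair? (β x) (β (j + x))
    ... | inj₁ (βx , βjx) = ⊥-elim (true≢false βjx (avoid x j ≤-refl (m≤m+n j κ) βx))
    ... | inj₂ le = le
    zeros : ∀ x → suc u ≤ x → x < κ + suc u → g x ≤ 0
    zeros x lo hi with ≤⇒∃ lo
    ... | d , refl = +-mono-≤
        (⟦false⟧≤0 (trans (cong β (+-comm (suc u) d)) (trans (cong β (+-suc d u)) (gap d<κ))))
        (⟦false⟧≤0 (trans (cong β (reassoc j u d)) (avoid u (j + suc d) (m≤m+n j (suc d)) (+-monoʳ-≤ j d<κ) βu)))
      where
      d<κ : d < κ
      d<κ = +-cancelʳ-< (suc u) d κ (subst (_< κ + suc u) (+-comm (suc u) d) hi)
      reassoc = sumset-eq₂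
  -- Without such a gap one can hop along β in steps of at most κ, so some element u lies at most κ
  -- before position b + (ℓ - j). Its distance to the element b + ℓ is then between j and j + κ,
  -- which is forbidden.
  sumset {β} βᵖ j κ j≤ℓ κ<ℓ pos avoid | no none with find-in-window {β} 0 ℓ pos
  ... | b , _ , _ , βb = ⊥-elim (contra (ℓ ∸ j) (m+[n∸m]≡n j≤ℓ))
    where
    step : ∀ u → β u ≡ true → ∃ λ e → e < κ × β (suc e + u) ≡ true
    step u βu with anyUpTo? (λ e → β (suc e + u) ≟ᵇ true) κ
    ... | yes p = p
    ... | no ¬p = ⊥-elim (none (u % ℓ , m%n<n u ℓ , trans (sym (periodic-% βᵖ u)) βu , λ {e} e<κ →
            trans (sym (periodic-% (periodic-shift βᵖ (suc e)) u)) (≢true λ βe → ¬p (e , e<κ , βe))))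
    cover : ∀ n → ∃ λ u → β u ≡ true × u ≤ n + b × n + b ≤ κ + u
    cover zero    = b , βb , ≤-refl , m≤n+m b κ
    cover (suc n) with cover n
    ... | u , βu , lo , hi with suc n + b ≤? κ + u
    ...   | yes le = u , βu , ≤-trans lo (n≤1+n (n + b)) , le
    ...   | no ≰ with step u βu
    ...     | e , e<κ , βe = suc e + u , βe ,
                ≤-trans (+-monoˡ-≤ u e<κ) (<⇒≤ (≰⇒> ≰)) ,
                ≤-trans (s≤s hi) (≤-trans (s≤s (+-monoʳ-≤ κ (m≤n+m u e))) (≤-reflexive (sym (+-suc κ (e + u)))))
    contra : ∀ n → j + n ≡ ℓ → ⊥
    contra n eq with cover n
    ... | u , βu , lo , hi with ≤⇒∃ lo
    ...   | d , eqd = true≢false (trans (βᵖ b) βb) (trans (cong β pos-eq)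
              (avoid u (j + d) (m≤m+n j d) (+-monoʳ-≤ j d≤κ) βu))
      where
      d≤κ : d ≤ κ
      d≤κ = +-cancelʳ-≤ u d κ (≤-trans (≤-reflexive (trans (+-comm d u) eqd)) hi)
      pos-eq : ℓ + b ≡ j + d + u
      pos-eq = trans (cong (_+ b) (sym eq)) (trans (+-assoc j n b) (trans (cong (j +_) (trans (sym eqd) (+-comm u d))) (sym (+-assoc j d u))))

  opaque
    two-blocks-arith : ∀ j e o G₁ G₂ G₃ G₄ → G₁ ≤ (2 + j) * 2 → G₂ ≤ e * 1 → G₃ ≤ (2 + j) * 2 → G₄ ≤ o * 1 →
      G₁ + (G₂ + (G₃ + G₄)) ≤ (2 + j + (e + (2 + j + o))) + 2 * (2 + j)
    two-blocks-arith j e o G₁ G₂ G₃ G₄ h1 h2 h3 h4 =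
      linear 0 (h1 ⊕ h2 ⊕ h3 ⊕ h4) (solve (j ∷ e ∷ o ∷ G₁ ∷ G₂ ∷ G₃ ∷ G₄ ∷ []))

    one-block-arith : ∀ j e G₁ G₂ → G₁ ≤ (2 + j) * 2 → G₂ ≤ e * 1 → G₁ + G₂ ≤ (2 + j + e) + 2 * (2 + j)
    one-block-arith j e G₁ G₂ h1 h2 =
      linear (j + 2) (h1 ⊕ h2) (solve (j ∷ e ∷ G₁ ∷ G₂ ∷ []))

    second-block-fits : ∀ e j ρ b o l → e + (j + b) < l + o → b ≡ suc ρ + o → j ≤ ρ → 2 ≤ e →
      (2 + j + (e + (2 + j))) ≤ l + 2
    second-block-fits e j ρ b o l h1 h2 h3 _ =
      linear 0 (h1 ⊕ ≤-reflexive (sym h2) ⊕ h3) (solve (e ∷ j ∷ ρ ∷ b ∷ o ∷ l ∷ []))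

    beyond-second-block : ∀ D e j ρ o l → suc ρ ≤ D → suc ρ ≤ e → l ≤ 3 * ρ + 2 →
      l + o ≤ D + (j + (e + (j + (suc ρ + o))))
    beyond-second-block D e j ρ o l h1 h2 h3 =
      linear (2 * j + 1) (h1 ⊕ h2 ⊕ h3) (solve (D ∷ e ∷ j ∷ ρ ∷ o ∷ l ∷ []))

  -- β lies in two blocks of j consecutive positions, so x or x+2 lies in β for at most 2(j+2) values of x.
  two-blocks : ∀ {α β : ℕ → Bool} → Periodic ℓ α → Periodic ℓ β → ∀ j ρ →
               j ≤ suc ρ → j ≤ ℓ → ℓ ≤ 3 * suc ρ + 2 → 0 < count β →
               (∀ u → ⟦ β u ⟧ + ⟦ β (2 + u) ⟧ + ⟦ α (1 + u) ⟧ ≤ 2) →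
               (∀ u m → j ≤ m → m ≤ j + suc ρ → β u ≡ true → β (m + u) ≡ false) →
               count β + count β + count α ≤ ℓ + 2 * (2 + j)
  two-blocks {α} {β} αᵖ βᵖ j ρ j≤ρ j≤ℓ ℓ≤ pos two avoid = result (proj₁ origin) (proj₁ (proj₂ origin)) (proj₂ (proj₂ origin))
    where
    open ≤-Reasoning
    -- The first element at or after `j + b` opens a new block: `avoid` pushes it more than `suc ρ`
    -- further, and by periodicity it comes no later than `ℓ + b`.
    next : ∀ b → β b ≡ true → ∃ λ e → suc ρ < e × j + e ≤ ℓ × β (e + (j + b)) ≡ true
                                   × (∀ d → d < e → β (d + (j + b)) ≡ false)
    next b βb with find-first β (ℓ ∸ j) (j + b) (trans (cong β (trans (sym (+-assoc (ℓ ∸ j) j b)) (cong (_+ b) (m∸n+n≡m j≤ℓ)))) (trans (βᵖ b) βb))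
    ... | e , e≤ , βe , min with suc (suc ρ) ≤? e
    ...   | yes lt = e , lt , ≤-trans (+-monoʳ-≤ j e≤) (≤-reflexive (m+[n∸m]≡n j≤ℓ)) , βe , min
    ...   | no  ≮ = ⊥-elim (true≢false βe (trans (cong β (lemma e j b))
              (avoid b (j + e) (m≤m+n j e) (+-monoʳ-≤ j (≤-pred (≰⇒> ≮))) βb)))
      where
      lemma = +-pull

    -- A block start with `2 + ρ` free positions before it. Positions are measured from the
    -- beginning `o` of this gap, which avoids subtraction.
    origin : ∃ λ o → β (suc (suc ρ) + o) ≡ true × (∀ d → d ≤ suc ρ → β (d + o) ≡ false)
    origin with find-in-window {β} 0 ℓ pos
    ... | b , _ , _ , βb with next b βb
    ...   | e , ρ<e , _ , βe , min with ≤⇒∃ ρ<e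
    ...     | o , refl = o + (j + b) , trans (cong β (sym (+-assoc (suc (suc ρ)) o (j + b)))) βe ,
                λ d d≤ → trans (cong β (sym (+-assoc d o (j + b)))) (min (d + o) (+-monoˡ-≤ o (s≤s d≤)))

    module _ (o : ℕ) (βb : β (suc (suc ρ) + o) ≡ true) (gap : ∀ d → d ≤ suc ρ → β (d + o) ≡ false) where
      b = suc (suc ρ) + o
      x₀ = ρ + o
      g = λ x → ⟦ β x ⟧ + ⟦ β (2 + x) ⟧ + ⟦ α (1 + x) ⟧

      quiet : ∀ x → β x ≡ false → β (2 + x) ≡ false → g x ≤ 1
      quiet x p q = +-mono-≤ (+-mono-≤ (⟦false⟧≤0 p) (⟦false⟧≤0 q)) (⟦⟧≤1 (α (1 + x)))

      result : count β + count β + count α ≤ ℓ + 2 * (2 + j)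
      result with next b βb
      ... | e , ρ<e , e≤ , βe , min with ≤⇒∃ (≤-trans (s≤s (s≤s z≤n)) ρ<e)
      ...   | e′ , refl with (2 + e′) + (j + b) <? ℓ + o
      ...     | yes inside with ≤⇒∃ {2 + j + (e′ + (2 + j))} {ℓ}
                    (≤-pred (≤-pred (≤-trans (≤-reflexive (lemma j e′)) (≤-trans (second-block-fits (2 + e′) j (suc ρ) b o ℓ inside refl j≤ρ (s≤s (s≤s z≤n)))  (≤-reflexive (+-comm ℓ 2))))))
        where
        lemma = second-block-eq₁
      ...       | n , eqn = begin
        count β + count β + count α         ≡⟨ sym (triple-sum βᵖ αᵖ x₀) ⟩
        win g x₀ ℓ                          ≡⟨ cong (win g x₀) (trans (sym eqn) (assoc j e′ n)) ⟩
        win g x₀ (n₁ + (e′ + (n₁ + n)))     ≡⟨ win-++ g x₀ n₁ (e′ + (n₁ + n)) ⟩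
        win g x₀ n₁ + win g (n₁ + x₀) (e′ + (n₁ + n))
                                            ≡⟨ cong (win g x₀ n₁ +_) (trans (win-++ g (n₁ + x₀) e′ (n₁ + n))
                                                  (cong (win g (n₁ + x₀) e′ +_) (win-++ g (e′ + (n₁ + x₀)) n₁ n))) ⟩
        win g x₀ n₁ + (win g (n₁ + x₀) e′ + (win g (e′ + (n₁ + x₀)) n₁ + win g (n₁ + (e′ + (n₁ + x₀))) n))
          ≤⟨ two-blocks-arith j e′ n _ _ _ _
               (win-bound 2 x₀ n₁ λ x _ _ → two x)
               (win-bound 1 (n₁ + x₀) e′ λ x lo hi → first-gap x lo hi)
               (win-bound 2 (e′ + (n₁ + x₀)) n₁ λ x _ _ → two x)
               (win-bound 1 (n₁ + (e′ + (n₁ + x₀))) n last-gap) ⟩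
        (n₁ + (e′ + (n₁ + n))) + 2 * (2 + j) ≡⟨ cong (_+ 2 * (2 + j)) (trans (sym (assoc j e′ n)) eqn) ⟩
        ℓ + 2 * (2 + j)                     ∎
        where
        n₁ = 2 + j
        assoc = second-block-eq₂
        first-gap : ∀ x → n₁ + x₀ ≤ x → x < e′ + (n₁ + x₀) → g x ≤ 1
        first-gap x lo hi with ≤⇒∃ lo
        ... | d , refl = quiet _ (trans (cong β (eq₁ j ρ o d)) (min d (≤-trans d<e (m≤n+m e′ 2))))
                                 (trans (cong β (eq₂ j ρ o d)) (min (2 + d) (s≤s (s≤s d<e))))
          where
          d<e : d < e′
          d<e = +-cancelʳ-< (n₁ + x₀) d e′ (subst (_< e′ + (n₁ + x₀)) (+-comm (n₁ + x₀) d) hi)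
          eq₁ = first-gap-eq₁
          eq₂ = first-gap-eq₂
        b₂ = (2 + e′) + (j + b)
        -- A third block would make three gaps of at least `2 + ρ` positions, more than
        -- `ℓ ≤ 3 * suc ρ + 2` allows. Past the second block there is only the gap that precedes the
        -- first.
        after : ∀ D → D + (j + b₂) < ℓ + b → β (D + (j + b₂)) ≡ false
        after D lt with D ≤? suc ρ
        ... | yes le = trans (cong β (reassoc D j b₂)) (avoid b₂ (j + D) (m≤m+n j D) (+-monoʳ-≤ j le) βe)
          where
          reassoc = +-pull
        ... | no ≰ with ≤⇒∃ (beyond-second-block D (2 + e′) j (suc ρ) o ℓ (≰⇒> ≰) ρ<e ℓ≤)
        ...   | d , eqd = trans (cong β (trans (sym eqd) (reassoc ℓ o d))) (trans (βᵖ (d + o)) (gap d d≤))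
          where
          reassoc = +-swapʳ
          d≤ : d ≤ suc ρ
          d≤ = ≤-pred (+-cancelʳ-≤ o _ _ (+-cancelˡ-≤ ℓ _ _
                 (≤-trans (≤-reflexive (trans (+-suc ℓ (d + o)) (cong suc (trans (sym (reassoc ℓ o d)) eqd)))) lt)))
        last-gap : ∀ x → n₁ + (e′ + (n₁ + x₀)) ≤ x → x < n + (n₁ + (e′ + (n₁ + x₀))) → g x ≤ 1
        last-gap x lo hi with ≤⇒∃ lo
        ... | d , refl = quiet _
            (trans (cong β (eq₁ j e′ ρ o d)) (after d (≤-trans (s≤s (m≤n+m _ 2)) bound)))
            (trans (cong β (eq₂ j e′ ρ o d)) (after (2 + d) bound))
          where
          d<n : d < n
          d<n = +-cancelʳ-< (n₁ + (e′ + (n₁ + x₀))) d n (subst (_< n + (n₁ + (e′ + (n₁ + x₀)))) (+-comm (n₁ + (e′ + (n₁ + x₀))) d) hi)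
          eq₁ = last-gap-eq₁
          eq₂ = last-gap-eq₂
          eq₃ = last-gap-eq₃
          bound : 2 + d + (j + b₂) < ℓ + b
          bound = ≤-trans (s≤s (s≤s (+-monoˡ-≤ (j + b₂) d<n))) (≤-reflexive (trans (eq₃ j e′ ρ o n) (cong (_+ b) eqn)))
      result | e , ρ<e , e≤ , βe , min | e′ , refl | no outside = begin
        count β + count β + count α         ≡⟨ sym (triple-sum βᵖ αᵖ x₀) ⟩
        win g x₀ ℓ                          ≡⟨ cong (win g x₀) ℓ-eq ⟩
        win g x₀ (n₁ + e′)                  ≡⟨ win-++ g x₀ n₁ e′ ⟩
        win g x₀ n₁ + win g (n₁ + x₀) e′    ≤⟨ one-block-arith j e′ _ _
               (win-bound 2 x₀ n₁ λ x _ _ → two x)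
               (win-bound 1 (n₁ + x₀) e′ λ x lo hi → first-gap x lo hi) ⟩
        n₁ + e′ + 2 * (2 + j)               ≡⟨ cong (_+ 2 * (2 + j)) (sym ℓ-eq) ⟩
        ℓ + 2 * (2 + j)                     ∎
        where
        n₁ = 2 + j
        -- the block found is the first one again
        ℓ-eq : ℓ ≡ 2 + j + e′
        ℓ-eq with ≤⇒∃ (≮⇒≥ outside)
        ... | d , eqd with suc (suc ρ) ≤? d
        ...   | no  ≰ = ⊥-elim (true≢false βe (trans (cong β (trans (sym eqd) (reassoc ℓ o d))) (trans (βᵖ (d + o)) (gap d (≤-pred (≰⇒> ≰))))))
          where
          reassoc = +-swapʳ
        ...   | yes le = ≤-antisym (+-cancelʳ-≤ b _ _ (≤-trans (≤-trans (≤-reflexive (eq₁ ℓ (2 + ρ) o)) (+-monoʳ-≤ (ℓ + o) le)) (≤-reflexive (trans eqd (eq₂ e′ j b)))))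
                     (≤-trans (≤-reflexive (eq₃ j e′)) e≤)
          where
          eq₁ = +-rotate
          eq₂ = first-block-eq₁
          eq₃ = first-block-eq₂
        first-gap : ∀ x → n₁ + x₀ ≤ x → x < e′ + (n₁ + x₀) → g x ≤ 1
        first-gap x lo hi with ≤⇒∃ lo
        ... | d , refl = quiet _ (trans (cong β (eq₁ j ρ o d)) (min d (≤-trans d<e (m≤n+m e′ 2))))
                                 (trans (cong β (eq₂ j ρ o d)) (min (2 + d) (s≤s (s≤s d<e))))
          where
          d<e : d < e′
          d<e = +-cancelʳ-< (n₁ + x₀) d e′ (subst (_< e′ + (n₁ + x₀)) (+-comm (n₁ + x₀) d) hi)
          eq₁ = first-gap-eq₁
          eq₂ = first-gap-eq₂

-- Sets that keep away from a given point of a cycle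

opaque
  ends-arith : ∀ w x G₁ G₂ G₃ G₄ G₅ → G₁ ≤ 1 → G₂ ≤ w * 0 → G₃ ≤ x * 1 → G₄ ≤ w * 0 → G₅ ≤ 1 * 1 →
    G₁ + (G₂ + (G₃ + (G₄ + G₅))) + 2 * suc w ≤ (suc w + suc w + x) + 2
  ends-arith w x G₁ G₂ G₃ G₄ G₅ h1 h2 h3 h4 h5 =
    linear 0 (h1 ⊕ h2 ⊕ h3 ⊕ h4 ⊕ h5) (solve (w ∷ x ∷ G₁ ∷ G₂ ∷ G₃ ∷ G₄ ∷ G₅ ∷ []))

  ends-split : ∀ w x → suc w + suc w + x ≡ 1 + (w + (x + (w + 1)))
  ends-split w x = solve (w ∷ x ∷ [])

  ends-first : ∀ d w x → d < w → suc d < suc w + suc w + x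
  ends-first d w x h1 =
    linear (w + x + 1) (h1) (solve (d ∷ w ∷ x ∷ []))
  ends-last : ∀ d w x → d < w → w + suc x + d < suc w + suc w + x
  ends-last d w x h1 =
    linear 1 (h1) (solve (d ∷ w ∷ x ∷ []))
  ends-last′ : ∀ d w x → d < w → suc w + suc w + x ≤ w + suc x + d + suc w
  ends-last′ d w x _ =
    linear d (z≤n {0}) (solve (d ∷ w ∷ x ∷ []))

  ends-pos₁ : ∀ y d → suc (suc y + d) ≡ suc (suc d) + y
  ends-pos₁ y d = solve (y ∷ d ∷ [])

  ends-pos₂ : ∀ x w y d → x + (w + suc y) + d ≡ w + suc x + d + y
  ends-pos₂ x w y d = solve (x ∷ w ∷ y ∷ d ∷ [])

  ends-pos₃ : ∀ x w y d → 1 + (x + (w + suc y) + d) ≡ w + suc x + suc d + y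
  ends-pos₃ x w y d = solve (x ∷ w ∷ y ∷ d ∷ [])

  ends-next : ∀ d w x → d < w → w + suc x + suc d < suc w + suc w + x
  ends-next d w x h1 =
    linear 0 (h1) (solve (d ∷ w ∷ x ∷ []))
  ends-next′ : ∀ d w x → d < w → suc w + suc w + x ≤ w + suc x + suc d + suc w
  ends-next′ d w x _ =
    linear (1 + d) (z≤n {0}) (solve (d ∷ w ∷ x ∷ []))

module Ends {p : ℕ} where
  open Pattern {p}

  -- The point y itself may lie in η, but the `suc w` positions on either side of it do not. Hence
  -- η(x) + η(x+1) vanishes at 2w positions of a period and is at most 1 at the others. If the two
  -- sides overlap, only y can lie in η, against `2 ≤ count η`.
  ends-bound : ∀ {η : ℕ → Bool} → Periodic p η → ∀ w y →
               (∀ D → 1 ≤ D → D < p → (D ≤ suc w ⊎ p ≤ D + suc w) → η (D + y) ≡ false) →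
               (∀ u → ⟦ η u ⟧ + ⟦ η (1 + u) ⟧ ≤ 1) →
               2 ≤ count η → count η + count η + 2 * suc w ≤ p + 2
  ends-bound {η} ηᵖ w y far apart two with suc w + suc w ≤? p
  ... | no ≰ = contradiction (≤-trans two (≤-trans (≤-reflexive (sym (count-from ηᵖ y)))
          (win-head 1 y p λ D 1≤D D<p → far D 1≤D D<p (near D D<p)))) (λ { (s≤s ()) })
    where
    near : ∀ D → D < p → D ≤ suc w ⊎ p ≤ D + suc w
    near D D<p with D ≤? suc w
    ... | yes le = inj₁ le
    ... | no gt = inj₂ (≤-trans (<⇒≤ (≰⇒> ≰)) (+-monoˡ-≤ (suc w) (<⇒≤ (≰⇒> gt))))
  ... | yes le with ≤⇒∃ le
  ...   | x , refl = begin
    count η + count η + 2 * suc w                   ≡⟨ cong (_+ 2 * suc w) (sym (pair-sum ηᵖ 1 y)) ⟩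
    win g y (suc w + suc w + x) + 2 * suc w         ≡⟨ cong (λ m → win g y m + 2 * suc w) (ends-split w x) ⟩
    g y + win g (suc y) (w + (x + (w + 1))) + 2 * suc w
      ≡⟨ cong (λ s → g y + s + 2 * suc w) (trans (win-++ g (suc y) w (x + (w + 1)))
           (cong (win g (suc y) w +_) (trans (win-++ g (w + suc y) x (w + 1))
             (cong (win g (w + suc y) x +_) (win-++ g (x + (w + suc y)) w 1))))) ⟩
    g y + (win g (suc y) w + (win g (w + suc y) x + (win g (x + (w + suc y)) w + win g (w + (x + (w + suc y))) 1))) + 2 * suc w
      ≤⟨ ends-arith w x (g y) _ _ _ _ (apart y) (win-bound 0 (suc y) w low) (win-bound 1 (w + suc y) x λ v _ _ → apart v)
           (win-bound 0 (x + (w + suc y)) w high) (win-bound 1 _ 1 λ v _ _ → apart v) ⟩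
    (suc w + suc w + x) + 2                         ∎
    where
    open ≤-Reasoning
    g = λ x → ⟦ η x ⟧ + ⟦ η (1 + x) ⟧
    low : ∀ v → suc y ≤ v → v < w + suc y → g v ≤ 0
    low v lo hi with ≤⇒∃ lo
    ... | d , refl = +-mono-≤
        (⟦false⟧≤0 (trans (cong (η ∘ suc) (+-comm y d)) (far (suc d) (s≤s z≤n) (ends-first d w x d<w) (inj₁ (s≤s (<⇒≤ d<w))))))
        (⟦false⟧≤0 (trans (cong η (ends-pos₁ y d)) (far (suc (suc d)) (s≤s z≤n)
          (≤-trans (s≤s (s≤s d<w)) (≤-trans (s≤s (m≤n+m (suc w) w)) (m≤m+n (suc w + suc w) x))) (inj₁ (s≤s d<w)))))
      where
      d<w : d < w
      d<w = +-cancelʳ-< (suc y) d w (subst (_< w + suc y) (+-comm (suc y) d) hi)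
    high : ∀ v → x + (w + suc y) ≤ v → v < w + (x + (w + suc y)) → g v ≤ 0
    high v lo hi with ≤⇒∃ lo
    ... | d , refl = +-mono-≤
        (⟦false⟧≤0 (trans (cong η (ends-pos₂ x w y d)) (far (w + suc x + d) (≤-trans (≤-trans (s≤s z≤n) (m≤n+m (suc x) w)) (m≤m+n _ d)) (ends-last d w x d<w) (inj₂ (ends-last′ d w x d<w)))))
        (⟦false⟧≤0 (trans (cong η (ends-pos₃ x w y d)) (far (w + suc x + suc d) (≤-trans (≤-trans (s≤s z≤n) (m≤n+m (suc x) w)) (m≤m+n _ (suc d))) (ends-next d w x d<w) (inj₂ (ends-next′ d w x d<w)))))
      where
      d<w : d < w
      d<w = +-cancelʳ-< (x + (w + suc y)) d w (subst (_< w + (x + (w + suc y))) (+-comm (x + (w + suc y)) d) hi)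

-- The exchanges possible on an r-cycle, whose vertices adjacent to the closing edges of the partial
-- cycles of sizes r−i−1 and r−j−1 are marked by α and β respectively.
data Exchange (r ρ i j : ℕ) (α β : ℕ → Bool) : Set where
  swapping  : ∀ u → β u ≡ true → α (1 + u) ≡ true → β (2 + u) ≡ true → Exchange r ρ i j α β
  shifting : ∀ u v → β u ≡ true → β (j + u) ≡ true → suc (j + u) ≤ v → v < r + u → α v ≡ true →
          Exchange r ρ i j α β
  splitting : ∀ u m v n → β u ≡ true → β (m + u) ≡ true → j ≤ m → m ≤ j + ρ →
          suc (m + u) ≤ v → suc (n + v) ≤ r + u → α v ≡ true → α (n + v) ≡ true →
          i ≤ n → n ≤ i + ρ → Exchange r ρ i j α β

-- Finding an exchange on a cycle of r positions

opaque
  ex-shift : ∀ a r j x y → x + y ≡ a → x ≤ suc j * 1 → 3 * r + 2 ≤ 5 * a → 2 * suc j + 3 ≤ r → 0 < y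
  ex-shift a r j x y h1 h2 h3 h4 =
    *-cancelˡ-≤ 12 (linear (7 * y + j) (5 ⊗ ≤-reflexive (sym h1) ⊕ 5 ⊗ h2 ⊕ h3 ⊕ 3 ⊗ h4)
      (solve (a ∷ r ∷ j ∷ x ∷ y ∷ [])))
  ex-bound : ∀ a r j i → r + 2 + 2 * suc j + suc i ≤ r + a → i ≤ j → 2 * suc i + j ≤ a
  ex-bound a r j i h1 h2 =
    linear 3 (h1 ⊕ h2) (solve (a ∷ r ∷ j ∷ i ∷ []))
  ex-long : ∀ a i j b r l → b + b + l ≤ r → j + l + 2 * suc i ≡ a → r + 2 + 2 * suc j + suc i ≤ b + b + a →
    i ≤ j → ⊥
  ex-long a i j b r l h1 h2 h3 h4 =
    1≰0 (*-cancelˡ-≤ 3 (linear 0 (h1 ⊕ ≤-reflexive (sym h2) ⊕ h3 ⊕ h4) (solve (a ∷ i ∷ j ∷ b ∷ r ∷ l ∷ []))))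
  ex-room : ∀ a b r ρ i j → b + b + ρ ≤ r → a ≤ r → r + 2 + 2 * suc j + suc i ≤ b + b + a →
    2 * suc j + suc i + 2 + ρ ≤ r
  ex-room a b r ρ i j h1 h2 h3 =
    linear 0 (h1 ⊕ h2 ⊕ h3) (solve (a ∷ b ∷ r ∷ ρ ∷ i ∷ j ∷ []))
  ex-j≤ρ : ∀ r ρ i j → 2 * suc j + suc i + 2 + ρ ≤ r → r ≤ 3 * ρ + 2 → j ≤ ρ
  ex-j≤ρ r ρ i j h1 h2 =
    *-cancelˡ-≤ 2 (linear (3 + i) (h1 ⊕ h2) (solve (r ∷ ρ ∷ i ∷ j ∷ [])))
  ex-two : ∀ b a r j i → b + b + a ≤ r + 2 * (2 + j) → r + 2 + 2 * suc j + suc i ≤ b + b + a → ⊥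
  ex-two b a r j i h1 h2 =
    1≰0 (linear i (h1 ⊕ h2) (solve (b ∷ a ∷ r ∷ j ∷ i ∷ [])))
  ex-rest : ∀ a x y m i → x + y ≡ a → x ≤ suc m * 1 → m + 2 * suc i ≤ a → 2 * i < y
  ex-rest a x y m i h1 h2 h3 =
    linear 0 (≤-reflexive (sym h1) ⊕ h2 ⊕ h3) (solve (a ∷ x ∷ y ∷ m ∷ i ∷ []))
  ex-rest₃ : ∀ a x y m i ρ r → x + y ≡ a → x ≤ suc m * 1 → suc (2 * suc (i + ρ)) + suc m ≤ r → r ≤ 3 * ρ + 2 →
    3 * r + 2 ≤ 5 * a → 3 * i < y
  ex-rest₃ a x y m i ρ r h1 h2 h3 h4 h5 =
    *-cancelˡ-≤ 6 (linear (y + 15 + 4 * m) (5 ⊗ ≤-reflexive (sym h1) ⊕ 5 ⊗ h2 ⊕ 9 ⊗ h3 ⊕ 6 ⊗ h4 ⊕ h5)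
      (solve (a ∷ x ∷ y ∷ m ∷ i ∷ ρ ∷ r ∷ [])))
  ex-fit₃ : ∀ o m i ρ r → suc m + o ≡ r → r ≤ 3 * ρ + 2 → o ≤ 3 * suc (i + ρ)
  ex-fit₃ o m i ρ r h1 h2 =
    linear (3 * i + 2 + m) (≤-reflexive h1 ⊕ h2) (solve (o ∷ m ∷ i ∷ ρ ∷ r ∷ []))
  ex-κ<r : ∀ l j i a r → j + l + 2 * suc i ≡ a → a ≤ r → suc l ≤ r
  ex-κ<r l j i a r h1 h2 =
    linear (1 + j + 2 * i) (≤-reflexive h1 ⊕ h2) (solve (l ∷ j ∷ i ∷ a ∷ r ∷ []))
  ex-j<r : ∀ r i j → 2 * suc j + suc i + 2 ≤ r → suc j ≤ r
  ex-j<r r i j h1 =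
    *-cancelˡ-≤ 2 (linear (r + 3 + i) (h1) (solve (r ∷ i ∷ j ∷ [])))
  ex-j≤r : ∀ r i j → 2 * suc j + suc i + 2 ≤ r → j ≤ r
  ex-j≤r r i j h1 =
    *-cancelˡ-≤ 2 (linear (r + 5 + i) (h1) (solve (r ∷ i ∷ j ∷ [])))
  ex-j+3≤r : ∀ r i j → 2 * suc j + suc i + 2 ≤ r → 2 * suc j + 3 ≤ r
  ex-j+3≤r r i j h1 =
    linear i (h1) (solve (r ∷ i ∷ j ∷ []))
  ex-m≤ : ∀ m j l i a → m ≤ j + l → j + l + 2 * suc i ≤ a → m + 2 * suc i ≤ a
  ex-m≤ m j l i a h1 h2 =
    linear 0 (h1 ⊕ h2) (solve (m ∷ j ∷ l ∷ i ∷ a ∷ []))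
  ex-ρ<r : ∀ r ρ → 3 * ρ ≤ r → 3 ≤ r → suc ρ ≤ r
  ex-ρ<r r ρ h1 h2 =
    *-cancelˡ-≤ 3 (linear r (h1 ⊕ h2) (solve (r ∷ ρ ∷ [])))
  ex-3≤r : ∀ r i j → 2 * suc j + suc i + 2 ≤ r → 3 ≤ r
  ex-3≤r r i j h1 =
    *-cancelˡ-≤ 5 (linear (2 * r + 6 * j + 3 * i) (3 ⊗ h1) (solve (r ∷ i ∷ j ∷ [])))
  ex-b>0′ : ∀ a b r j i → r + 2 + 2 * suc j + suc i ≤ b + b + a → a ≤ r → 1 ≤ 2 * b
  ex-b>0′ a b r j i h1 h2 =
    *-cancelˡ-≤ 5 (linear (8 * b + 2 * j + i) (h1 ⊕ h2) (solve (a ∷ b ∷ r ∷ j ∷ i ∷ [])))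

0<2*⇒0< : ∀ b → 1 ≤ 2 * b → 0 < b
0<2*⇒0< (suc b) _ = s≤s z≤n

opaque
  ex-order : ∀ j κ i → j + κ + 2 * suc i ≡ 2 * suc i + j + κ
  ex-order j κ i = solve (j ∷ κ ∷ i ∷ [])

  ex-pos : ∀ o m u → o + (suc m + u) ≡ suc m + o + u
  ex-pos o m u = solve (o ∷ m ∷ u ∷ [])

module _ {r : ℕ} .{{_ : NonZero r}} {α β : ℕ → Bool} (αᵖ : Periodic r α) (βᵖ : Periodic r β) where
  open Pattern {r}
  open Circle {r}

  private
    a = count α
    b = count β

  after-block : ∀ u m → suc m ≤ r → ∃ λ o → suc m + o ≡ r × ∃ λ x →
                x + win (λ y → ⟦ α y ⟧) (suc m + u) o ≡ a × x ≤ suc m * 1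
  after-block u m m<r with ≤⇒∃ m<r
  ... | o , eq = o , eq , win (λ y → ⟦ α y ⟧) u (suc m) ,
    trans (sym (win-++ (λ y → ⟦ α y ⟧) u (suc m) o)) (trans (cong (win (λ y → ⟦ α y ⟧) u) eq) (count-from αᵖ u)) ,
    win-bound 1 u (suc m) λ x _ _ → ⟦⟧≤1 (α x)

  -- The arc from u to m + u leaves at least 2i + 1 elements of α on the remaining o positions,
  -- enough for two stretches of i + ρ + 1. If o is larger than two stretches, the arc is so short
  -- that the density 3/5 of α leaves more than 3i elements, and three stretches always suffice
  -- because r ≤ 3ρ + 2.
  find-split : ∀ {ρ i j} l u m → r ≤ 3 * ρ + 2 → 3 * r + 2 ≤ 5 * a → j ≤ m → m ≤ j + l → l ≤ ρ →
               j + l + 2 * suc i ≤ a → β u ≡ true → β (m + u) ≡ true → Exchange r ρ i j α β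
  find-split {ρ} {i} {j} l u m r≤ a≥ j≤m m≤ l≤ρ j+l βu βm
    with after-block u m (≤-trans (s≤s (≤-trans m≤ (m≤m+n (j + l) (i + (suc i + 0))))) (≤-trans (≤-reflexive (sym (+-suc (j + l) (i + (suc i + 0))))) (≤-trans j+l (count≤ α))))
  ... | o , eq , x , sum , x≤ = found (case o ≤? 2 * suc (i + ρ) of λ where
      (yes o≤) → find-span α i ρ 2 o (suc m + u) o≤ (ex-rest a x _ m i sum x≤ (ex-m≤ m j l i a m≤ j+l))
      (no  o>) → find-span α i ρ 3 o (suc m + u) (ex-fit₃ o m i ρ r eq r≤)
        (ex-rest₃ a x _ m i ρ r sum x≤ (≤-trans (+-monoˡ-≤ (suc m) (≰⇒> o>)) (≤-reflexive (trans (+-comm o (suc m)) eq))) r≤ a≥))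
    where
    found : (∃ λ v → ∃ λ n → suc m + u ≤ v × suc (n + v) ≤ o + (suc m + u) × i ≤ n × n ≤ i + ρ
                           × α v ≡ true × α (n + v) ≡ true) → Exchange r ρ i j α β
    found (v , n , lo , hi , i≤n , n≤ , αv , αn) = splitting u m v n βu βm j≤m (≤-trans m≤ (+-monoʳ-≤ j l≤ρ)) lo
      (≤-trans hi (≤-reflexive (trans (ex-pos o m u) (cong (_+ u) eq)))) αv αn i≤n n≤

  two-or-swap : (∃ λ u → β u ≡ true × α (1 + u) ≡ true × β (2 + u) ≡ true)
              ⊎ (∀ u → ⟦ β u ⟧ + ⟦ β (2 + u) ⟧ + ⟦ α (1 + u) ⟧ ≤ 2)
  two-or-swap = decide (anyUpTo? (λ u → (β u ≟ᵇ true) ×-dec (α (1 + u) ≟ᵇ true) ×-dec (β (2 + u) ≟ᵇ true)) r)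
    where
    Swap : ℕ → Set
    Swap u = β u ≡ true × α (1 + u) ≡ true × β (2 + u) ≡ true
    two : (∀ u → u < r → ¬ Swap u) → ∀ u → ⟦ β u ⟧ + ⟦ β (2 + u) ⟧ + ⟦ α (1 + u) ⟧ ≤ 2
    two none u = ≮⇒≥ λ gt → case triple {β u} {β (2 + u)} gt of λ where
      (p , q , s) → none (u % r) (m%n<n u r) (trans (sym (periodic-% βᵖ u)) p ,
        trans (sym (periodic-% (periodic-shift αᵖ 1) u)) s , trans (sym (periodic-% (periodic-shift βᵖ 2) u)) q)
    decide : Dec (∃ λ u → u < r × Swap u) → ∃ Swap ⊎ (∀ u → ⟦ β u ⟧ + ⟦ β (2 + u) ⟧ + ⟦ α (1 + u) ⟧ ≤ 2)
    decide (yes (u , _ , s)) = inj₁ (u , s)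
    decide (no none)         = inj₂ (two λ u u<r s → none (u , u<r , s))

  span-or-avoid : ∀ j l → (∃ λ u → ∃ λ m → j ≤ m × m ≤ j + l × β u ≡ true × β (m + u) ≡ true)
                        ⊎ (∀ u m → j ≤ m → m ≤ j + l → β u ≡ true → β (m + u) ≡ false)
  span-or-avoid j l = decide (anyUpTo? (λ u → anyUpTo? (λ m →
                        (j ≤? m) ×-dec (β u ≟ᵇ true) ×-dec (β (m + u) ≟ᵇ true)) (suc (j + l))) r)
    where
    Span : ℕ → Set
    Span u = ∃ λ m → m < suc (j + l) × j ≤ m × β u ≡ true × β (m + u) ≡ true
    decide : Dec (∃ λ u → u < r × Span u) →
             (∃ λ u → ∃ λ m → j ≤ m × m ≤ j + l × β u ≡ true × β (m + u) ≡ true)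
             ⊎ (∀ u m → j ≤ m → m ≤ j + l → β u ≡ true → β (m + u) ≡ false)
    decide (yes (u , _ , m , m< , j≤m , βu , βm)) = inj₁ (u , m , j≤m , ≤-pred m< , βu , βm)
    decide (no none) = inj₂ λ u m j≤m m≤ βu → ≢true λ βm → none (u % r , m%n<n u r ,
      m , s≤s m≤ , j≤m , trans (sym (periodic-% βᵖ u)) βu , trans (sym (periodic-% (periodic-shift βᵖ m) u)) βm)

  module _ (ρ i j : ℕ) (ρ≤ : 3 * suc ρ ≤ r) (r≤ : r ≤ 3 * suc ρ + 2) (i≤j : i ≤ j)
           (ij≤ : 2 * suc j + suc i + 2 ≤ r) (a≥ : 3 * r + 2 ≤ 5 * a)
           (ab≥ : r + 2 + 2 * suc j + suc i ≤ b + b + a) where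

    private
      j≤r : j ≤ r
      j≤r = ex-j≤r r i j ij≤

      b>0 : 0 < b
      b>0 = 0<2*⇒0< b (ex-b>0′ a b r j i ab≥ (count≤ α))

    -- The arc has j + 1 positions, fewer than r/2, and so cannot contain all of α, which has more
    -- than 3r/5 elements.
    find-shift : (∃ λ u → β u ≡ true × β (j + u) ≡ true) → Exchange r (suc ρ) i j α β
    find-shift (u , βu , βj) with after-block u j (ex-j<r r i j ij≤)
    ... | o , eq , x , sum , x≤ with find-in-window {α} (suc j + u) o (ex-shift a r j x _ sum x≤ a≥ (ex-j+3≤r r i j ij≤))
    ...   | v , lo , hi , αv = shifting u v βu βj lo (≤-trans hi (≤-reflexive (trans (ex-pos o j u) (cong (_+ u) eq)))) αv

    -- Here κ is the largest excess for which an arc of j + κ + 1 positions still leaves 2i + 1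
    -- elements of α. If β avoids the distances from j to j + κ, `sumset` contradicts `ab≥`. If κ
    -- exceeds the permitted range `suc ρ`, the same bound only forces j ≤ `suc ρ`, and `two-blocks`
    -- supplies the contradiction.
    find-split′ : (∀ u → ⟦ β u ⟧ + ⟦ β (2 + u) ⟧ + ⟦ α (1 + u) ⟧ ≤ 2) →
                  (∃ λ κ → j + κ + 2 * suc i ≡ a) → Exchange r (suc ρ) i j α β
    find-split′ two (κ , eq) with ≤-total κ (suc ρ)
    ... | inj₁ κ≤ρ with span-or-avoid j κ
    ...   | inj₁ (u , m , j≤m , m≤ , βu , βm) =
            find-split κ u m r≤ a≥ j≤m m≤ κ≤ρ (≤-reflexive eq) βu βm
    ...   | inj₂ avoid = ⊥-elim (ex-long a i j b r κ
            (sumset βᵖ j κ j≤r (ex-κ<r κ j i a r eq (count≤ α)) b>0 avoid) eq ab≥ i≤j)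
    find-split′ two (κ , eq) | inj₂ ρ≤κ with span-or-avoid j (suc ρ)
    ...   | inj₁ (u , m , j≤m , m≤ , βu , βm) =
            find-split (suc ρ) u m r≤ a≥ j≤m m≤ ≤-refl (≤-trans (+-monoˡ-≤ (2 * suc i) (+-monoʳ-≤ j ρ≤κ)) (≤-reflexive eq)) βu βm
    ...   | inj₂ avoid = ⊥-elim (ex-two b a r j i
            (two-blocks αᵖ βᵖ j ρ (ex-j≤ρ r (suc ρ) i j room r≤) j≤r r≤ b>0 two avoid) ab≥)
      where
      room : 2 * suc j + suc i + 2 + suc ρ ≤ r
      room = ex-room a b r (suc ρ) i j
        (sumset βᵖ j (suc ρ) j≤r (ex-ρ<r r (suc ρ) ρ≤ (ex-3≤r r i j ij≤)) b>0 avoid) (count≤ α) ab≥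

    -- When β fills more than half of the cycle, two of its elements are at distance exactly j, and
    -- a shift is possible. Otherwise `ab≥` makes α large enough for the excess κ to be nonnegative.
    find-exchange : Exchange r (suc ρ) i j α β
    find-exchange with two-or-swap
    ... | inj₁ (u , p , q , s) = swapping u p q s
    ... | inj₂ two with ≤-<-connex (b + b) (r * 1)
    ...   | inj₂ big   = find-shift (find-pair βᵖ j big)
    ...   | inj₁ small with ≤⇒∃ (ex-bound a r j i (≤-trans ab≥ (+-monoˡ-≤ a (≤-trans small (≤-reflexive (*-identityʳ r))))) i≤j)
    ...     | κ , eq = find-split′ two (κ , trans (ex-order j κ i) eq)

-- Sums over finite types

sum-mono : ∀ n {f g : Fin n → ℕ} → (∀ i → f i ≤ g i) → sumFin n f ≤ sumFin n g
sum-mono zero    f≤g = z≤n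
sum-mono (suc n) f≤g = +-mono-≤ (f≤g Fin.zero) (sum-mono n (f≤g ∘ Fin.suc))

sum-cong : ∀ n {f g : Fin n → ℕ} → (∀ i → f i ≡ g i) → sumFin n f ≡ sumFin n g
sum-cong zero    f≡g = refl
sum-cong (suc n) f≡g = cong₂ _+_ (f≡g Fin.zero) (sum-cong n (f≡g ∘ Fin.suc))

sum-+ : ∀ n (f g : Fin n → ℕ) → sumFin n (λ i → f i + g i) ≡ sumFin n f + sumFin n g
sum-+ zero    f g = refl
sum-+ (suc n) f g = trans (cong (f Fin.zero + g Fin.zero +_) (sum-+ n (f ∘ Fin.suc) (g ∘ Fin.suc)))
  (+-interchange (f Fin.zero) (g Fin.zero) (sumFin n (f ∘ Fin.suc)) (sumFin n (g ∘ Fin.suc)))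

sum-zero : ∀ n → sumFin n (λ _ → 0) ≡ 0
sum-zero zero    = refl
sum-zero (suc n) = sum-zero n

sum-const : ∀ n c → sumFin n (λ _ → c) ≡ n * c
sum-const zero    c = refl
sum-const (suc n) c = cong (c +_) (sum-const n c)

sum-*ˡ : ∀ n c (f : Fin n → ℕ) → sumFin n (λ i → c * f i) ≡ c * sumFin n f
sum-*ˡ zero    c f = sym (*-zeroʳ c)
sum-*ˡ (suc n) c f = trans (cong (c * f Fin.zero +_) (sum-*ˡ n c (f ∘ Fin.suc))) (sym (*-distribˡ-+ c (f Fin.zero) _))

sum-swap : ∀ m n (f : Fin m → Fin n → ℕ) →
           sumFin m (λ i → sumFin n (f i)) ≡ sumFin n (λ j → sumFin m (λ i → f i j))
sum-swap zero    n f = sym (sum-zero n)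
sum-swap (suc m) n f = trans (cong (sumFin n (f Fin.zero) +_) (sum-swap m n (f ∘ Fin.suc)))
  (sym (sum-+ n (f Fin.zero) (λ j → sumFin m (λ i → f (Fin.suc i) j))))

+-swap : ∀ a b c → a + (b + c) ≡ b + (a + c)
+-swap a b c = trans (sym (+-assoc a b c)) (trans (cong (_+ c) (+-comm a b)) (+-assoc b a c))

sum-punchIn : ∀ {m} (f : Fin (suc m) → ℕ) v → sumFin (suc m) f ≡ f v + sumFin m (f ∘ punchIn v)
sum-punchIn         f Fin.zero    = refl
sum-punchIn {suc m} f (Fin.suc v) = trans (cong (f Fin.zero +_) (sum-punchIn (f ∘ Fin.suc) v))
  (+-swap (f Fin.zero) (f (Fin.suc v)) (sumFin m (f ∘ Fin.suc ∘ punchIn v)))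

⌊⌋-true : ∀ {A : Set} (d : Dec A) → A → ⌊ d ⌋ ≡ true
⌊⌋-true (yes _) _ = refl
⌊⌋-true (no ¬a) a = contradiction a ¬a

⌊⌋-false : ∀ {A : Set} (d : Dec A) → ¬ A → ⌊ d ⌋ ≡ false
⌊⌋-false (yes a) ¬a = contradiction a ¬a
⌊⌋-false (no _)  _  = refl

sum-δ : ∀ n (x : Fin n) (f : Fin n → ℕ) → sumFin n (λ y → ⟦ ⌊ y ≟ᶠ x ⌋ ⟧ * f y) ≡ f x
sum-δ (suc n) x f = begin
  sumFin (suc n) g                          ≡⟨ sum-punchIn g x ⟩
  g x + sumFin n (g ∘ punchIn x)
    ≡⟨ cong₂ _+_ (trans (cong (λ b → ⟦ b ⟧ * f x) (⌊⌋-true (x ≟ᶠ x) refl)) (*-identityˡ (f x)))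
                 (trans (sum-cong n λ y → cong (λ b → ⟦ b ⟧ * f (punchIn x y)) (⌊⌋-false (punchIn x y ≟ᶠ x) (punchInᵢ≢i x y)))
                        (sum-zero n)) ⟩
  f x + 0                                   ≡⟨ +-identityʳ (f x) ⟩
  f x                                       ∎
  where
  open ≡-Reasoning
  g : Fin (suc n) → ℕ
  g y = ⟦ ⌊ y ≟ᶠ x ⌋ ⟧ * f y

-- Edge counts of symmetric adjacency relations

degreeSum : ∀ {n} → Adj n → ℕ
degreeSum {n} a = sumFin n λ i → sumFin n λ j → ⟦ a i j ⟧

if≡⟦⟧ : ∀ b → (if b then 1 else 0) ≡ ⟦ b ⟧
if≡⟦⟧ true  = refl
if≡⟦⟧ false = refl

<⇒<ᵇ≡ : ∀ {m n} → m < n → (m <ᵇ n) ≡ true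
<⇒<ᵇ≡ {zero}  (s≤s _) = refl
<⇒<ᵇ≡ {suc m} (s≤s p) = <⇒<ᵇ≡ p

≥⇒<ᵇ≡ : ∀ {m n} → n ≤ m → (m <ᵇ n) ≡ false
≥⇒<ᵇ≡ z≤n     = refl
≥⇒<ᵇ≡ (s≤s p) = ≥⇒<ᵇ≡ p

degreeSum≡2*edgeCount : ∀ {n} (a : Adj n) → (∀ i j → a i j ≡ a j i) → (∀ i → a i i ≡ false) →
                        degreeSum a ≡ edgeCount a + edgeCount a
degreeSum≡2*edgeCount {n} a a-sym a-irr = begin
  degreeSum a
    ≡⟨ sum-cong n (λ i → trans (sum-cong n (split i)) (sum-+ n (upper i) (λ j → upper j i))) ⟩
  sumFin n (λ i → sumFin n (upper i) + sumFin n (λ j → upper j i))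
    ≡⟨ sum-+ n (λ i → sumFin n (upper i)) (λ i → sumFin n (λ j → upper j i)) ⟩
  edgeCount a + sumFin n (λ i → sumFin n (λ j → upper j i))
    ≡⟨ cong (edgeCount a +_) (sum-swap n n (λ i j → upper j i)) ⟩
  edgeCount a + edgeCount a ∎
  where
  open ≡-Reasoning
  upper : Fin n → Fin n → ℕ
  upper i j = if (toℕ i <ᵇ toℕ j) ∧ a i j then 1 else 0
  split : ∀ i j → ⟦ a i j ⟧ ≡ upper i j + upper j i
  split i j with <-cmp (toℕ i) (toℕ j)
  ... | tri< lt _ _ rewrite <⇒<ᵇ≡ lt | ≥⇒<ᵇ≡ (<⇒≤ lt) = trans (sym (if≡⟦⟧ (a i j))) (sym (+-identityʳ _))
  ... | tri> _ _ gt rewrite <⇒<ᵇ≡ gt | ≥⇒<ᵇ≡ (<⇒≤ gt) = trans (cong ⟦_⟧ (a-sym i j)) (sym (if≡⟦⟧ (a j i)))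
  ... | tri≈ _ eq _ with toℕ-injective eq
  ...   | refl rewrite ≥⇒<ᵇ≡ (≤-refl {toℕ i}) = cong ⟦_⟧ (a-irr i)

-- Edges lost by deleting a vertex or contracting an edge

total : ∀ {n} → (Fin n → Bool) → ℕ
total {n} f = sumFin n λ x → ⟦ f x ⟧

common : ∀ {n} → Adj n → Fin n → Fin n → Fin n → Bool
common a u v z = a u z ∧ a v z

opaque
  half-mono : ∀ x y c → x + x ≤ y + y + (c + c) → x ≤ y + c
  half-mono x y c h1 =
    *-cancelˡ-≤ 2 (linear 0 (h1) (solve (x ∷ y ∷ c ∷ [])))
  contract-arith : ∀ d D E E′ N c → E + E ≡ d + (d + D) → D + (N + N) ≤ E′ + E′ → d ≤ N + (1 + c) →
    E + E ≤ E′ + E′ + (suc c + suc c)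
  contract-arith d D E E′ N c h1 h2 h3 =
    linear 0 (≤-reflexive h1 ⊕ h2 ⊕ 2 ⊗ h3) (solve (d ∷ D ∷ E ∷ E′ ∷ N ∷ c ∷ []))

module _ {m : ℕ} (G : Graph (suc m)) where
  private
    a = adj G
    e = edgeCount a

  degreeSum-delete : ∀ v → e + e ≡ total (a v) + (total (a v) + degreeSum (deleteVertex a v))
  degreeSum-delete v = begin
    e + e               ≡⟨ sym (degreeSum≡2*edgeCount a (adj-sym G) (adj-irrefl G)) ⟩
    degreeSum a         ≡⟨ sum-punchIn (λ i → total (a i)) v ⟩
    total (a v) + sumFin m (λ x → total (a (punchIn v x)))
      ≡⟨ cong (total (a v) +_) (trans (sum-cong m λ x → sum-punchIn (λ j → ⟦ a (punchIn v x) j ⟧) v)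
           (sum-+ m (λ x → ⟦ a (punchIn v x) v ⟧) (λ x → total (deleteVertex a v x)))) ⟩
    total (a v) + (sumFin m (λ x → ⟦ a (punchIn v x) v ⟧) + degreeSum (deleteVertex a v))
      ≡⟨ cong (λ s → total (a v) + (s + degreeSum (deleteVertex a v))) column ⟩
    total (a v) + (total (a v) + degreeSum (deleteVertex a v)) ∎
    where
    open ≡-Reasoning
    column : sumFin m (λ x → ⟦ a (punchIn v x) v ⟧) ≡ total (a v)
    column = trans (sum-cong m λ x → cong ⟦_⟧ (adj-sym G (punchIn v x) v))
      (sym (trans (sum-punchIn (λ z → ⟦ a v z ⟧) v) (cong (λ b → ⟦ b ⟧ + total (a v ∘ punchIn v)) (adj-irrefl G v))))

  edgeCount-delete : ∀ v → e ≤ edgeCount (deleteVertex a v) + total (a v)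
  edgeCount-delete v = half-mono e (edgeCount (deleteVertex a v)) (total (a v)) (≤-reflexive (begin
    e + e                                    ≡⟨ degreeSum-delete v ⟩
    d + (d + degreeSum (deleteVertex a v))   ≡⟨ sym (+-assoc d d _) ⟩
    d + d + degreeSum (deleteVertex a v)     ≡⟨ +-comm (d + d) _ ⟩
    degreeSum (deleteVertex a v) + (d + d)
      ≡⟨ cong (_+ (d + d)) (degreeSum≡2*edgeCount (deleteVertex a v)
           (λ x y → adj-sym G (punchIn v x) (punchIn v y)) (λ x → adj-irrefl G (punchIn v x))) ⟩
    edgeCount (deleteVertex a v) + edgeCount (deleteVertex a v) + (d + d) ∎))
    where
    open ≡-Reasoning
    d = total (a v)

  module _ {v : Fin (suc m)} (x₀ : Fin m) where
    private
      u = punchIn v x₀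
      p = punchIn v
      b = contractEdge a u v

    ≟-sym : (x y : Fin m) → ⌊ x ≟ᶠ y ⌋ ≡ ⌊ y ≟ᶠ x ⌋
    ≟-sym x y with x ≟ᶠ y
    ... | yes refl = sym (⌊⌋-true (x ≟ᶠ x) refl)
    ... | no x≢y   = sym (⌊⌋-false (y ≟ᶠ x) (x≢y ∘ sym))

    contract-sym : ∀ x y → b x y ≡ b y x
    contract-sym x y = cong₂ _∧_ (cong not (≟-sym x y))
      (cong₂ _∨_ (adj-sym G (p x) (p y)) (∨-comm (⌊ p x ≟ᶠ u ⌋ ∧ a v (p y)) (⌊ p y ≟ᶠ u ⌋ ∧ a v (p x))))

    contract-irrefl : ∀ x → b x x ≡ false
    contract-irrefl x rewrite ⌊⌋-true (x ≟ᶠ x) refl = refl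

    -- the neighbours that the merged vertex u inherits from v
    new : Fin (suc m) → Bool
    new z = a v z ∧ (not (a u z) ∧ not ⌊ z ≟ᶠ u ⌋)

    inherit : ∀ z → ⟦ a u z ⟧ + ⟦ new z ⟧ ≤ ⟦ a u z ∨ (a v z ∨ false) ⟧
    inherit z with a u z | a v z | ⌊ z ≟ᶠ u ⌋
    ... | true  | true  | _     = ≤-refl
    ... | true  | false | _     = ≤-refl
    ... | false | true  | true  = z≤n
    ... | false | true  | false = ≤-refl
    ... | false | false | _     = z≤n

    ∨-monoˡ : ∀ b c d → ⟦ b ∨ (c ∨ false) ⟧ ≤ ⟦ b ∨ (c ∨ d) ⟧
    ∨-monoˡ true  _     _ = ≤-refl
    ∨-monoˡ false true  _ = ≤-refl
    ∨-monoˡ false false _ = z≤n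

    row : ∀ y → ⟦ a u (p y) ⟧ + ⟦ new (p y) ⟧ ≤ ⟦ b x₀ y ⟧
    row y with x₀ ≟ᶠ y
    ... | yes refl rewrite adj-irrefl G u | ⌊⌋-true (u ≟ᶠ u) refl | ∧-zeroʳ (a v u) = z≤n
    ... | no _     rewrite ⌊⌋-true (u ≟ᶠ u) refl =
            ≤-trans (inherit (p y)) (∨-monoˡ (a u (p y)) (a v (p y)) _)

    -- The three summands come from disjoint sets of entries: old adjacencies, and inherited ones in
    -- the row and in the column of u. Therefore their sum is still at most one entry.
    contract-lower : ∀ x y → ⟦ a (p x) (p y) ⟧ + (⟦ ⌊ x ≟ᶠ x₀ ⌋ ⟧ * ⟦ new (p y) ⟧ + ⟦ ⌊ y ≟ᶠ x₀ ⌋ ⟧ * ⟦ new (p x) ⟧)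
                             ≤ ⟦ b x y ⟧
    contract-lower x y with x ≟ᶠ x₀ | y ≟ᶠ x₀
    ... | yes refl | yes refl rewrite adj-irrefl G u | ⌊⌋-true (u ≟ᶠ u) refl | ∧-zeroʳ (a v u) = z≤n
    ... | yes refl | no _ = ≤-trans (≤-reflexive (cong (⟦ a u (p y) ⟧ +_) (trans (+-identityʳ _) (+-identityʳ _)))) (row y)
    ... | no _ | yes refl = ≤-trans (≤-reflexive (cong₂ _+_ (cong ⟦_⟧ (adj-sym G (p x) u)) (+-identityʳ _)))
                              (≤-trans (row x) (≤-reflexive (cong ⟦_⟧ (contract-sym x₀ x))))
    ... | no _ | no _ with x ≟ᶠ y
    ...   | yes refl rewrite adj-irrefl G (p x) = z≤n
    ...   | no _ with a (p x) (p y)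
    ...     | true  = ≤-refl
    ...     | false = z≤n

    -- Contracting uv amounts to deleting v and joining u to each vertex of `new`; every such edge
    -- contributes 2 to the degree sum.
    degreeSum-contract : degreeSum (deleteVertex a v) + (total (new ∘ p) + total (new ∘ p))
                         ≤ edgeCount b + edgeCount b
    degreeSum-contract = begin
      D + (N + N)
        ≡⟨ cong (D +_) (sym (cong₂ _+_ rows columns)) ⟩
      D + (sumFin m (λ x → sumFin m (λ y → δ x * ⟦ new (p y) ⟧)) + sumFin m (λ x → sumFin m (λ y → δ y * ⟦ new (p x) ⟧)))
        ≡⟨ cong (D +_) (sym (sum-+ m _ _)) ⟩
      D + sumFin m (λ x → sumFin m (λ y → δ x * ⟦ new (p y) ⟧) + sumFin m (λ y → δ y * ⟦ new (p x) ⟧))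
        ≡⟨ sym (sum-+ m _ _) ⟩
      sumFin m (λ x → sumFin m (λ y → ⟦ a (p x) (p y) ⟧) + (sumFin m (λ y → δ x * ⟦ new (p y) ⟧) + sumFin m (λ y → δ y * ⟦ new (p x) ⟧)))
        ≡⟨ sum-cong m (λ x → trans (cong (sumFin m (λ y → ⟦ a (p x) (p y) ⟧) +_) (sym (sum-+ m _ _))) (sym (sum-+ m _ _))) ⟩
      sumFin m (λ x → sumFin m (λ y → ⟦ a (p x) (p y) ⟧ + (δ x * ⟦ new (p y) ⟧ + δ y * ⟦ new (p x) ⟧)))
        ≤⟨ sum-mono m (λ x → sum-mono m (contract-lower x)) ⟩
      degreeSum b
        ≡⟨ degreeSum≡2*edgeCount b contract-sym contract-irrefl ⟩
      edgeCount b + edgeCount b ∎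
      where
      open ≤-Reasoning
      D N : ℕ
      D = degreeSum (deleteVertex a v)
      N = total (new ∘ p)
      δ : Fin m → ℕ
      δ x = ⟦ ⌊ x ≟ᶠ x₀ ⌋ ⟧
      rows : sumFin m (λ x → sumFin m (λ y → δ x * ⟦ new (p y) ⟧)) ≡ N
      rows = trans (sum-cong m λ x → sum-*ˡ m (δ x) (λ y → ⟦ new (p y) ⟧)) (sum-δ m x₀ (λ _ → N))
      columns : sumFin m (λ x → sumFin m (λ y → δ y * ⟦ new (p x) ⟧)) ≡ N
      columns = sum-cong m λ x → sum-δ m x₀ (λ _ → ⟦ new (p x) ⟧)

    -- A neighbour of v is inherited by u, or is u itself, or was already adjacent to u. The last
    -- two kinds are the edges that contraction loses beyond those inherited.
    degree-split : total (a v) ≤ total (new ∘ p) + (1 + total (common a u v))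
    degree-split = begin
      total (a v)                              ≡⟨ sum-punchIn (λ z → ⟦ a v z ⟧) v ⟩
      ⟦ a v v ⟧ + total (a v ∘ p)              ≡⟨ cong (λ b → ⟦ b ⟧ + total (a v ∘ p)) (adj-irrefl G v) ⟩
      total (a v ∘ p)                          ≤⟨ sum-mono m pointwise ⟩
      sumFin m (λ y → ⟦ new (p y) ⟧ + (⟦ ⌊ y ≟ᶠ x₀ ⌋ ⟧ * 1 + ⟦ common a u v (p y) ⟧))
        ≡⟨ trans (sum-+ m _ _) (cong (total (new ∘ p) +_) (sum-+ m _ _)) ⟩
      total (new ∘ p) + (sumFin m (λ y → ⟦ ⌊ y ≟ᶠ x₀ ⌋ ⟧ * 1) + total (common a u v ∘ p))
        ≤⟨ +-monoʳ-≤ (total (new ∘ p)) (+-mono-≤ (≤-reflexive (sum-δ m x₀ (λ _ → 1)))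
             (≤-trans (m≤n+m _ _) (≤-reflexive (sym (sum-punchIn (λ z → ⟦ common a u v z ⟧) v))))) ⟩
      total (new ∘ p) + (1 + total (common a u v)) ∎
      where
      open ≤-Reasoning
      pointwise : ∀ y → ⟦ a v (p y) ⟧ ≤ ⟦ new (p y) ⟧ + (⟦ ⌊ y ≟ᶠ x₀ ⌋ ⟧ * 1 + ⟦ common a u v (p y) ⟧)
      pointwise y with y ≟ᶠ x₀
      ... | yes refl = ≤-trans (⟦⟧≤1 (a v u)) (≤-trans (m≤m+n 1 _) (m≤n+m _ ⟦ new u ⟧))
      ... | no y≢ rewrite ⌊⌋-false (p y ≟ᶠ u) (λ eq → y≢ (punchIn-injective v y x₀ eq)) with a v (p y) | a u (p y)
      ...   | true  | true  = ≤-refl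
      ...   | true  | false = ≤-refl
      ...   | false | _     = z≤n

    edgeCount-contract′ : e ≤ edgeCount b + suc (total (common a u v))
    edgeCount-contract′ = half-mono e (edgeCount b) _
      (contract-arith (total (a v)) (degreeSum (deleteVertex a v)) e (edgeCount b) (total (new ∘ p)) (total (common a u v))
        (degreeSum-delete v) degreeSum-contract degree-split)

  edgeCount-contract : ∀ u v → a u v ≡ true → e ≤ edgeCount (contractEdge a u v) + suc (total (common a u v))
  edgeCount-contract u v uv = subst (λ u → e ≤ edgeCount (contractEdge a u v) + suc (total (common a u v)))
    (punchIn-punchOut v≢u) (edgeCount-contract′ (punchOut v≢u))
    where
    v≢u : v ≢ u
    v≢u refl = true≢false uv (adj-irrefl G v)

  degree<order : ∀ v → total (a v) ≤ m
  degree<order v = begin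
    total (a v)                   ≡⟨ sum-punchIn (λ z → ⟦ a v z ⟧) v ⟩
    ⟦ a v v ⟧ + total (a v ∘ punchIn v)
                                  ≤⟨ +-mono-≤ (≤-reflexive (cong ⟦_⟧ (adj-irrefl G v))) (sum-mono m λ y → ⟦⟧≤1 (a v (punchIn v y))) ⟩
    sumFin m (λ _ → 1)            ≡⟨ trans (sum-const m 1) (*-identityʳ m) ⟩
    m                             ∎
    where open ≤-Reasoning

  edgeCount≤ : e + e ≤ suc m * m
  edgeCount≤ = begin
    e + e           ≡⟨ sym (degreeSum≡2*edgeCount a (adj-sym G) (adj-irrefl G)) ⟩
    degreeSum a     ≤⟨ sum-mono (suc m) degree<order ⟩
    sumFin (suc m) (λ _ → m) ≡⟨ sum-const (suc m) m ⟩
    suc m * m       ∎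
    where open ≤-Reasoning

opaque
  -- With n = m + 1 vertices and at most x edges lost, en ≤ e′n + xn < e(n - 1) + xn. So x exceeds
  -- e/n, which is half the average degree and hence at least 2kr/3.
  drop-bound : ∀ k r m e e′ x → 4 * k * r * suc m ≤ 3 * (2 * e) → e ≤ e′ + x → e′ * suc m < e * m → 2 * k * r < 3 * x
  drop-bound k r m e e′ x h1 h2 h3 = *-cancelˡ-< (2 * suc m) (2 * k * r) (3 * x)
    (linear 5 (h1 ⊕ 6 ⊗ (suc m) ⊗ h2 ⊕ 6 ⊗ h3) (solve (k ∷ r ∷ m ∷ e ∷ e′ ∷ x ∷ [])))

  -- The average degree of a simple graph is less than its order by at least 1. This bound later
  -- provides vertices outside the family.
  order-bound : ∀ k r m e → 4 * k * r * suc m ≤ 3 * (2 * e) → e + e ≤ suc m * m → 4 * k * r + 3 ≤ 3 * suc m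
  order-bound k r m e h1 h2 = ≤-trans (+-monoˡ-≤ 3 (*-cancelˡ-≤ {4 * k * r} {3 * m} (suc m)
    (linear 0 (h1 ⊕ 3 ⊗ h2) (solve (k ∷ r ∷ m ∷ e ∷ []))))) (≤-reflexive (trans (+-comm (3 * m) 3) (sym (*-suc 3 m))))

-- Counting along lists of vertices

cnt : ∀ {A : Set} → (A → Bool) → List A → ℕ
cnt f []       = 0
cnt f (x ∷ xs) = ⟦ f x ⟧ + cnt f xs

cnt-++ : ∀ {A : Set} (f : A → Bool) xs ys → cnt f (xs ++ ys) ≡ cnt f xs + cnt f ys
cnt-++ f []       ys = refl
cnt-++ f (x ∷ xs) ys = trans (cong (⟦ f x ⟧ +_) (cnt-++ f xs ys)) (sym (+-assoc ⟦ f x ⟧ (cnt f xs) (cnt f ys)))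

cnt≤length : ∀ {A : Set} (f : A → Bool) xs → cnt f xs ≤ length xs
cnt≤length f []       = z≤n
cnt≤length f (x ∷ xs) = +-mono-≤ (⟦⟧≤1 (f x)) (cnt≤length f xs)

cnt-mono : ∀ {A : Set} {f g : A → Bool} → (∀ x → f x ≡ true → g x ≡ true) → ∀ xs → cnt f xs ≤ cnt g xs
cnt-mono f⇒g []       = z≤n
cnt-mono {f = f} f⇒g (x ∷ xs) with f x in fx
... | true rewrite f⇒g x fx = s≤s (cnt-mono f⇒g xs)
... | false = ≤-trans (cnt-mono f⇒g xs) (m≤n+m _ _)

cnt-↭ : ∀ {A : Set} (f : A → Bool) {xs ys} → xs ↭ ys → cnt f xs ≡ cnt f ys
cnt-↭ f _↭_.refl           = refl
cnt-↭ f (_↭_.prep x p)     = cong (⟦ f x ⟧ +_) (cnt-↭ f p)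
cnt-↭ f (_↭_.swap x y p)   = trans (cong (λ s → ⟦ f x ⟧ + (⟦ f y ⟧ + s)) (cnt-↭ f p)) (+-swap ⟦ f x ⟧ ⟦ f y ⟧ _)
cnt-↭ f (_↭_.trans p q)    = trans (cnt-↭ f p) (cnt-↭ f q)

∃-cnt : ∀ {A : Set} (f : A → Bool) xs → 0 < cnt f xs → ∃ λ x → x ∈ xs × f x ≡ true
∃-cnt f (x ∷ xs) pos with f x in fx
... | true  = x , here refl , fx
... | false with ∃-cnt f xs pos
...   | y , y∈ , fy = y , there y∈ , fy

module _ {n : ℕ} where

  _∈?_ : (x : Fin n) (xs : List (Fin n)) → Dec (x ∈ xs)
  x ∈? xs = Any.any? (x ≟ᶠ_) xs

  total≤cnt : ∀ (f : Fin n → Bool) xs → (∀ x → f x ≡ true → x ∈ xs) → total f ≤ cnt f xs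
  total≤cnt f xs cover = ≤-trans (sum-mono n pointwise) (≤-reflexive (sums xs))
    where
    weight : List (Fin n) → Fin n → ℕ
    weight []       x = 0
    weight (y ∷ ys) x = ⟦ ⌊ x ≟ᶠ y ⌋ ⟧ * ⟦ f y ⟧ + weight ys x
    sums : ∀ ys → sumFin n (weight ys) ≡ cnt f ys
    sums []       = sum-zero n
    sums (y ∷ ys) = trans (sum-+ n (λ x → ⟦ ⌊ x ≟ᶠ y ⌋ ⟧ * ⟦ f y ⟧) (weight ys))
      (cong₂ _+_ (sum-δ n y (λ _ → ⟦ f y ⟧)) (sums ys))
    member : ∀ {x ys} → x ∈ ys → ⟦ f x ⟧ ≤ weight ys x
    member {x} (here refl) = ≤-trans (≤-reflexive (sym (trans (cong (λ b → ⟦ b ⟧ * ⟦ f x ⟧) (⌊⌋-true (x ≟ᶠ x) refl)) (*-identityˡ _))))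
                                     (m≤m+n _ _)
    member (there x∈) = ≤-trans (member x∈) (m≤n+m _ _)
    pointwise : ∀ x → ⟦ f x ⟧ ≤ weight xs x
    pointwise x with f x in fx
    ... | false = z≤n
    ... | true  = subst (λ b → ⟦ b ⟧ ≤ weight xs x) fx (member (cover x fx))

  find-outside : ∀ (f : Fin n → Bool) xs → (∃ λ x → f x ≡ true × x ∉ xs) ⊎ (∀ x → f x ≡ true → x ∈ xs)
  find-outside f xs with any? (λ x → (f x ≟ᵇ true) ×-dec ¬? (x ∈? xs))
  ... | yes p = inj₁ p
  ... | no ¬p = inj₂ λ x fx → decidable-stable (x ∈? xs) λ x∉ → ¬p (x , fx , x∉)

  outside : ∀ (f : Fin n → Bool) xs → cnt f xs < total f → ∃ λ x → f x ≡ true × x ∉ xs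
  outside f xs lt with find-outside f xs
  ... | inj₁ p     = p
  ... | inj₂ cover = contradiction (total≤cnt f xs cover) (<⇒≱ lt)

  outside-length : ∀ xs → length xs < n → ∃ λ x → x ∉ xs
  outside-length xs lt with outside (λ _ → true) xs
    (≤-<-trans (cnt≤length _ xs) (<-≤-trans lt (≤-reflexive (sym (trans (sum-const n 1) (*-identityʳ n))))))
  ... | x , _ , x∉ = x , x∉

-- Duplicate-free lists up to permutation

module _ {A : Set} where

  Unique-resp-↭ : ∀ {xs ys : List A} → xs ↭ ys → Unique xs → Unique ys
  Unique-resp-↭ p = ↭ₛ.Unique-resp-↭ (setoid A) (↭⇒↭ₛ p)

  Unique-++ˡ : ∀ (xs : List A) {ys} → Unique (xs ++ ys) → Unique xs
  Unique-++ˡ []       u        = AP.[]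
  Unique-++ˡ (x ∷ xs) (p AP.∷ u) = All.tabulate (λ z∈ → All.lookup p (∈-++⁺ˡ z∈)) AP.∷ Unique-++ˡ xs u

  Unique-++ʳ : ∀ (xs : List A) {ys} → Unique (xs ++ ys) → Unique ys
  Unique-++ʳ []       u       = u
  Unique-++ʳ (x ∷ xs) (_ AP.∷ u) = Unique-++ʳ xs u

  Unique-disjoint : ∀ (xs : List A) {ys} → Unique (xs ++ ys) → ∀ {x} → x ∈ xs → x ∉ ys
  Unique-disjoint (x ∷ xs) (p AP.∷ u) (here refl) x∈ys = All.lookup p (∈-++⁺ʳ xs x∈ys) refl
  Unique-disjoint (x ∷ xs) (p AP.∷ u) (there x∈)  x∈ys = Unique-disjoint xs u x∈ x∈ys

  Unique-∷ : ∀ {x : A} {xs} → x ∉ xs → Unique xs → Unique (x ∷ xs)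
  Unique-∷ x∉ u = AllP.¬Any⇒All¬ _ x∉ AP.∷ u

  Unique-++⁺ : ∀ {xs ys : List A} → Unique xs → Unique ys → (∀ {x} → x ∈ xs → x ∉ ys) → Unique (xs ++ ys)
  Unique-++⁺ ux uy dis = Unique.++⁺ ux uy (λ { (x∈ , y∈) → dis x∈ y∈ })

  Unique-⊆ : ∀ (ys zs : List A) {xs} → xs ↭ ys ++ zs → Unique xs → Unique ys
  Unique-⊆ ys zs p u = Unique-++ˡ ys (Unique-resp-↭ p u)

  concat-↭ : ∀ {xss yss : List (List A)} → xss ↭ yss → concat xss ↭ concat yss
  concat-↭ _↭_.refl         = ↭-refl
  concat-↭ (_↭_.prep x p)   = ++⁺ˡ x (concat-↭ p)
  concat-↭ (_↭_.swap x y p) = ↭-trans (shifts x y) (++⁺ˡ y (++⁺ˡ x (concat-↭ p)))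
  concat-↭ (_↭_.trans p q)  = ↭-trans (concat-↭ p) (concat-↭ q)

  extract : ∀ {x : A} {xs} → x ∈ xs → ∃ λ ys → xs ↭ x ∷ ys
  extract {x} x∈ with ∈-∃++ x∈
  ... | as , bs , refl = as ++ bs , shift x as bs

  open import Algebra.Solver.CommutativeMonoid (++-commutativeMonoid {A = A}) public
    using (_⊜_) renaming (solve to ↭-solve; _⊕_ to _∙_)

lookup∈ : ∀ {A : Set} (xs : List A) i → lookup xs i ∈ xs
lookup∈ (x ∷ xs) Fin.zero    = here refl
lookup∈ (x ∷ xs) (Fin.suc i) = there (lookup∈ xs i)

lookup-injective : ∀ {A : Set} {xs : List A} → Unique xs → ∀ {i j} → lookup xs i ≡ lookup xs j → i ≡ j
lookup-injective (p AP.∷ u) {Fin.zero}  {Fin.zero}  _  = refl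
lookup-injective {xs = _ ∷ xs} (p AP.∷ u) {Fin.zero}  {Fin.suc j} eq = contradiction eq (All.lookup p (lookup∈ xs j))
lookup-injective {xs = _ ∷ xs} (p AP.∷ u) {Fin.suc i} {Fin.zero}  eq = contradiction (sym eq) (All.lookup p (lookup∈ xs i))
lookup-injective (p AP.∷ u) {Fin.suc i} {Fin.suc j} eq = cong Fin.suc (lookup-injective u eq)

unique-length : ∀ {n} {xs : List (Fin n)} → Unique xs → length xs ≤ n
unique-length {xs = xs} u = injective⇒≤ {f = lookup xs} (lookup-injective u)

-- Segments of a sequence

seg : ∀ {A : Set} → (ℕ → A) → ℕ → ℕ → List A
seg c u zero    = []
seg c u (suc m) = c u ∷ seg c (suc u) m

module _ {A : Set} where

  seg-++ : ∀ (c : ℕ → A) u m m′ → seg c u (m + m′) ≡ seg c u m ++ seg c (m + u) m′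
  seg-++ c u zero    m′ = refl
  seg-++ c u (suc m) m′ = cong (c u ∷_) (trans (seg-++ c (suc u) m m′) (cong (λ v → seg c (suc u) m ++ seg c v m′) (+-suc m u)))

  seg-suc : ∀ (c : ℕ → A) u m → seg (c ∘ suc) u m ≡ seg c (suc u) m
  seg-suc c u zero    = refl
  seg-suc c u (suc m) = cong (c (suc u) ∷_) (seg-suc c (suc u) m)

  seg-cong : ∀ {c d : ℕ → A} u m → (∀ x → x < m + u → c x ≡ d x) → seg c u m ≡ seg d u m
  seg-cong u zero    eq = refl
  seg-cong u (suc m) eq = cong₂ _∷_ (eq u (s≤s (m≤n+m u m)))
    (seg-cong (suc u) m λ x x< → eq x (subst (x <_) (+-suc m u) x<))

  length-seg : ∀ (c : ℕ → A) u m → length (seg c u m) ≡ m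
  length-seg c u zero    = refl
  length-seg c u (suc m) = cong suc (length-seg c (suc u) m)

  cnt-seg : ∀ (f : A → Bool) (c : ℕ → A) u m → cnt f (seg c u m) ≡ win (λ x → ⟦ f (c x) ⟧) u m
  cnt-seg f c u zero    = refl
  cnt-seg f c u (suc m) = cong (⟦ f (c u) ⟧ +_) (cnt-seg f c (suc u) m)

  ∈-seg : ∀ (c : ℕ → A) u m x → u ≤ x → x < m + u → c x ∈ seg c u m
  ∈-seg c u zero    x u≤x x<u = contradiction u≤x (<⇒≱ x<u)
  ∈-seg c u (suc m) x u≤x x< with m≤n⇒m<n∨m≡n u≤x
  ... | inj₁ u<x  = there (∈-seg c (suc u) m x u<x (subst (x <_) (sym (+-suc m u)) x<))
  ... | inj₂ refl = here refl

  nth : A → List A → ℕ → A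
  nth d []       i       = d
  nth d (x ∷ xs) zero    = x
  nth d (x ∷ xs) (suc i) = nth d xs i

  seg-nth : ∀ d (xs : List A) → seg (nth d xs) 0 (length xs) ≡ xs
  seg-nth d []       = refl
  seg-nth d (x ∷ xs) = cong (x ∷_) (trans (sym (seg-suc (nth d (x ∷ xs)) 0 (length xs))) (seg-nth d xs))

-- Walks and cycles as vertex lists

module Walks {n : ℕ} (G : Graph n) where
  V = Fin n
  a = adj G

  infixr 5 _◅_

  -- The list of vertices is an index and distinctness a separate `Unique`. Disjointness of several
  -- cycles thus becomes `Unique` of one concatenated list, and an exchange is checked by a
  -- permutation of that list.
  data Walk : V → List V → V → Set where
    stop : ∀ x → Walk x (x ∷ []) x
    _◅_ : ∀ {x y z ys} → a x y ≡ true → Walk y ys z → Walk x (x ∷ ys) z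

  a-sym : ∀ {x y} → a x y ≡ true → a y x ≡ true
  a-sym {x} {y} = trans (adj-sym G y x)

  walk-++ : ∀ {x xs y z zs w} → Walk x xs y → a y z ≡ true → Walk z zs w → Walk x (xs ++ zs) w
  walk-++ (stop x)   yz q = yz ◅ q
  walk-++ (e ◅ p) yz q = e ◅ walk-++ p yz q

  walk-reverse : ∀ {x xs y} → Walk x xs y → Walk y (reverse xs) x
  walk-reverse (stop x) = stop x
  walk-reverse (_◅_ {x} {ys = ys} e p) = subst (λ l → Walk _ l x) (sym (unfold-reverse x ys))
    (walk-++ (walk-reverse p) (a-sym e) (stop x))

  walk-length : ∀ {x xs y} → Walk x xs y → 1 ≤ length xs
  walk-length (stop x)   = s≤s z≤n
  walk-length (_ ◅ _) = s≤s z≤n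

  walk-head∈ : ∀ {x xs y} → Walk x xs y → x ∈ xs
  walk-head∈ (stop x)   = here refl
  walk-head∈ (_ ◅ _) = here refl

  walk-last∈ : ∀ {x xs y} → Walk x xs y → y ∈ xs
  walk-last∈ (stop x)   = here refl
  walk-last∈ (_ ◅ p) = there (walk-last∈ p)

  walk-step : ∀ {x xs y} d → Walk x xs y → ∀ i → suc i < length xs → a (nth d xs i) (nth d xs (suc i)) ≡ true
  walk-step d (stop x) i (s≤s ())
  walk-step d (e ◅ (stop y))       zero    _ = e
  walk-step d (e ◅ (e′ ◅ p))    zero    _ = e
  walk-step d (e ◅ p)           (suc i) (s≤s lt) = walk-step d p i lt

  walk-first : ∀ {x xs y} d → Walk x xs y → nth d xs 0 ≡ x
  walk-first d (stop x)   = refl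
  walk-first d (_ ◅ _) = refl

  walk-final : ∀ {x xs y} d → Walk x xs y → ∀ i → suc i ≡ length xs → nth d xs i ≡ y
  walk-final d (stop x)   zero    _  = refl
  walk-final d (e ◅ (stop y)) zero ()
  walk-final d (e ◅ (_ ◅ _)) zero ()
  walk-final d (e ◅ p) (suc i) eq = walk-final d p i (suc-injective eq)

  -- An edge, traversed in both directions, also qualifies; this lets edges serve as partial cycles.
  -- Genuine cycles are recognised by their length, at least r ≥ 3.
  IsCycle : List V → Set
  IsCycle xs = ∃ λ h → ∃ λ l → Walk h xs l × a l h ≡ true

  -- The cycle unrolled to a periodic sequence: arcs are segments of `at`, and a set of vertices
  -- pulled back along `at` is a periodic subset of ℕ.
  record Rotation (xs : List V) : Set where
    field
      at       : ℕ → V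
      nonZero  : NonZero (length xs)
      periodic : Periodic (length xs) at
      edge     : ∀ u → a (at u) (at (suc u)) ≡ true
      seg-at   : seg at 0 (length xs) ≡ xs

    seg-↭ : ∀ u → seg at u (length xs) ↭ xs
    seg-↭ zero    = ↭-reflexive seg-at
    seg-↭ (suc u) = ↭-trans (rotate u) (seg-↭ u)
      where
      rotate : ∀ u → seg at (suc u) (length xs) ↭ seg at u (length xs)
      rotate u with length xs | periodic
      ... | zero  | _   = ↭-refl
      ... | suc ℓ | per = ↭-trans (↭-reflexive (trans (cong (seg at (suc u)) (+-comm 1 ℓ))
              (trans (seg-++ at (suc u) ℓ 1) (cong (λ z → seg at (suc u) ℓ ++ z ∷ []) (trans (cong at (+-suc ℓ u)) (per u))))))
              (↭-sym (∷↭∷ʳ (at u) (seg at (suc u) ℓ)))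

    walk-seg : ∀ u m → Walk (at u) (seg at u (suc m)) (at (m + u))
    walk-seg u zero    = stop (at u)
    walk-seg u (suc m) = edge u ◅ subst (λ v → Walk (at (suc u)) (seg at (suc u) (suc m)) (at v)) (+-suc m u) (walk-seg (suc u) m)

    periodic-∘ : ∀ (f : V → Bool) → Periodic (length xs) (f ∘ at)
    periodic-∘ f x = cong f (periodic x)

    count≡cnt : ∀ (f : V → Bool) → Pattern.count {length xs} (f ∘ at) ≡ cnt f xs
    count≡cnt f = trans (sym (cnt-seg f at 0 (length xs))) (cong (cnt f) seg-at)

  rotation : ∀ {xs} → IsCycle xs → Rotation xs
  rotation {xs} (h , l , walk , close) = record
    { at = at ; nonZero = nz ; periodic = per ; edge = edge
    ; seg-at = trans (seg-cong 0 ℓ λ x x< → cong (nth h xs) (m<n⇒m%n≡m (subst (x <_) (+-identityʳ ℓ) x<))) (seg-nth h xs) }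
    where
    ℓ = length xs
    instance
      nz : NonZero ℓ
      nz = >-nonZero (walk-length walk)
    at : ℕ → V
    at u = nth h xs (u % ℓ)
    per : Periodic ℓ at
    per x = cong (nth h xs) (trans (cong (_% ℓ) (+-comm ℓ x)) ([m+n]%n≡m%n x ℓ))
    suc-% : ∀ u → suc u % ℓ ≡ suc (u % ℓ) % ℓ
    suc-% u = trans (cong (λ v → suc v % ℓ) (m≡m%n+[m/n]*n u ℓ)) ([m+kn]%n≡m%n (suc (u % ℓ)) (u / ℓ) ℓ)
    edge : ∀ u → a (at u) (at (suc u)) ≡ true
    edge u with m≤n⇒m<n∨m≡n (m%n<n u ℓ)
    ... | inj₁ lt = trans (cong (λ i → a (at u) (nth h xs i)) (trans (suc-% u) (m<n⇒m%n≡m lt)))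
                          (walk-step h walk (u % ℓ) lt)
    ... | inj₂ eq = trans (cong₂ a (walk-final h walk (u % ℓ) eq)
                            (trans (cong (nth h xs) (trans (suc-% u) (trans (cong (_% ℓ) eq) (n%n≡0 ℓ)))) (walk-first h walk))) close

  -- With `f = a x` the prefix closes to a cycle through x, and the number of neighbours of x on
  -- that cycle is known exactly.
  last-true : ∀ (f : V → Bool) {x xs y} → Walk x xs y → ∀ m → suc m ≤ cnt f xs →
              ∃ λ as → ∃ λ bs → ∃ λ z → xs ≡ as ++ bs × Walk x as z × f z ≡ true × cnt f as ≡ suc m
  last-true f (stop x) m le with f x in fx
  ... | true with m
  ...   | zero  = x ∷ [] , [] , x , refl , (stop x) , fx , cong (λ b → ⟦ b ⟧ + 0) fx
  last-true f (stop x) m (s≤s ()) | true | suc _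
  last-true f {x} (e ◅ p) m le with f x in fx
  ... | false with last-true f p m le
  ...   | as , bs , z , refl , w , fz , eq = x ∷ as , bs , z , refl , e ◅ w , fz , trans (cong (λ b → ⟦ b ⟧ + cnt f as) fx) eq
  last-true f {x} (_◅_ {ys = ys} e p) zero le | true =
    x ∷ [] , ys , x , refl , (stop x) , fx , cong (λ b → ⟦ b ⟧ + 0) fx
  last-true f {x} (e ◅ p) (suc m) le | true with last-true f p m (≤-pred le)
  ...   | as , bs , z , refl , w , fz , eq = x ∷ as , bs , z , refl , e ◅ w , fz , trans (cong (λ b → ⟦ b ⟧ + cnt f as) fx) (cong suc eq)

  extend : ∀ X {x xs y} → Walk x xs y → Unique xs → (∀ {z} → z ∈ xs → z ∉ X) → ∀ fuel → n ≤ fuel + length xs →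
           ∃ λ h → ∃ λ ys → Walk h ys y × Unique ys × (∀ {z} → z ∈ ys → z ∉ X)
                          × (∀ {z} → z ∈ xs → z ∈ ys) × (∀ z → a h z ≡ true → z ∈ ys ++ X)
  extend X {x} {xs} w u dis fuel le with find-outside (a x) (xs ++ X)
  ... | inj₂ stuck = x , xs , w , u , dis , (λ z∈ → z∈) , stuck
  ... | inj₁ (z , xz , z∉) with fuel
  ...   | zero = contradiction (≤-trans (s≤s le) (unique-length (Unique-∷ (z∉ ∘ ∈-++⁺ˡ) u))) (<⇒≱ ≤-refl)
  ...   | suc fuel with extend X {z} {z ∷ xs} (a-sym xz ◅ w) (Unique-∷ (z∉ ∘ ∈-++⁺ˡ) u)
                         (λ { (here refl) → z∉ ∘ ∈-++⁺ʳ xs ; (there z∈) → dis z∈ }) fuel (≤-trans le (≤-reflexive (sym (+-suc fuel _))))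
  ...     | h , ys , w′ , u′ , dis′ , sub , stuck = h , ys , w′ , u′ , dis′ , sub ∘ there , stuck

  -- The walk is extended at one end, reversed and extended at the other. The first end stays stuck
  -- because the second extension keeps all earlier vertices.
  maximal-walk : ∀ X {v} → v ∉ X → ∃ λ h → ∃ λ l → ∃ λ xs → Walk h xs l × Unique xs × (∀ {z} → z ∈ xs → z ∉ X)
                 × (∀ z → a h z ≡ true → z ∈ xs ++ X) × (∀ z → a l z ≡ true → z ∈ xs ++ X)
  maximal-walk X {v} v∉ with extend X {v} {v ∷ []} (stop v) (All.[] AP.∷ AP.[]) (λ { (here refl) → v∉ }) n (m≤m+n n 1)
  ... | h , xs , w , u , dis , _ , stuck with extend X (walk-reverse w) (Unique-resp-↭ (↭-sym (↭-reverse xs)) u)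
                                                (dis ∘ ∈-resp-↭ (↭-reverse xs)) n (m≤m+n n _)
  ...   | h′ , ys , w′ , u′ , dis′ , sub , stuck′ = h′ , h , ys , w′ , u′ , dis′ , stuck′ , λ z az →
            case ∈-++⁻ xs (stuck z az) of λ where
              (inj₁ z∈) → ∈-++⁺ˡ (sub (∈-resp-↭ (↭-sym (↭-reverse xs)) z∈))
              (inj₂ z∈) → ∈-++⁺ʳ ys z∈

∈-seg⁻ : ∀ {A : Set} (c : ℕ → A) u m {x} → x ∈ seg c u m → ∃ λ v → c v ≡ x
∈-seg⁻ c u (suc m) (here refl) = u , refl
∈-seg⁻ c u (suc m) (there x∈)  = ∈-seg⁻ c (suc u) m x∈

-- Long cycles in a graph of large minimum degree

opaque
  thin-arith : ∀ q A B ca cb cx l → cx ≡ ca + cb → ca ≡ suc q → 2 + q < cx → cb ≤ B → A + B ≤ suc l → A < l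
  thin-arith q A B ca cb cx l h1 h2 h3 h4 h5 =
    linear 0 (≤-reflexive h1 ⊕ ≤-reflexive h2 ⊕ h3 ⊕ h4 ⊕ h5) (solve (q ∷ A ∷ B ∷ ca ∷ cb ∷ cx ∷ l ∷ []))
  long-arith : ∀ j r₂ X d c → X + suc j * (2 + r₂) + 1 ≤ d → d ≤ c + X → suc r₂ ≤ c
  long-arith j r₂ X d c h1 h2 =
    linear (2 + j * r₂ + 2 * j) (h1 ⊕ h2) (solve (j ∷ r₂ ∷ X ∷ d ∷ c ∷ []))
  long-next : ∀ j r₂ X d c → X + suc j * (2 + r₂) + 1 ≤ d → c ≤ 2 + r₂ → c + X + j * (2 + r₂) + 1 ≤ d
  long-next j r₂ X d c h1 h2 =
    linear 0 (h1 ⊕ h2) (solve (j ∷ r₂ ∷ X ∷ d ∷ c ∷ []))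

module LongCycles {n : ℕ} (G : Graph n) (q : ℕ) where
  open Walks G

  private
    r = 2 + q

  index : ∀ {C} (R : Rotation C) {x} → x ∈ C → ∃ λ u → Rotation.at R u ≡ x
  index {C} R x∈ = ∈-seg⁻ at 0 (length C) (subst (_ ∈_) (sym seg-at) x∈)
    where open Rotation R

  around : ∀ {C} (R : Rotation C) u → let open Rotation R in
           ∃ λ l → Walk (at u) (seg at u (length C)) l × a l (at u) ≡ true
  around {C} R u = go (length C) refl
    where
    open Rotation R
    go : ∀ m → length C ≡ m → ∃ λ l → Walk (at u) (seg at u (length C)) l × a l (at u) ≡ true
    go zero    eq = contradiction eq (≢-nonZero⁻¹ (length C) {{nonZero}})
    go (suc m) eq = at (m + u) , subst (λ k → Walk (at u) (seg at u k) (at (m + u))) (sym eq) (walk-seg u m) ,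
      trans (cong (a (at (m + u))) (trans (sym (periodic u)) (cong (λ k → at (k + u)) eq))) (edge (m + u))

  cnt-self : ∀ {x xs y} → Walk x xs y → suc (cnt (a x) xs) ≤ length xs
  cnt-self {x} (stop x) rewrite adj-irrefl G x = s≤s z≤n
  cnt-self {x} (_◅_ {ys = ys} e p) rewrite adj-irrefl G x = s≤s (cnt≤length (a x) ys)

  Long : List V → Set
  Long C = IsCycle C × r ≤ length C

  -- Closing at the neighbour numbered `suc q`, that is r - 1, leaves x and r - 1 neighbours on the
  -- cycle, hence at least r vertices.
  close : ∀ {x xs y} → Walk x xs y → suc q ≤ cnt (a x) xs →
          ∃ λ as → ∃ λ bs → xs ≡ as ++ bs × Long as × cnt (a x) as ≡ suc q
  close {x} w le with last-true (a x) w q le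
  ... | as , bs , z , eq , w′ , xz , c = as , bs , eq ,
        ((x , z , w′ , a-sym xz) , ≤-trans (≤-reflexive (cong suc (sym c))) (cnt-self w′)) , c

  module _ (X : List V) where

    Avoids : List V → Set
    Avoids C = Unique C × (∀ {z} → z ∈ C → z ∉ X)

    Thin : List V → Set
    Thin C = ∀ x → x ∉ X → cnt (a x) C ≤ r

    -- Of more than r neighbours of x only r - 1 are kept, so at least two vertices are cut off.
    -- This outweighs the one vertex by which the walk may exceed C when x is put in front of it.
    shorten : ∀ {C : List V} {x xs y} → Walk x xs y → Avoids xs → length xs ≤ suc (length C) → r < cnt (a x) xs →
              ∃ λ C′ → Long C′ × Avoids C′ × length C′ < length C
    shorten {C} {x} {xs} w (u , dis) len≤ big with close w (≤-trans (m≤n+m (suc q) 2) big)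
    ... | as , bs , refl , long , c = as , long , (Unique-++ˡ as u , dis ∘ ∈-++⁺ˡ) ,
          thin-arith q (length as) (length bs) (cnt (a x) as) (cnt (a x) bs) _ (length C) (cnt-++ (a x) as bs) c big
            (cnt≤length (a x) bs) (≤-trans (≤-reflexive (sym (length-++ as))) len≤)

    make-thin : ∀ fuel {C} → length C ≤ fuel → Long C → Avoids C → ∃ λ C′ → Long C′ × Avoids C′ × Thin C′
    make-thin fuel {C} le long@(cyc , _) (u , dis) = decide (any? λ x → ¬? (x ∈? X) ×-dec (suc r ≤? cnt (a x) C))
      where
      R = rotation cyc
      open Rotation R
      shorter : (∃ λ x → x ∉ X × r < cnt (a x) C) → ∃ λ C′ → Long C′ × Avoids C′ × length C′ < length C
      shorter (x , x∉X , big) with x ∈? C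
      ... | yes x∈ with index R x∈
      ...   | v , refl = shorten {C} (proj₁ (proj₂ (around R v)))
                (Unique-resp-↭ (↭-sym (seg-↭ v)) u , dis ∘ ∈-resp-↭ (seg-↭ v))
                (≤-trans (≤-reflexive (length-seg at v (length C))) (n≤1+n _))
                (≤-trans big (≤-reflexive (sym (cnt-↭ (a x) (seg-↭ v)))))
      shorter (x , x∉X , big) | no x∉C with ∃-cnt (a x) C (≤-trans (s≤s z≤n) big)
      ...   | y , y∈ , xy with index R y∈
      ...     | v , refl = shorten {C} (xy ◅ proj₁ (proj₂ (around R v)))
                (Unique-∷ (x∉C ∘ ∈-resp-↭ (seg-↭ v)) (Unique-resp-↭ (↭-sym (seg-↭ v)) u) ,
                 λ { (here refl) → x∉X ; (there z∈) → dis (∈-resp-↭ (seg-↭ v) z∈) })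
                (≤-reflexive (cong suc (length-seg at v (length C))))
                (≤-trans big (≤-trans (≤-reflexive (sym (cnt-↭ (a x) (seg-↭ v)))) (m≤n+m _ _)))
      recurse : ∀ fuel → length C ≤ fuel → (∃ λ C′ → Long C′ × Avoids C′ × length C′ < length C) →
                ∃ λ C′ → Long C′ × Avoids C′ × Thin C′
      recurse zero       le (C′ , _ , _ , lt) = contradiction (≤-trans lt le) λ ()
      recurse (suc fuel) le (C′ , long , av , lt) = make-thin fuel (≤-pred (≤-trans lt le)) long av
      decide : Dec (∃ λ x → x ∉ X × r < cnt (a x) C) → ∃ λ C′ → Long C′ × Avoids C′ × Thin C′
      decide (no none)  = C , long , (u , dis) , λ x x∉X → ≮⇒≥ λ lt → none (x , x∉X , lt)
      decide (yes some) = recurse fuel le (shorter some)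

  -- A thin cycle takes at most r neighbours from each vertex outside X, so the degree hypothesis
  -- survives with j lowered by one. The surplus 1 gives a vertex of the new cycle a neighbour
  -- outside, where the next search starts.
  long-cycles : ∀ j X {v} → v ∉ X → (∀ w → w ∉ X → cnt (a w) X + j * r + 1 ≤ total (a w)) →
                ∃ λ ds → length ds ≡ j × All Long ds × Unique (concat ds) × (∀ {z} → z ∈ concat ds → z ∉ X)
                       × (∀ w → w ∉ X → w ∉ concat ds → cnt (a w) (concat ds) ≤ j * r)
                       × ∃ λ v → v ∉ X × v ∉ concat ds
  long-cycles zero    X {v} v∉ rich = [] , refl , All.[] , AP.[] , (λ ()) , (λ _ _ _ → z≤n) , v , v∉ , λ ()
  long-cycles (suc j) X {v} v∉ rich with maximal-walk X v∉
  ... | h , _ , xs , w , u , dis , stuck , _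
    with close w (long-arith j q (cnt (a h) X) (total (a h)) (cnt (a h) xs) (rich h (dis (walk-head∈ w)))
           (≤-trans (total≤cnt (a h) (xs ++ X) stuck) (≤-reflexive (cnt-++ (a h) xs X))))
  ... | as , bs , refl , long , _ with make-thin X (length as) ≤-refl long (Unique-++ˡ as u , dis ∘ ∈-++⁺ˡ)
  ...   | C , longC@((x , _ , wC , _) , _) , (uC , disC) , thin
    with outside (a x) (C ++ X) (≤-trans (≤-reflexive (cong suc (cnt-++ (a x) C X)))
           (≤-trans (≤-trans (≤-reflexive (+-comm 1 _)) (+-monoˡ-≤ 1 (m≤m+n _ (j * r))))
             (long-next j q (cnt (a x) X) (total (a x)) (cnt (a x) C) (rich x (disC (walk-head∈ wC))) (thin x (disC (walk-head∈ wC))))))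
  ...     | v′ , _ , v′∉
    with long-cycles j (C ++ X) {v′} v′∉ (λ w w∉ → ≤-trans (≤-reflexive (cong (λ s → s + j * r + 1) (cnt-++ (a w) C X)))
           (long-next j q (cnt (a w) X) (total (a w)) (cnt (a w) C) (rich w (w∉ ∘ ∈-++⁺ʳ C)) (thin w (w∉ ∘ ∈-++⁺ʳ C))))
  ...       | ds , len , longs , uds , disds , few , v″ , v″∉ , v″∉ds =
              C ∷ ds , cong suc len , longC All.∷ longs , unique , disjoint , few′ , v″ , v″∉ ∘ ∈-++⁺ʳ C , v″∉′
    where
    unique : Unique (C ++ concat ds)
    unique = Unique-++⁺ uC uds (λ z∈C z∈ds → disds z∈ds (∈-++⁺ˡ z∈C))
    disjoint : ∀ {z} → z ∈ C ++ concat ds → z ∉ X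
    disjoint z∈ with ∈-++⁻ C z∈
    ... | inj₁ z∈C = disC z∈C
    ... | inj₂ z∈ds = disds z∈ds ∘ ∈-++⁺ʳ C
    few′ : ∀ w → w ∉ X → w ∉ C ++ concat ds → cnt (a w) (C ++ concat ds) ≤ r + j * r
    few′ w w∉X w∉ = ≤-trans (≤-reflexive (cnt-++ (a w) C (concat ds)))
      (+-mono-≤ (thin w w∉X) (few w (λ w∈ → case ∈-++⁻ C w∈ of λ where
        (inj₁ w∈C) → w∉ (∈-++⁺ˡ w∈C)
        (inj₂ w∈X) → w∉X w∈X) (w∉ ∘ ∈-++⁺ʳ C)))
    v″∉′ : v″ ∉ C ++ concat ds
    v″∉′ v∈ with ∈-++⁻ C v∈
    ... | inj₁ v∈C  = v″∉ (∈-++⁺ˡ v∈C)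
    ... | inj₂ v∈ds = v″∉ds v∈ds

-- With A the goal and B i the blocking inequality at vertex i, this replaces the argument that an
-- unimprovable configuration satisfies the inequality everywhere.
finite-choice : ∀ n {A : Set} {B : Fin n → Set} → (∀ i → A ⊎ B i) → A ⊎ (∀ i → B i)
finite-choice zero    f = inj₂ λ ()
finite-choice (suc n) f with f Fin.zero | finite-choice n (f ∘ Fin.suc)
... | inj₁ x | _      = inj₁ x
... | inj₂ _ | inj₁ x = inj₁ x
... | inj₂ b | inj₂ g = inj₂ λ { Fin.zero → b ; (Fin.suc i) → g i }

all-choice : ∀ {X A : Set} {B : X → Set} xs → (∀ x → x ∈ xs → A ⊎ B x) → A ⊎ All B xs
all-choice []       f = inj₂ All.[]
all-choice (x ∷ xs) f with f x (here refl) | all-choice xs (λ y y∈ → f y (there y∈))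
... | inj₁ y | _       = inj₁ y
... | inj₂ _ | inj₁ y  = inj₁ y
... | inj₂ b | inj₂ bs = inj₂ (b All.∷ bs)

∧-true : ∀ {b c} → b ∧ c ≡ true → b ≡ true × c ≡ true
∧-true {true} {true} _ = refl , refl

opaque
  sum3-shuffle : ∀ x y z x′ y′ z′ → (x + x′) + (y + y′) + (z + z′) ≡ (x + y + z) + (x′ + y′ + z′)
  sum3-shuffle x y z x′ y′ z′ = solve (x ∷ y ∷ z ∷ x′ ∷ y′ ∷ z′ ∷ [])

cnt-concat : ∀ {A : Set} (f g : A → Bool) b {cs} → All (λ C → cnt f C + cnt f C + cnt g C ≤ b) cs →
             cnt f (concat cs) + cnt f (concat cs) + cnt g (concat cs) ≤ length cs * b
cnt-concat f g b All.[] = z≤n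
cnt-concat f g b {C ∷ cs} (le All.∷ les)
  rewrite cnt-++ f C (concat cs) | cnt-++ g C (concat cs) =
  ≤-trans (≤-reflexive (sum3-shuffle (cnt f C) (cnt f C) (cnt g C) _ _ _)) (+-mono-≤ le (cnt-concat f g b les))

module Shortcut {n : ℕ} (G : Graph n) where
  open Walks G

  walk-cnt-last : ∀ (f : V → Bool) {x xs y} → Walk x xs y → f y ≡ false → suc (cnt f xs) ≤ length xs
  walk-cnt-last f (stop x) eq rewrite eq = s≤s z≤n
  walk-cnt-last f (_◅_ {x} e w) eq = ≤-trans (≤-reflexive (sym (+-suc ⟦ f x ⟧ _))) (+-mono-≤ (⟦⟧≤1 (f x)) (walk-cnt-last f w eq))

  module _ {C : List V} (R : Rotation C) where
    open Rotation R

    -- x replaces the d vertices strictly between positions u and u+d+1.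
    shortcut : ∀ x u d m → length C ≡ d + suc m → a x (at u) ≡ true → a x (at (suc d + u)) ≡ true →
               IsCycle (x ∷ seg at (suc d + u) (suc m)) × C ↭ seg at (suc u) d ++ seg at (suc d + u) (suc m)
    shortcut x u d m eq xu xd =
      (x , at (m + (suc d + u)) , xd ◅ walk-seg (suc d + u) m , a-sym (trans (cong (a x) back) xu)) ,
      ↭-trans (↭-sym (seg-↭ (suc u))) (↭-reflexive (trans (cong (seg at (suc u)) eq)
        (trans (seg-++ at (suc u) d (suc m)) (cong (λ v → seg at (suc u) d ++ seg at v (suc m)) (+-suc d u)))))
      where
      back : at (m + (suc d + u)) ≡ at u
      back = trans (cong at (trans (lemma m d u) (cong (_+ u) (sym eq)))) (periodic u)
        where
        lemma : ∀ m d u → m + (suc d + u) ≡ d + suc m + u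
        lemma m d u = trans (sym (+-assoc m (suc d) u)) (cong (_+ u) (trans (+-suc m d) (trans (cong suc (+-comm m d)) (sym (+-suc d m)))))

-- Single improvements of the family and of the partial cycle

opaque
  short-len : ∀ l d m r → l ≡ d + suc m → r + d ≤ suc l → r ≤ suc (suc m)
  short-len l d m r h1 h2 =
    linear 0 (≤-reflexive h1 ⊕ h2) (solve (l ∷ d ∷ m ∷ r ∷ []))
  short-lt : ∀ l m d → l ≡ d + suc m → 2 ≤ d → suc (suc (suc m)) ≤ l
  short-lt l m d h1 h2 =
    linear 0 (≤-reflexive (sym h1) ⊕ h2) (solve (l ∷ m ∷ d ∷ []))
  short-fit : ∀ l d q → 2 + q + d ≤ suc l → suc d ≤ l
  short-fit l d q h1 =
    linear q (h1) (solve (l ∷ d ∷ q ∷ []))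
  e1-half : ∀ x y l r → 2 * r < x + x + y → x + x ≤ l * 1 → y + y ≤ l * 1 → 3 * l ≤ 4 * r → ⊥
  e1-half x y l r h1 h2 h3 h4 =
    1≰0 (*-cancelˡ-≤ 2 (linear 0 (2 ⊗ h1 ⊕ 2 ⊗ h2 ⊕ h3 ⊕ h4) (solve (x ∷ y ∷ l ∷ r ∷ []))))
  r<⇒fits : ∀ r l → r < l → r + 2 ≤ suc l
  r<⇒fits r l h1 =
    linear 0 (h1) (solve (r ∷ l ∷ []))
  *2 : ∀ r → r * 2 ≡ 2 * r
  *2 r = solve (r ∷ [])
  closing-arith : ∀ s T K c m → s ≤ suc T → T ≤ K + (0 + c) → suc c ≤ m → s + 1 ≤ K + suc m
  closing-arith s T K c m h1 h2 h3 =
    linear 0 (h1 ⊕ h2 ⊕ h3) (solve (s ∷ T ∷ K ∷ c ∷ m ∷ []))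
  p-small : ∀ p r L → p < r → r ≤ L → suc p ≤ L
  p-small p r L h1 h2 =
    linear 0 (h1 ⊕ h2) (solve (p ∷ r ∷ L ∷ []))

module State {n : ℕ} (G : Graph n) (q ρ : ℕ) (Goal : Set) (s : ℕ)
             (r≤ : 3 * suc ρ ≤ 2 + q)
             (degree : ∀ v → s ≤ total (adj G v))
             (codegree : ∀ u v → adj G u v ≡ true → s ≤ suc (total (common (adj G) u v))) where
  open Walks G public
  open LongCycles G q public
  open Shortcut G public

  r L : ℕ
  r = 2 + q
  L = r + suc ρ

  3L≤4r : 3 * L ≤ 4 * r
  3L≤4r = ≤-trans (≤-reflexive (*-distribˡ-+ 3 r (suc ρ))) (≤-trans (+-monoʳ-≤ (3 * r) r≤) (≤-reflexive (+-comm (3 * r) r)))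

  r≤L : r ≤ L
  r≤L = m≤m+n r (suc ρ)

  Good : List V → Set
  Good C = IsCycle C × r ≤ length C × length C ≤ L

  -- A partial cycle: a vertex, an edge or a cycle.
  Partial : V → V → List V → Set
  Partial h l P = Walk h P l × (a l h ≡ true ⊎ length P ≡ 1)

  partial-cases : ∀ {h l P} → Partial h l P → IsCycle P ⊎ (P ≡ h ∷ [] × l ≡ h)
  partial-cases (stop x , _)             = inj₂ (refl , refl)
  partial-cases (w@(_ ◅ _) , inj₁ lh)    = inj₁ (_ , _ , w , lh)
  partial-cases (_ ◅ stop _ , inj₂ ())
  partial-cases (_ ◅ (_ ◅ _) , inj₂ ())

  -- K counts the common neighbours off P of the closing edge; on P there are at most |P| − 2.
  closing-edge-total : ∀ {h l P} K → Partial h l P → total (common a h l) ≤ K + cnt (common a h l) P → s + 1 ≤ K + length P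
  closing-edge-total {h} K (stop .h , inj₁ e) _ = ⊥-elim (true≢false e (adj-irrefl G h))
  closing-edge-total {h} K (stop .h , inj₂ _) cover = +-monoˡ-≤ 1 (begin
    s                                   ≤⟨ degree h ⟩
    total (a h)                         ≡⟨ sum-cong n (λ z → cong ⟦_⟧ (sym (∧-idem (a h z)))) ⟩
    total (common a h h)                ≤⟨ cover ⟩
    K + (⟦ common a h h h ⟧ + 0)        ≡⟨ cong (λ b → K + (⟦ b ⟧ + 0)) (trans (∧-idem (a h h)) (adj-irrefl G h)) ⟩
    K + 0                               ≡⟨ +-identityʳ K ⟩
    K                                   ∎)
    where open ≤-Reasoning
  closing-edge-total {h} {l} K (_◅_ {ys = ys} e w , inj₁ lh) cover = closing-arith s (total A) K (cnt A ys) (length ys)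
      (codegree h l (a-sym lh))
      (≤-trans cover (≤-reflexive (cong (λ b → K + (⟦ b ∧ a l h ⟧ + cnt A ys)) (adj-irrefl G h))))
      (walk-cnt-last A w (trans (cong (a h l ∧_) (adj-irrefl G l)) (∧-zeroʳ (a h l))))
    where
    A : V → Bool
    A = common a h l
  closing-edge-total K (_ ◅ stop _ , inj₂ ())
  closing-edge-total K (_ ◅ (_ ◅ _) , inj₂ ())

  -- The three fields encode the lexicographic order: `smaller` forgets the partial cycle, while
  -- `longer` must preserve the number of vertices in the family. The result of `longer` may have up
  -- to L vertices, since from r on it can join the family.
  record Continuations (cs : List (List V)) (p : ℕ) : Set where
    field
      more    : ∀ cs′ → length cs′ ≡ suc (length cs) → All Good cs′ → Unique (concat cs′) → Goal
      smaller : ∀ cs′ → length cs′ ≡ length cs → All Good cs′ → Unique (concat cs′) →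
                length (concat cs′) < length (concat cs) → Goal
      longer  : ∀ cs′ {h l P′} → length cs′ ≡ length cs → All Good cs′ → Partial h l P′ → Unique (concat cs′ ++ P′) →
                length (concat cs′) ≡ length (concat cs) → p < length P′ → length P′ ≤ L → Goal

  module Stuck (cs : List (List V)) (good : All Good cs) {h l : V} (P : List V) (partial : Partial h l P)
               (p<r : length P < r) (uniq : Unique (concat cs ++ P)) (cont : Continuations cs (length P)) where
    open Continuations cont public

    U X : List V
    U = concat cs
    X = U ++ P

    A : V → Bool
    A = common a h l

    A-head : ∀ {z} → A z ≡ true → a h z ≡ true
    A-head {z} = proj₁ ∘ ∧-true {a h z}

    enter : ∀ {c} → A c ≡ true → Partial c l (c ∷ P)
    enter Ac with ∧-true Ac
    ... | hc , lc = a-sym hc ◅ proj₁ partial , inj₁ lc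

    p<L : suc (length P) ≤ L
    p<L = p-small (length P) r L p<r r≤L

    stuck? : Goal ⊎ (∀ z → A z ≡ true → z ∈ X)
    stuck? with find-outside A X
    ... | inj₂ stuck = inj₂ stuck
    ... | inj₁ (z , Az , z∉) = inj₁ (longer cs refl good (enter Az)
            (Unique-resp-↭ (↭-sym (shift z U P)) (Unique-∷ z∉ uniq)) refl ≤-refl p<L)

    A-total : (∀ z → A z ≡ true → z ∈ X) → s + 1 ≤ cnt A U + length P
    A-total stuck = closing-edge-total (cnt A U) partial (≤-trans (total≤cnt A X stuck) (≤-reflexive (cnt-++ A U P)))

    length-U : ∀ (C D : List V) → U ↭ C ++ D → length U ≡ length C + length D
    length-U C D p = trans (↭-length p) (length-++ C)

    -- A vertex adjacent to two consecutive vertices of P is inserted between them: a shortcut with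
    -- d = 0, dropping nothing.
    apart : ∀ {w} → w ∉ X → (R : Rotation P) → (∃ λ u → a w (Rotation.at R u) ≡ true × a w (Rotation.at R (1 + u)) ≡ true) → Goal
    apart {w} w∉ R (u , wu , wu′) = go (length P) refl
      where
      open Rotation R
      go : ∀ m → length P ≡ m → Goal
      go zero    eq = contradiction eq (≢-nonZero⁻¹ (length P) {{nonZero}})
      go (suc m) eq with shortcut R w u 0 m eq wu wu′
      ... | (h′ , l′ , walk , close′) , p = longer cs refl good (walk , inj₁ close′)
            (Unique-resp-↭ (↭-trans (++⁺ˡ (w ∷ U) p) (↭-sym (shift w U _))) (Unique-∷ w∉ uniq)) refl
            (≤-reflexive (cong suc (sym len))) (≤-trans (≤-reflexive (cong suc len)) p<L)
        where
        len : length (seg at (1 + u) (suc m)) ≡ length P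
        len = trans (length-seg at (1 + u) (suc m)) (sym eq)

    -- More than half of P would include two consecutive vertices. If P is one vertex h, then A is
    -- the whole neighbourhood of h, so a neighbour w outside X contradicts that P is stuck.
    P-half : ∀ w → w ∉ X → (∀ z → A z ≡ true → z ∈ X) → Goal ⊎ (cnt (a w) P + cnt (a w) P ≤ length P * 1)
    P-half w w∉ stuck with partial-cases partial
    ... | inj₂ (refl , refl) = inj₂ (single (a w h) refl)
      where
      single : ∀ b → a w h ≡ b → ⟦ a w h ⟧ + 0 + (⟦ a w h ⟧ + 0) ≤ 1
      single false eq rewrite eq = z≤n
      single true  eq = ⊥-elim (w∉ (stuck w (cong₂ _∧_ (a-sym eq) (a-sym eq))))
    ... | inj₁ cyc with ≤-<-connex (cnt (a w) P + cnt (a w) P) (length P * 1)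
    ...   | inj₁ le = inj₂ le
    ...   | inj₂ gt = inj₁ (apart w∉ R (Pattern.find-pair (periodic-∘ (a w)) 1
              (subst (λ c → length P * 1 < c + c) (sym (count≡cnt (a w))) gt)))
      where
      R : Rotation P
      R = rotation cyc
      open Rotation R

    module OnCycle {C : List V} (C∈ : C ∈ cs) where

      goodC : Good C
      goodC = All.lookup good C∈

      R : Rotation C
      R = rotation (proj₁ goodC)

      open Rotation R public

      cs′ : List (List V)
      cs′ = proj₁ (extract C∈)

      D : List V
      D = concat cs′

      cs↭ : cs ↭ C ∷ cs′
      cs↭ = proj₂ (extract C∈)

      |cs| : length cs ≡ suc (length cs′)
      |cs| = ↭-length cs↭

      good′ : All Good cs′
      good′ = All.tail (All-resp-↭ cs↭ good)

      U↭ : U ↭ C ++ D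
      U↭ = concat-↭ cs↭

      -- C loses d consecutive vertices and gains x, hence becomes shorter.
      bypass : ∀ x → x ∉ U → ∀ d → 2 ≤ d → r + d ≤ suc (length C) →
               (∃ λ u → a x (at u) ≡ true × a x (at (suc d + u)) ≡ true) → Goal
      bypass x x∉ d 2≤d fits (u , xu , xd) with ≤⇒∃ {suc d} {length C} (short-fit (length C) d q fits)
      ... | m , eq with shortcut R x u d m (trans (sym eq) (sym (+-suc d m))) xu xd
      ...   | cyc , p = smaller (C′ ∷ cs′) (sym |cs|) ((cyc ,
              ≤-trans (short-len (length C) d m r eq′ fits) (≤-reflexive (sym len)) ,
              ≤-trans (≤-reflexive len) (≤-trans (<⇒≤ shorter) (proj₂ (proj₂ goodC)))) All.∷ good′)
              (Unique-⊆ (C′ ++ D) (seg at (suc u) d) perm (Unique-∷ x∉ (Unique-++ˡ U uniq)))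
              (≤-trans (s≤s (≤-reflexive (length-++ C′))) (≤-trans (+-monoˡ-≤ (length D) (≤-trans (s≤s (≤-reflexive len)) shorter))
                (≤-reflexive (sym (length-U C D U↭)))))
        where
        C′ rest : List V
        rest = seg at (suc d + u) (suc m)
        C′ = x ∷ rest
        eq′ : length C ≡ d + suc m
        eq′ = trans (sym eq) (sym (+-suc d m))
        len : length C′ ≡ suc (suc m)
        len = cong suc (length-seg at (suc d + u) (suc m))
        shorter : suc (suc (suc m)) ≤ length C
        shorter = short-lt (length C) m d eq′ 2≤d
        perm : x ∷ U ↭ (C′ ++ D) ++ seg at (suc u) d
        perm = ↭-trans (++⁺ˡ (x ∷ []) (↭-trans U↭ (++⁺ʳ D p)))
          (↭-solve 4 (λ x S T D → x ∙ ((S ∙ T) ∙ D) ⊜ ((x ∙ T) ∙ D) ∙ S) ↭-refl (x ∷ []) (seg at (suc u) d) rest D)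

      -- More than half of the positions contain two at distance 3, between which x replaces two
      -- vertices. As r < |C|, the result keeps at least r vertices.
      half : ∀ x → x ∉ U → r < length C → length C * 1 < cnt (a x) C + cnt (a x) C → Goal
      half x x∉ r<C big = bypass x x∉ 2 ≤-refl (r<⇒fits r (length C) r<C)
        (Pattern.find-pair (periodic-∘ (a x)) 3 (subst (λ c → length C * 1 < c + c) (sym (count≡cnt (a x))) big))

      -- w takes the place of the vertex c between two of its neighbours, and c, a common neighbour
      -- of the ends of P, enters P; the size of the family is unchanged.
      swap-in : ∀ w → w ∉ X → (∃ λ u → a w (at u) ≡ true × A (at (1 + u)) ≡ true × a w (at (2 + u)) ≡ true) → Goal
      swap-in w w∉ (u , wu , Ac , wu₂) with ≤⇒∃ {2} {length C} (≤-trans (m≤m+n 2 q) (proj₁ (proj₂ goodC)))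
      ... | m , eq with shortcut R w u 1 m (sym eq) wu wu₂
      ...   | cyc , p = longer (C′ ∷ cs′) (sym |cs|)
              ((cyc , ≤-trans (proj₁ (proj₂ goodC)) (≤-reflexive (sym |C′|)) , ≤-trans (≤-reflexive |C′|) (proj₂ (proj₂ goodC))) All.∷ good′)
              (enter Ac) (Unique-resp-↭ perm (Unique-∷ w∉ uniq))
              (trans (length-++ C′) (trans (cong (_+ length D) |C′|) (sym (length-U C D U↭)))) ≤-refl p<L
        where
        rest C′ : List V
        rest = seg at (2 + u) (suc m)
        C′ = w ∷ rest
        |C′| : length C′ ≡ length C
        |C′| = trans (cong suc (length-seg at (2 + u) (suc m))) eq
        c : V
        c = at (1 + u)
        perm : w ∷ (U ++ P) ↭ (C′ ++ D) ++ (c ∷ P)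
        perm = ↭-trans (++⁺ˡ (w ∷ []) (++⁺ʳ P (↭-trans U↭ (++⁺ʳ D p))))
          (↭-solve 5 (λ w c T D P → w ∙ (((c ∙ T) ∙ D) ∙ P) ⊜ ((w ∙ T) ∙ D) ∙ (c ∙ P)) ↭-refl (w ∷ []) (c ∷ []) rest D P)

      h∉U : h ∉ U
      h∉U h∈ = Unique-disjoint U uniq h∈ (walk-head∈ (proj₁ partial))

      -- For |C| = r averaging yields a vertex to swap. For |C| > r both w and h see at most half of
      -- C by `half`, and A lies in the neighbourhood of h, so the left side would be at most 3|C|/2
      -- ≤ 2r.
      e1 : ∀ w → w ∉ X → 2 * r < cnt (a w) C + cnt (a w) C + cnt A C → Goal
      e1 w w∉ big with m≤n⇒m<n∨m≡n (proj₁ (proj₂ goodC))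
      ... | inj₂ r≡C = swap-in w w∉ (Pattern.find-triple (periodic-∘ (a w)) (periodic-∘ A)
              (subst₂ _<_ (trans (sym (*2 r)) (cong (_* 2) r≡C))
                (sym (cong₂ (λ x y → x + x + y) (count≡cnt (a w)) (count≡cnt A))) big))
      ... | inj₁ r<C with ≤-<-connex (cnt (a w) C + cnt (a w) C) (length C * 1)
      ...   | inj₂ gt = half w (w∉ ∘ ∈-++⁺ˡ) r<C gt
      ...   | inj₁ le with ≤-<-connex (cnt (a h) C + cnt (a h) C) (length C * 1)
      ...     | inj₂ gt = half h h∉U r<C gt
      ...     | inj₁ le′ = ⊥-elim (e1-half (cnt (a w) C) (cnt (a h) C) (length C) r
                  (≤-trans big (+-monoʳ-≤ (cnt (a w) C + cnt (a w) C) (cnt-mono (λ z → A-head {z}) C))) le le′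
                  (≤-trans (*-monoʳ-≤ 3 (proj₂ (proj₂ goodC))) 3L≤4r))

    Facts : V → Set
    Facts w = All (λ C → cnt (a w) C + cnt (a w) C + cnt A C ≤ 2 * r) cs × cnt (a w) P + cnt (a w) P ≤ length P * 1

    facts? : (∀ z → A z ≡ true → z ∈ X) → Goal ⊎ (∀ w → w ∉ X → Facts w)
    facts? stuck = finite-choice n λ w → decide w (w ∈? X)
      where
      one : ∀ w → w ∉ X → Goal ⊎ (w ∉ X → Facts w)
      one w w∉ with all-choice {A = Goal} {B = λ C → cnt (a w) C + cnt (a w) C + cnt A C ≤ 2 * r} cs (λ C C∈ →
          case ≤-<-connex (cnt (a w) C + cnt (a w) C + cnt A C) (2 * r) of λ where
            (inj₁ le) → inj₂ le
            (inj₂ gt) → inj₁ (OnCycle.e1 C∈ w w∉ gt))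
                    | P-half w w∉ stuck
      ... | inj₁ g | _       = inj₁ g
      ... | inj₂ _ | inj₁ g  = inj₁ g
      ... | inj₂ b | inj₂ b′ = inj₂ λ _ → b , b′
      decide : ∀ w → Dec (w ∈ X) → Goal ⊎ (w ∉ X → Facts w)
      decide w (yes w∈) = inj₂ λ w∉ → contradiction w∈ w∉
      decide w (no w∉)  = one w w∉

-- The second partial cycle and the recombination

opaque
  rich-arith : ∀ t j q cU cP aU p deg s → cU + cU + aU ≤ t * (2 * (3 + q)) → s + 1 ≤ aU + p →
    cP + cP ≤ p * 1 → s ≤ deg → p < 3 + q → 2 * (suc t + j) * (3 + q) < 3 * s →
    cU + cP + j * (3 + q) + 1 ≤ deg
  rich-arith t j q cU cP aU p deg s h1 h2 h3 h4 h5 h6 =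
    *-cancelˡ-≤ 2 (linear 2 (h1 ⊕ h2 ⊕ h3 ⊕ 2 ⊗ h4 ⊕ 2 ⊗ h5 ⊕ h6)
      (solve (t ∷ j ∷ q ∷ cU ∷ cP ∷ aU ∷ p ∷ deg ∷ s ∷ [])))

  room-arith : ∀ t j q ρ u p n → u ≤ t * (3 + q + suc ρ) → 3 * suc ρ ≤ 3 + q → p < 3 + q →
    4 * (suc t + j) * (3 + q) + 3 ≤ 3 * n → u + p < n
  room-arith t j q ρ u p n h1 h2 h3 h4 =
    *-cancelˡ-≤ 3 (linear (6 + q + 4 * j * q + 12 * j) (3 ⊗ h1 ⊕ 3 ⊗ h3 ⊕ h4 ⊕ t ⊗ h2)
      (solve (t ∷ j ∷ q ∷ ρ ∷ u ∷ p ∷ n ∷ [])))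

  end-arith : ∀ t j q cU cP cD cW aU p deg s → cU + cU + aU ≤ t * (2 * (3 + q)) → s + 1 ≤ aU + p → s ≤ deg →
    deg ≤ cW + (cU + cP + cD) → cD ≤ j * (3 + q) → 2 * (suc t + j) * (3 + q) < 3 * s →
    2 * (3 + q) + 2 ≤ 2 * cW + 2 * cP + p
  end-arith t j q cU cP cD cW aU p deg s h1 h2 h3 h4 h5 h6 =
    linear 0 (h1 ⊕ h2 ⊕ 2 ⊗ h3 ⊕ 2 ⊗ h4 ⊕ 2 ⊗ h5 ⊕ h6)
      (solve (t ∷ j ∷ q ∷ cU ∷ cP ∷ cD ∷ cW ∷ aU ∷ p ∷ deg ∷ s ∷ []))

  ends-contra : ∀ f w p c r → f + f + 2 * w ≤ p + 2 → 2 * r + 2 ≤ 2 * c + 2 * f + p → suc c ≤ w → p < r → ⊥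
  ends-contra f w p c r h1 h2 h3 h4 =
    1≰0 (*-cancelˡ-≤ 4 (linear 0 (h1 ⊕ h2 ⊕ 2 ⊗ h3 ⊕ 2 ⊗ h4) (solve (f ∷ w ∷ p ∷ c ∷ r ∷ []))))

  around₁ : ∀ w d m p → p ≡ d + suc m → suc d ≤ w → p < w + suc m
  around₁ w d m p h1 h2 =
    linear 0 (≤-reflexive h1 ⊕ h2) (solve (w ∷ d ∷ m ∷ p ∷ []))
  around₂ : ∀ w D p → p ≤ D + w → p < w + suc D
  around₂ w D p h1 =
    linear 0 (h1) (solve (w ∷ D ∷ p ∷ []))

  cnt-pos : ∀ c f p q → 2 * (3 + q) + 2 ≤ 2 * c + 2 * f + p → f ≤ 1 → p < 3 + q → 1 ≤ 2 * c
  cnt-pos c f p q h1 h2 h3 =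
    *-cancelˡ-≤ 4 (linear (6 * c + q) (h1 ⊕ 2 ⊗ h2 ⊕ h3) (solve (c ∷ f ∷ p ∷ q ∷ [])))
  enough-arith : ∀ c f p r m → 2 * r + 2 ≤ 2 * c + 2 * f + p → suc c ≤ m → 2 * r + 4 ≤ 2 * m + 2 * f + p
  enough-arith c f p r m h1 h2 =
    linear 0 (h1 ⊕ 2 ⊗ h2) (solve (c ∷ f ∷ p ∷ r ∷ m ∷ []))
  enough-suc : ∀ c f p r → 2 * r + 4 ≤ 2 * c + 2 * f + p → 2 * r + 4 ≤ 2 * (c + 1) + 2 * f + p
  enough-suc c f p r h1 =
    linear 2 (h1) (solve (c ∷ f ∷ p ∷ r ∷ []))
  choose-arith : ∀ t j q s p aU → 5 * aU ≤ t * (3 * (3 + q) + 1) → s + 1 ≤ aU + p → p < 3 + q →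
    2 * (suc t + j) * (3 + q) < 3 * s → 5 ≤ t + j → ⊥
  choose-arith t j q s p aU h1 h2 h3 h4 h5 =
    1≰0 (*-cancelˡ-≤ 20 (linear (9 * j * q + 30 * j) (3 ⊗ h1 ⊕ 15 ⊗ h2 ⊕ 15 ⊗ h3 ⊕ 5 ⊗ h4 ⊕ q ⊗ h5)
      (solve (t ∷ j ∷ q ∷ s ∷ p ∷ aU ∷ []))))
  tight-half : ∀ a r l → 3 * r + 2 ≤ 5 * a → l ≡ suc r → 3 ≤ r → a + a ≤ l * 1 → ⊥
  tight-half a r l h1 h2 h3 h4 =
    1≰0 (*-cancelˡ-≤ 2 (linear 0 (2 ⊗ h1 ⊕ 5 ⊗ ≤-reflexive h2 ⊕ h3 ⊕ 5 ⊗ h4) (solve (a ∷ r ∷ l ∷ []))))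
  tight-seven : ∀ a r l → 3 * r + 2 ≤ 5 * a → 3 * l ≤ 4 * r → l * 3 < 7 * a
  tight-seven a r l h1 h2 =
    *-cancelˡ-≤ 3 (linear (a + 5) (4 ⊗ h1 ⊕ 3 ⊗ h2) (solve (a ∷ r ∷ l ∷ [])))
  fits-3 : ∀ r l → suc (suc r) ≤ l → r + 3 ≤ suc l
  fits-3 r l h1 =
    linear 0 (h1) (solve (r ∷ l ∷ []))
  ab-arith : ∀ t′ j q s p p′ f aC aD bC bD i j₂ aU bU → s + 1 ≤ aU + p → s + 1 ≤ bU + f + p′ → aU ≡ aC + aD →
    bU ≡ bC + bD → bD + bD + aD ≤ t′ * (2 * (3 + q)) → 2 * (suc (suc t′) + j) * (3 + q) < 3 * s → f ≤ 1 →
    suc p + i ≡ 3 + q → suc p′ + j₂ ≡ 3 + q → 3 + q + 2 + 2 * suc j₂ + suc i ≤ bC + bC + aC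
  ab-arith t′ j q s p p′ f aC aD bC bD i j₂ aU bU h1 h2 h3 h4 h5 h6 h7 h8 h9 =
    linear (2 * j * q + 6 * j) (h1 ⊕ 2 ⊗ h2 ⊕ ≤-reflexive h3 ⊕ 2 ⊗ ≤-reflexive h4 ⊕ h5 ⊕ h6 ⊕ 2 ⊗ h7 ⊕ ≤-reflexive h8 ⊕ 2 ⊗ ≤-reflexive h9)
      (solve (t′ ∷ j ∷ q ∷ s ∷ p ∷ p′ ∷ f ∷ aC ∷ aD ∷ bC ∷ bD ∷ i ∷ j₂ ∷ aU ∷ bU ∷ []))
  ij-arith : ∀ p p′ f i j₂ r → 2 * r + 4 ≤ 2 * p′ + 2 * f + p → f ≤ 1 → suc p + i ≡ r → suc p′ + j₂ ≡ r →
    2 * suc j₂ + suc i + 2 ≤ r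
  ij-arith p p′ f i j₂ r h1 h2 h3 h4 =
    linear 0 (h1 ⊕ 2 ⊗ h2 ⊕ ≤-reflexive h3 ⊕ 2 ⊗ ≤-reflexive h4) (solve (p ∷ p′ ∷ f ∷ i ∷ j₂ ∷ r ∷ []))
  i≤j-arith : ∀ p p′ i j₂ r → p′ ≤ p → suc p + i ≡ r → suc p′ + j₂ ≡ r → i ≤ j₂
  i≤j-arith p p′ i j₂ r h1 h2 h3 =
    linear 0 (h1 ⊕ ≤-reflexive h2 ⊕ ≤-reflexive (sym h3)) (solve (p ∷ p′ ∷ i ∷ j₂ ∷ r ∷ []))
  join-lo : ∀ m j₂ p′ r → suc p′ + j₂ ≡ r → j₂ ≤ m → r ≤ suc m + p′
  join-lo m j₂ p′ r h1 h2 =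
    linear 0 (≤-reflexive (sym h1) ⊕ h2) (solve (m ∷ j₂ ∷ p′ ∷ r ∷ []))
  join-hi : ∀ m j₂ p′ r ρ → suc p′ + j₂ ≡ r → m ≤ j₂ + ρ → suc m + p′ ≤ r + ρ
  join-hi m j₂ p′ r ρ h1 h2 =
    linear 0 (≤-reflexive h1 ⊕ h2) (solve (m ∷ j₂ ∷ p′ ∷ r ∷ ρ ∷ []))
  split-fit : ∀ n v l u m d → suc (n + v) ≤ l + u → suc (m + u) + d ≡ v → suc m + (d + suc n) ≤ l
  split-fit n v l u m d h1 h2 =
    linear 0 (h1 ⊕ ≤-reflexive h2) (solve (n ∷ v ∷ l ∷ u ∷ m ∷ d ∷ []))

cnt-concat₅ : ∀ {A : Set} (g : A → Bool) b {cs} → All (λ C → 5 * cnt g C ≤ b) cs → 5 * cnt g (concat cs) ≤ length cs * b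
cnt-concat₅ g b All.[] = z≤n
cnt-concat₅ g b {C ∷ cs} (le All.∷ les) = ≤-trans
  (≤-reflexive (trans (cong (5 *_) (cnt-++ g C (concat cs))) (*-distribˡ-+ 5 (cnt g C) (cnt g (concat cs)))))
  (+-mono-≤ le (cnt-concat₅ g b les))

length-concat : ∀ {A : Set} L (cs : List (List A)) → All (λ C → length C ≤ L) cs → length (concat cs) ≤ length cs * L
length-concat L []       All.[]           = z≤n
length-concat L (C ∷ cs) (le All.∷ les) = ≤-trans (≤-reflexive (length-++ C)) (+-mono-≤ le (length-concat L cs les))

module Finish {n : ℕ} (G : Graph n) (q ρ : ℕ) (Goal : Set) (s : ℕ)
              (r≤ : 3 * suc ρ ≤ 3 + q) (≤r : 3 + q ≤ 3 * suc ρ + 2)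
              (degree : ∀ v → s ≤ total (adj G v))
              (codegree : ∀ u v → adj G u v ≡ true → s ≤ suc (total (common (adj G) u v))) where
  open State G (suc q) ρ Goal s r≤ degree codegree public

  module Search (cs : List (List V)) (good : All Good cs) {h l : V} (P : List V) (partial : Partial h l P)
                (p<r : length P < r) (uniq : Unique (concat cs ++ P)) (cont : Continuations cs (length P))
                (j : ℕ) (dense : 2 * (suc (length cs) + j) * r < 3 * s) (large : 4 * (suc (length cs) + j) * r + 3 ≤ 3 * n)
                (k≥6 : 5 ≤ length cs + j)
                (done : ∀ cs′ → length cs′ ≡ suc (length cs) + j → All Long cs′ → Unique (concat cs′) → Goal)
                where
    open Stuck cs good P partial p<r uniq cont public

    t p : ℕ
    t = length cs
    p = length P

    -- The family covers at most 4rt/3 vertices with t < k, and P fewer than r; the order of the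
    -- graph exceeds 4kr/3.
    room : ∃ λ v → v ∉ X
    room = outside-length X (≤-trans (≤-reflexive (cong suc (length-++ U)))
      (room-arith t j q ρ (length U) p n (length-concat L cs (All.map (proj₂ ∘ proj₂) good)) r≤ p<r large))

    module WithFacts (stuck : ∀ z → A z ≡ true → z ∈ X) (facts : ∀ w → w ∉ X → Facts w) where

      A-tot : s + 1 ≤ cnt A U + p
      A-tot = A-total stuck

      U-bound : ∀ w → w ∉ X → cnt (a w) U + cnt (a w) U + cnt A U ≤ t * (2 * r)
      U-bound w w∉ = cnt-concat (a w) A (2 * r) (proj₁ (facts w w∉))

      -- `U-bound` and `A-tot` give at most rt - (s + 1 - p)/2 neighbours in U, and P holds at most
      -- p/2. Since p < r and 3s > 2kr, more than jr neighbours remain, where j = k - t - 1 cycles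
      -- are to be found.
      rich : ∀ w → w ∉ X → cnt (a w) X + j * r + 1 ≤ total (a w)
      rich w w∉ = ≤-trans (≤-reflexive (cong (λ c → c + j * r + 1) (cnt-++ (a w) U P)))
        (rich-arith t j q (cnt (a w) U) (cnt (a w) P) (cnt A U) p (total (a w)) s (U-bound w w∉) A-tot
          (proj₂ (facts w w∉)) (degree w) p<r dense)

      module WithLong (ds : List (List V)) (|ds| : length ds ≡ j) (long : All Long ds) (X₂ : List V)
                      (X₂-def : X₂ ≡ X ++ concat ds) (uniq₂ : Unique X₂)
                      (few : ∀ w → w ∉ X → w ∉ concat ds → cnt (a w) (concat ds) ≤ j * r) where

        outX : ∀ {w} → w ∉ X₂ → w ∉ X
        outX w∉ w∈ = w∉ (subst (_ ∈_) (sym X₂-def) (∈-++⁺ˡ w∈))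

        outD : ∀ {w} → w ∉ X₂ → w ∉ concat ds
        outD w∉ w∈ = w∉ (subst (_ ∈_) (sym X₂-def) (∈-++⁺ʳ X w∈))

        -- A cycle with fewer than r vertices replaces P. One with at least r completes the family
        -- and the j cycles `ds` to k cycles; no upper bound on its size is required at this final
        -- stage.
        big-cycle : ∀ ws → Unique (X₂ ++ ws) → ∀ xs rest → IsCycle xs → P ++ ws ↭ xs ++ rest → p < length xs → Goal
        big-cycle ws u xs rest cyc@(h′ , l′ , w , close′) perm p< with ≤-<-connex r (length xs)
        ... | inj₂ xs<r = longer cs refl good (w , inj₁ close′)
                (Unique-⊆ (U ++ xs) (rest ++ concat ds) perm′ u) refl p< (≤-trans (<⇒≤ xs<r) r≤L)
          where
          perm′ : X₂ ++ ws ↭ (U ++ xs) ++ (rest ++ concat ds)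
          perm′ = ↭-trans (↭-reflexive (cong (_++ ws) X₂-def))
            (↭-trans (↭-solve 4 (λ U P D W → ((U ∙ P) ∙ D) ∙ W ⊜ (U ∙ (P ∙ W)) ∙ D) ↭-refl U P (concat ds) ws)
            (↭-trans (++⁺ʳ (concat ds) (++⁺ˡ U perm))
              (↭-solve 4 (λ U S R D → (U ∙ (S ∙ R)) ∙ D ⊜ (U ∙ S) ∙ (R ∙ D)) ↭-refl U xs rest (concat ds))))
        ... | inj₁ r≤xs = done (xs ∷ cs ++ ds)
                (cong suc (trans (length-++ cs) (cong (t +_) |ds|)))
                ((cyc , r≤xs) All.∷ AllP.++⁺ (All.map (λ { (c , lo , _) → c , lo }) good) long)
                (Unique-⊆ (xs ++ concat (cs ++ ds)) rest perm′ u)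
          where
          perm′ : X₂ ++ ws ↭ (xs ++ concat (cs ++ ds)) ++ rest
          perm′ = ↭-trans (↭-reflexive (cong (_++ ws) X₂-def))
            (↭-trans (↭-solve 4 (λ U P D W → ((U ∙ P) ∙ D) ∙ W ⊜ (P ∙ W) ∙ (U ∙ D)) ↭-refl U P (concat ds) ws)
            (↭-trans (++⁺ʳ (U ++ concat ds) perm)
            (↭-trans (↭-solve 4 (λ S R U D → (S ∙ R) ∙ (U ∙ D) ⊜ (S ∙ (U ∙ D)) ∙ R) ↭-refl xs rest U (concat ds))
              (↭-reflexive (cong (λ z → (xs ++ z) ++ rest) (concat-++ cs ds))))))

        record End : Set where
          field
            e y     : V
            ws      : List V
            walk    : Walk e ws y
            uniqW   : Unique (X₂ ++ ws)
            e∉X     : e ∉ X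
            -- Common neighbours counted at e may be wasted on P; this limits the waste to one
            -- vertex.
            few-P   : cnt (a e) P ≤ 1
            many    : 2 * r + 2 ≤ 2 * cnt (a e) ws + 2 * cnt (a e) P + p

        -- All neighbours of e lie in ws, U, P or `ds`. Subtracting the bounds for U and `ds` from
        -- s, doubling, and using 3s > 2kr leaves 2r + 2.
        end-many : ∀ {ws} e → e ∉ X₂ → (∀ z → a e z ≡ true → z ∈ ws ++ X₂) →
                   2 * r + 2 ≤ 2 * cnt (a e) ws + 2 * cnt (a e) P + p
        end-many {ws} e e∉ stk = end-arith t j q (cnt (a e) U) (cnt (a e) P) (cnt (a e) (concat ds)) (cnt (a e) ws) (cnt A U) p (total (a e)) s
          (U-bound e (outX e∉)) A-tot (degree e)
          (≤-trans (total≤cnt (a e) (ws ++ X₂) stk) (≤-reflexive (trans (cnt-++ (a e) ws X₂)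
            (cong (cnt (a e) ws +_) (trans (cong (cnt (a e)) X₂-def) (trans (cnt-++ (a e) X (concat ds)) (cong (_+ cnt (a e) (concat ds)) (cnt-++ (a e) U P))))))))
          (few e (outX e∉) (outD e∉)) dense

        module BothEnds {h₁ l₁ ws} (walk : Walk h₁ ws l₁) (uniqW : Unique (X₂ ++ ws)) (R : Rotation P) where
          open Rotation R

          -- The path ws replaces the D - 1 vertices of P strictly between its two attachments, on
          -- the shorter or the longer way round; either way the cycle has more than p vertices.
          far : ∀ y D → 1 ≤ D → D < p → (D ≤ length ws ⊎ p ≤ D + length ws) →
                a l₁ (at y) ≡ true → a h₁ (at (D + y)) ≡ true → Goal
          far y (suc d) 1≤D D<p (inj₁ D≤) ly hD with ≤⇒∃ {suc d} {p} (<⇒≤ D<p)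
          ... | m , eq = big-cycle ws uniqW (reverse ws ++ seg at (suc d + y) (suc m)) (seg at (suc y) d)
              (l₁ , at (m + (suc d + y)) , walk-++ (walk-reverse walk) hD (walk-seg (suc d + y) m) , a-sym (trans (cong (a l₁) back) ly))
              perm (≤-trans (around₁ (length ws) d m p (trans (sym eq) (sym (+-suc d m))) D≤)
                (≤-reflexive (sym (trans (length-++ (reverse ws)) (cong₂ _+_ (length-reverse ws) (length-seg at (suc d + y) (suc m)))))))
            where
            back : at (m + (suc d + y)) ≡ at y
            back = trans (cong at (trans (sym (+-assoc m (suc d) y)) (cong (_+ y) (trans (+-comm m (suc d)) eq)))) (periodic y)
            perm : P ++ ws ↭ (reverse ws ++ seg at (suc d + y) (suc m)) ++ seg at (suc y) d
            perm = ↭-trans (++⁺ (↭-trans (↭-sym (seg-↭ (suc y))) (↭-reflexive (trans (cong (seg at (suc y)) (trans (sym eq) (sym (+-suc d m))))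
                     (trans (seg-++ at (suc y) d (suc m)) (cong (λ v → seg at (suc y) d ++ seg at v (suc m)) (+-suc d y)))))) (↭-sym (↭-reverse ws)))
                   (↭-solve 3 (λ S T W → (S ∙ T) ∙ W ⊜ (W ∙ T) ∙ S) ↭-refl (seg at (suc y) d) (seg at (suc d + y) (suc m)) (reverse ws))
          far y D 1≤D D<p (inj₂ p≤) ly hD with ≤⇒∃ {suc D} {p} D<p
          ... | m , eq = big-cycle ws uniqW (ws ++ seg at y (suc D)) (seg at (suc D + y) m)
              (h₁ , at (D + y) , walk-++ walk ly (walk-seg y D) , a-sym hD)
              perm (≤-trans (around₂ (length ws) D p p≤)
                (≤-reflexive (sym (trans (length-++ ws) (cong (length ws +_) (length-seg at y (suc D)))))))
            where
            perm : P ++ ws ↭ (ws ++ seg at y (suc D)) ++ seg at (suc D + y) m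
            perm = ↭-trans (++⁺ʳ ws (↭-trans (↭-sym (seg-↭ y)) (↭-reflexive (trans (cong (seg at y) (sym eq)) (seg-++ at y (suc D) m)))))
                   (↭-solve 3 (λ S T W → (S ∙ T) ∙ W ⊜ (W ∙ S) ∙ T) ↭-refl (seg at y (suc D)) (seg at (suc D + y) m) ws)

          η : ℕ → Bool
          η u = a h₁ (at u)

          consecutive? : h₁ ∉ X → Goal ⊎ (∀ u → ⟦ η u ⟧ + ⟦ η (1 + u) ⟧ ≤ 1)
          consecutive? h₁∉ = decide (anyUpTo? (λ u → suc 1 ≤? ⟦ η u ⟧ + ⟦ η (1 + u) ⟧) p)
            where
            instance
              nz : NonZero p
              nz = nonZero
            per : Periodic p (λ u → ⟦ η u ⟧ + ⟦ η (1 + u) ⟧)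
            per u = cong₂ (λ b c → ⟦ b ⟧ + ⟦ c ⟧) (cong (a h₁) (periodic u)) (periodic-shift (periodic-∘ (a h₁)) 1 u)
            decide : Dec (∃ λ u → u < p × 1 < ⟦ η u ⟧ + ⟦ η (1 + u) ⟧) → Goal ⊎ (∀ u → ⟦ η u ⟧ + ⟦ η (1 + u) ⟧ ≤ 1)
            decide (yes (u , _ , two)) = inj₁ (apart h₁∉ R (u , Pattern.pair {p} {η u} two))
            decide (no none) = inj₂ λ u → ≮⇒≥ λ two → none (u % p , m%n<n u p , subst (1 <_) (periodic-% per u) two)

          far? : ∀ y → a l₁ (at y) ≡ true →
                 Goal ⊎ (∀ D → 1 ≤ D → D < p → (D ≤ length ws ⊎ p ≤ D + length ws) → η (D + y) ≡ false)
          far? y ly = decide (anyUpTo? (λ D → (1 ≤? D) ×-dec ((D ≤? length ws) ⊎-dec (p ≤? D + length ws)) ×-dec (η (D + y) ≟ᵇ true)) p)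
            where
            decide : Dec (∃ λ D → D < p × 1 ≤ D × (D ≤ length ws ⊎ p ≤ D + length ws) × η (D + y) ≡ true) →
                     Goal ⊎ (∀ D → 1 ≤ D → D < p → (D ≤ length ws ⊎ p ≤ D + length ws) → η (D + y) ≡ false)
            decide (yes (D , D<p , 1≤D , near , hD)) = inj₁ (far y D 1≤D D<p near ly hD)
            decide (no none) = inj₂ λ D 1≤D D<p near → ≢true λ hD → none (D , D<p , 1≤D , near , hD)

          -- With c and f neighbours of h₁ on ws and on P, `ends-bound` and c < |ws| give 2c + 2f +
          -- p ≤ 2p < 2r, contrary to `many`.
          both : h₁ ∉ X → 2 ≤ cnt (a h₁) P → 0 < cnt (a l₁) P →
                 2 * r + 2 ≤ 2 * cnt (a h₁) ws + 2 * cnt (a h₁) P + p → Goal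
          both h₁∉ two one many with ∃-cnt (a l₁) P one
          ... | v , v∈ , lv with index R v∈
          ...   | y , refl with consecutive? h₁∉ | far? y lv
          ...     | inj₁ g | _ = g
          ...     | inj₂ _ | inj₁ g = g
          ...     | inj₂ apart′ | inj₂ far′ = go (length ws) refl
            where
            go : ∀ w → length ws ≡ w → Goal
            go zero    eq = contradiction (≤-trans (walk-length walk) (≤-reflexive eq)) λ ()
            go (suc w) eq = ⊥-elim (ends-contra (cnt (a h₁) P) (suc w) p (cnt (a h₁) ws) r
              (subst (λ c → c + c + 2 * suc w ≤ p + 2) (count≡cnt (a h₁))
                (Ends.ends-bound (periodic-∘ (a h₁)) w y
                  (λ D 1≤D D<p near → far′ D 1≤D D<p (subst (λ k → D ≤ k ⊎ p ≤ D + k) (sym eq) near)) apart′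
                  (subst (2 ≤_) (sym (count≡cnt (a h₁))) two)))
              many (≤-trans (cnt-self walk) (≤-reflexive eq)) p<r)

        find-end : ∀ {v} → v ∉ X₂ → Goal ⊎ End
        find-end v∉ with maximal-walk X₂ v∉
        ... | h₁ , l₁ , ws , walk , u , dis , stk , stk′ with ≤-<-connex (cnt (a h₁) P) 1
        ...   | inj₁ le = inj₂ record { walk = walk ; uniqW = uW ; e∉X = outX (dis (walk-head∈ walk)) ; few-P = le
                                      ; many = end-many {ws} h₁ (dis (walk-head∈ walk)) stk }
          where
          uW : Unique (X₂ ++ ws)
          uW = Unique-++⁺ uniq₂ u (λ x∈ w∈ → dis w∈ x∈)
        ...   | inj₂ two with cnt (a l₁) P in f₂
        ...     | zero = inj₂ record
                    { walk = walk-reverse walk ; uniqW = Unique-resp-↭ (++⁺ˡ X₂ (↭-sym (↭-reverse ws))) uW ; e∉X = outX (dis (walk-last∈ walk))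
                    ; few-P = ≤-trans (≤-reflexive f₂) z≤n
                    ; many = end-many {reverse ws} l₁ (dis (walk-last∈ walk)) (λ z lz → ∈-resp-↭ (++⁺ʳ X₂ (↭-sym (↭-reverse ws))) (stk′ z lz)) }
          where
          uW : Unique (X₂ ++ ws)
          uW = Unique-++⁺ uniq₂ u (λ x∈ w∈ → dis w∈ x∈)
        ...     | suc f with partial-cases partial
        ...       | inj₂ (refl , _) = contradiction (≤-trans two (cnt≤length (a h₁) P)) λ { (s≤s ()) }
        ...       | inj₁ cyc = inj₁ (BothEnds.both walk uW (rotation cyc) (outX (dis (walk-head∈ walk))) two
                      (≤-trans (s≤s z≤n) (≤-reflexive (sym f₂))) (end-many {ws} h₁ (dis (walk-head∈ walk)) stk))
          where
          uW : Unique (X₂ ++ ws)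
          uW = Unique-++⁺ uniq₂ u (λ x∈ w∈ → dis w∈ x∈)

      -- A second partial cycle P′, with common neighbours of its closing edge only in X ++ P′.
      record Second : Set where
        field
          e z    : V
          P′     : List V
          walk   : Walk e P′ z
          close′ : a z e ≡ true
          uniq′  : Unique (X ++ P′)
          e∉X    : e ∉ X
          few-P  : cnt (a e) P ≤ 1
          p′≤p   : length P′ ≤ p
          enough : 2 * r + 4 ≤ 2 * length P′ + 2 * cnt (a e) P + p
          stuck′ : ∀ y → common a e z y ≡ true → y ∈ X ++ P′

      -- New vertices are appended behind z, so e and the bound `few-P` persist. Only disjointness
      -- from X is maintained: the cycles `ds` may now be hit. A walk that outgrows P takes its
      -- place.
      grow : ∀ fuel {e z P′} → Walk e P′ z → a z e ≡ true → Unique (X ++ P′) → e ∉ X → cnt (a e) P ≤ 1 → length P′ ≤ p →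
             2 * r + 4 ≤ 2 * length P′ + 2 * cnt (a e) P + p → p ≤ fuel + length P′ → Goal ⊎ Second
      grow fuel {e} {z} {P′} walk close′ u e∉ few p′≤p enough le with find-outside (common a e z) (X ++ P′)
      ... | inj₂ stuck′ = inj₂ record { walk = walk ; close′ = close′ ; uniq′ = u ; e∉X = e∉ ; few-P = few ; p′≤p = p′≤p ; enough = enough ; stuck′ = stuck′ }
      ... | inj₁ (y , By , y∉) = next (∧-true By) (≤-<-connex (length (P′ ++ y ∷ [])) p)
        where
        P″ : List V
        P″ = P′ ++ y ∷ []
        |P″| : length P″ ≡ length P′ + 1
        |P″| = length-++ P′
        perm : y ∷ (X ++ P′) ↭ X ++ P″
        perm = ↭-solve 3 (λ y X P → y ∙ (X ∙ P) ⊜ X ∙ (P ∙ y)) ↭-refl (y ∷ []) X P′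
        u″ : Unique (X ++ P″)
        u″ = Unique-resp-↭ perm (Unique-∷ y∉ u)
        recurse : ∀ fuel → p ≤ fuel + length P′ → length P″ ≤ p → a e y ≡ true → a z y ≡ true → Goal ⊎ Second
        recurse zero le short _ _ = contradiction (≤-trans (≤-reflexive (sym |P″|)) (≤-trans short le)) (<⇒≱ (≤-reflexive (+-comm 1 (length P′))))
        recurse (suc fuel) le short ey zy = grow fuel (walk-++ walk zy (stop y)) (a-sym ey) u″ e∉ few short
          (≤-trans (enough-suc (length P′) (cnt (a e) P) p r enough) (≤-reflexive (cong (λ m → 2 * m + 2 * cnt (a e) P + p) (sym |P″|))))
          (≤-trans le (≤-reflexive (trans (sym (+-suc fuel (length P′))) (cong (fuel +_) (trans (+-comm 1 (length P′)) (sym |P″|))))))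
        next : a e y ≡ true × a z y ≡ true → length P″ ≤ p ⊎ p < length P″ → Goal ⊎ Second
        next (ey , zy) (inj₁ short) = recurse fuel le short ey zy
        next (ey , zy) (inj₂ long)  = inj₁ (longer cs refl good (walk-++ walk zy (stop y) , inj₁ (a-sym ey))
          (Unique-⊆ (U ++ P″) P (↭-solve 3 (λ U P Q → (U ∙ P) ∙ Q ⊜ (U ∙ Q) ∙ P) ↭-refl U P P″) u″) refl long
          (≤-trans (≤-reflexive (trans |P″| (+-comm (length P′) 1))) (≤-trans (s≤s p′≤p) p<L)))

      -- The walk is cut at the last neighbour of e on it, so the prefix contains e and all these
      -- neighbours. The one extra vertex turns 2r + 2 into 2r + 4.
      start-second : ∀ ds (|ds| : length ds ≡ j) (long : All Long ds) (uniq₂ : Unique (X ++ concat ds))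
                     (few : ∀ w → w ∉ X → w ∉ concat ds → cnt (a w) (concat ds) ≤ j * r) →
                     WithLong.End ds |ds| long (X ++ concat ds) refl uniq₂ few → Goal ⊎ Second
      start-second ds |ds| long uniq₂ few end = go (cnt (a e) ws) refl
        where
        open WithLong ds |ds| long (X ++ concat ds) refl uniq₂ few
        open End end
        go : ∀ c → cnt (a e) ws ≡ c → Goal ⊎ Second
        go zero    eq = contradiction (≤-trans (0<2*⇒0< _ (cnt-pos (cnt (a e) ws) (cnt (a e) P) p q many few-P p<r)) (≤-reflexive eq)) λ ()
        go (suc m) eq with last-true (a e) walk m (≤-reflexive (sym eq))
        ... | as , bs , z , ws-eq , w , ez , c = choose (≤-<-connex (length as) p)
          where
          enough : 2 * r + 4 ≤ 2 * length as + 2 * cnt (a e) P + p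
          enough = enough-arith (cnt (a e) ws) (cnt (a e) P) p r (length as) many
            (≤-trans (s≤s (≤-reflexive (trans eq (sym c)))) (cnt-self w))
          choose : length as ≤ p ⊎ p < length as → Goal ⊎ Second
          choose (inj₁ short) = grow p w (a-sym ez) (Unique-⊆ (X ++ as) (concat ds ++ bs)
              (↭-trans (↭-reflexive (cong ((X ++ concat ds) ++_) ws-eq))
                (↭-solve 4 (λ X D S T → (X ∙ D) ∙ (S ∙ T) ⊜ (X ∙ S) ∙ (D ∙ T)) ↭-refl X (concat ds) as bs)) uniqW)
              e∉X few-P short enough (m≤m+n p (length as))
          choose (inj₂ big) = inj₁ (big-cycle ws uniqW as (bs ++ P) (e , z , w , a-sym ez)
              (↭-trans (↭-reflexive (cong (P ++_) ws-eq)) (↭-solve 3 (λ P S T → P ∙ (S ∙ T) ⊜ S ∙ (T ∙ P)) ↭-refl P as bs)) big)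

      -- Otherwise 5|A ∩ U| ≤ t(3r + 1) with t ≤ k - 1, whereas |A ∩ U| ≥ s + 1 - p exceeds (2k/3 -
      -- 1)r. Here k ≥ 6 enters, as 5(2k/3 - 1) ≥ 3(k - 1).
      choose-cycle : ∃ λ C → C ∈ cs × 3 * r + 2 ≤ 5 * cnt A C
      choose-cycle with all-choice {A = ∃ λ C → C ∈ cs × 3 * r + 2 ≤ 5 * cnt A C} {B = λ C → 5 * cnt A C ≤ 3 * r + 1} cs
          (λ C C∈ → case 3 * r + 2 ≤? 5 * cnt A C of λ where
            (yes le) → inj₁ (C , C∈ , le)
            (no gt)  → inj₂ (≤-pred (≤-trans (≰⇒> gt) (≤-reflexive (+-suc (3 * r) 1)))))
      ... | inj₁ found = found
      ... | inj₂ low   = ⊥-elim (choose-arith t j q s p (cnt A U) (cnt-concat₅ A (3 * r + 1) low) A-tot p<r dense k≥6)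

      module Exchanges (second : Second) {C : List V} (C∈ : C ∈ cs) (A-many : 3 * r + 2 ≤ 5 * cnt A C) where
        open Second second
        open OnCycle C∈

        p′ : ℕ
        p′ = length P′

        B : V → Bool
        B = common a e z

        B-head : ∀ {v} → B v ≡ true → a e v ≡ true
        B-head {v} = proj₁ ∘ ∧-true {a e v}

        -- B may meet P, but only in neighbours of e, of which P has at most one.
        B-tot : s + 1 ≤ cnt B U + cnt (a e) P + p′
        B-tot = closing-edge-total (cnt B U + cnt (a e) P) (walk , inj₁ close′) (begin
          total B                              ≤⟨ total≤cnt B (X ++ P′) stuck′ ⟩
          cnt B (X ++ P′)                      ≡⟨ trans (cnt-++ B X P′) (cong (_+ cnt B P′) (cnt-++ B U P)) ⟩
          cnt B U + cnt B P + cnt B P′         ≤⟨ +-monoˡ-≤ (cnt B P′) (+-monoʳ-≤ (cnt B U) (cnt-mono (λ v → B-head {v}) P)) ⟩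
          cnt B U + cnt (a e) P + cnt B P′     ∎)
          where open ≤-Reasoning

        A≤h : cnt A C ≤ cnt (a h) C
        A≤h = cnt-mono (λ v → A-head {v}) C

        A-many′ : 3 * r + 2 ≤ 5 * cnt (a h) C
        A-many′ = ≤-trans A-many (*-monoʳ-≤ 5 A≤h)

        tight₁ : length C ≡ suc r → Goal
        tight₁ eq = half h h∉U (≤-reflexive (sym eq))
          (≰⇒> (tight-half (cnt (a h) C) r (length C) A-many′ eq (s≤s (s≤s (s≤s z≤n)))))

        dense-C : length C * 3 < 7 * Pattern.count {length C} (a h ∘ at)
        dense-C = subst (λ c → length C * 3 < 7 * c) (sym (count≡cnt (a h)))
          (tight-seven (cnt (a h) C) r (length C) A-many′ (≤-trans (*-monoʳ-≤ 3 (proj₂ (proj₂ goodC))) 3L≤4r))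

        tight₂ : suc (suc r) ≤ length C →
                 (∃ λ u → a h (at u) ≡ true × (a h (at (3 + u)) ≡ true ⊎ a h (at (4 + u)) ≡ true)) → Goal
        tight₂ lt (u , hu , inj₁ hu₃) = bypass h h∉U 2 ≤-refl (r<⇒fits r (length C) (<⇒≤ lt)) (u , hu , hu₃)
        tight₂ lt (u , hu , inj₂ hu₄) = bypass h h∉U 3 (s≤s (s≤s z≤n)) (fits-3 r (length C) lt) (u , hu , hu₄)

        -- h lies outside U and sees over 3r/5 vertices of C. If |C| = r + 1 this is more than half
        -- of C, and distance 3 can be forced. For |C| ≥ r + 2 only 3/7 of C is guaranteed, but then
        -- distance 4, which removes two vertices in total, is also admissible.
        tight? : Goal ⊎ length C ≡ r
        tight? with m≤n⇒m<n∨m≡n (proj₁ (proj₂ goodC))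
        ... | inj₂ eq = inj₂ (sym eq)
        ... | inj₁ r<C with m≤n⇒m<n∨m≡n r<C
        ...   | inj₂ eq = inj₁ (tight₁ (sym eq))
        ...   | inj₁ lt = inj₁ (tight₂ lt (Pattern.find-3-or-4 (periodic-∘ (a h)) dense-C))

        -- An arc from position u to m + u joined to P′ has m + 1 + p′ vertices, so j₂ is the
        -- distance that completes P′ to exactly r; i plays the same part for P.
        module Tight (ℓ≡r : length C ≡ r) (i j₂ : ℕ) (i-def : suc p + i ≡ r) (j-def : suc p′ + j₂ ≡ r) where

          private
            ℓ = length C
            instance
              nz : NonZero ℓ
              nz = nonZero

          α β : ℕ → Bool
          α = A ∘ at
          β = B ∘ at

          join : ∀ {x y Q} → Walk x Q y → ∀ u m → common a x y (at u) ≡ true → common a x y (at (m + u)) ≡ true →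
                 IsCycle (seg at u (suc m) ++ Q)
          join w u m hu hm = at u , _ , walk-++ (walk-seg u m) (a-sym (proj₁ (∧-true hm))) w , proj₂ (∧-true hu)

          C-split : ∀ u m o → suc m + o ≡ ℓ → C ↭ seg at u (suc m) ++ seg at (suc m + u) o
          C-split u m o eq = ↭-trans (↭-sym (seg-↭ u)) (↭-reflexive (trans (cong (seg at u) (sym eq)) (seg-++ at u (suc m) o)))

          all↭ : ∀ {S} → C ↭ S → X ++ P′ ↭ ((S ++ D) ++ P) ++ P′
          all↭ p = ++⁺ʳ P′ (++⁺ʳ P (↭-trans U↭ (++⁺ʳ D p)))

          -- The arc completes P′ to exactly r vertices, so the family keeps its size, and the
          -- vertex at v, off the arc, enters P.
          do-shift : ∀ u v → β u ≡ true → β (j₂ + u) ≡ true → suc (j₂ + u) ≤ v → v < ℓ + u → α v ≡ true → Goal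
          do-shift u v βu βj lo hi αv with ≤⇒∃ {suc j₂} {ℓ} (≤-trans (s≤s (m≤n+m j₂ p′)) (≤-reflexive (trans j-def (sym ℓ≡r))))
          ... | o , eq with extract (∈-seg at (suc j₂ + u) o v lo (≤-trans hi (≤-reflexive (trans (cong (_+ u) (sym eq)) (pos j₂ o u)))))
            where
            pos : ∀ j o u → suc j + o + u ≡ o + (suc j + u)
            pos j o u = trans (cong (_+ u) (+-comm (suc j) o)) (+-assoc o (suc j) u)
          ...   | K , K↭ = longer (C′ ∷ cs′) (sym |cs|)
                    ((join walk u j₂ βu βj , ≤-reflexive (sym |C′|) , ≤-trans (≤-reflexive |C′|) r≤L) All.∷ good′)
                    (enter αv) (Unique-⊆ ((C′ ++ D) ++ (c ∷ P)) K perm uniq′)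
                    (trans (length-++ C′) (trans (cong (_+ length D) (trans |C′| (sym ℓ≡r))) (sym (length-U C D U↭)))) ≤-refl p<L
            where
            J C′ : List V
            J = seg at u (suc j₂)
            C′ = J ++ P′
            c : V
            c = at v
            |C′| : length C′ ≡ r
            |C′| = trans (length-++ J) (trans (cong (_+ p′) (length-seg at u (suc j₂))) (trans (cong suc (+-comm j₂ p′)) j-def))
            perm : X ++ P′ ↭ ((C′ ++ D) ++ (c ∷ P)) ++ K
            perm = ↭-trans (all↭ (↭-trans (C-split u j₂ o eq) (++⁺ˡ J K↭)))
              (↭-solve 6 (λ J c K D P Q → (((J ∙ (c ∙ K)) ∙ D) ∙ P) ∙ Q ⊜ (((J ∙ Q) ∙ D) ∙ (c ∙ P)) ∙ K) ↭-refl J (c ∷ []) K D P P′)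

          -- Two disjoint arcs of C complete P′ and P, so one family cycle is traded for two; the
          -- tolerance `suc ρ` keeps both within L.
          do-split : ∀ u m v n′ → β u ≡ true → β (m + u) ≡ true → j₂ ≤ m → m ≤ j₂ + suc ρ →
                     suc (m + u) ≤ v → suc (n′ + v) ≤ ℓ + u → α v ≡ true → α (n′ + v) ≡ true →
                     i ≤ n′ → n′ ≤ i + suc ρ → Goal
          do-split u m v n′ βu βm j≤m m≤ lo hi αv αn i≤n n≤ with ≤⇒∃ lo
          ... | d , v-eq with ≤⇒∃ (split-fit n′ v ℓ u m d hi v-eq)
          ...   | o , ℓ-eq = more (C′ ∷ C″ ∷ cs′) (cong suc (sym |cs|))
                  ((join walk u m βu βm ,
                    ≤-trans (join-lo m j₂ p′ r j-def j≤m) (≤-reflexive (sym |C′|)) ,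
                    ≤-trans (≤-reflexive |C′|) (join-hi m j₂ p′ r (suc ρ) j-def m≤)) All.∷
                   (join (proj₁ partial) v n′ αv αn ,
                    ≤-trans (join-lo n′ i p r i-def i≤n) (≤-reflexive (sym |C″|)) ,
                    ≤-trans (≤-reflexive |C″|) (join-hi n′ i p r (suc ρ) i-def n≤)) All.∷ good′)
                  (Unique-⊆ (C′ ++ (C″ ++ D)) (K₁ ++ K₂) perm uniq′)
            where
            J I K₁ K₂ C′ C″ : List V
            J = seg at u (suc m)
            I = seg at v (suc n′)
            K₁ = seg at (suc m + u) d
            K₂ = seg at (suc n′ + v) o
            C′ = J ++ P′
            C″ = I ++ P
            |C′| : length C′ ≡ suc m + p′
            |C′| = trans (length-++ J) (cong (_+ p′) (length-seg at u (suc m)))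
            |C″| : length C″ ≡ suc n′ + p
            |C″| = trans (length-++ I) (cong (_+ p) (length-seg at v (suc n′)))
            K-split : seg at (suc m + u) (d + (suc n′ + o)) ≡ K₁ ++ (I ++ K₂)
            K-split = trans (seg-++ at (suc m + u) d (suc n′ + o)) (cong (K₁ ++_)
              (trans (cong (λ w → seg at w (suc n′ + o)) (trans (+-comm d (suc m + u)) v-eq)) (seg-++ at v (suc n′) o)))
            perm : X ++ P′ ↭ (C′ ++ (C″ ++ D)) ++ (K₁ ++ K₂)
            perm = ↭-trans (all↭ (↭-trans (C-split u m (d + (suc n′ + o)) (trans (assoc m d n′ o) ℓ-eq)) (↭-reflexive (cong (J ++_) K-split))))
              (↭-solve 7 (λ J K I L D P Q → (((J ∙ (K ∙ (I ∙ L))) ∙ D) ∙ P) ∙ Q ⊜ ((J ∙ Q) ∙ ((I ∙ P) ∙ D)) ∙ (K ∙ L)) ↭-refl J K₁ I K₂ D P P′)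
              where
              assoc : ∀ m d n o → suc m + (d + (suc n + o)) ≡ suc m + (d + suc n) + o
              assoc m d n o = trans (cong (suc m +_) (sym (+-assoc d (suc n) o))) (sym (+-assoc (suc m) (d + suc n) o))

          -- B lies in the neighbourhood of e, so the other t - 1 cycles carry at most 2r each of
          -- 2|B| + |A|. From `A-tot` and twice `B-tot` more than 2kr is available in 3s, and t - 1
          -- ≤ k - 2 leaves 4r for C, up to the terms p, 2p′ and the loss on P.
          ab-many : ℓ + 2 + 2 * suc j₂ + suc i ≤ cnt B C + cnt B C + cnt A C
          ab-many = ≤-trans (≤-reflexive (cong (λ k → k + 2 + 2 * suc j₂ + suc i) ℓ≡r))
            (ab-arith (length cs′) j q s p p′ (cnt (a e) P) (cnt A C) (cnt A D) (cnt B C) (cnt B D) i j₂ (cnt A U) (cnt B U)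
              A-tot B-tot (trans (cnt-↭ A U↭) (cnt-++ A C D)) (trans (cnt-↭ B U↭) (cnt-++ B C D))
              (cnt-concat B A (2 * r) (All.map (λ {S} le → ≤-trans (+-monoˡ-≤ (cnt A S) (+-mono-≤ (B≤e S) (B≤e S))) le) others))
              (subst (λ k → 2 * (suc k + j) * r < 3 * s) |cs| dense) few-P i-def j-def)
            where
            B≤e : ∀ S → cnt B S ≤ cnt (a e) S
            B≤e = cnt-mono (λ v → B-head {v})
            others : All (λ S → cnt (a e) S + cnt (a e) S + cnt A S ≤ 2 * r) cs′
            others = All.tail (All-resp-↭ cs↭ (proj₁ (facts e e∉X)))

          exchange : Goal
          exchange with find-exchange {ℓ} (periodic-∘ A) (periodic-∘ B) ρ i j₂
              (≤-trans r≤ (≤-reflexive (sym ℓ≡r))) (≤-trans (≤-reflexive ℓ≡r) ≤r) (i≤j-arith p p′ i j₂ r p′≤p i-def j-def)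
              (≤-trans (ij-arith p p′ (cnt (a e) P) i j₂ r enough few-P i-def j-def) (≤-reflexive (sym ℓ≡r)))
              (subst₂ (λ k c → 3 * k + 2 ≤ 5 * c) (sym ℓ≡r) (sym (count≡cnt A)) A-many)
              (subst₂ (λ x y → ℓ + 2 + 2 * suc j₂ + suc i ≤ x + x + y) (sym (count≡cnt B)) (sym (count≡cnt A)) ab-many)
          ... | swapping u βu αu βu₂ = swap-in e e∉X (u , B-head {at u} βu , αu , B-head {at (2 + u)} βu₂)
          ... | shifting u v βu βj lo hi αv = do-shift u v βu βj lo hi αv
          ... | splitting u m v n′ βu βm j≤m m≤ lo hi αv αn i≤n n≤ = do-split u m v n′ βu βm j≤m m≤ lo hi αv αn i≤n n≤

        finish : Goal
        finish with tight?
        ... | inj₁ g = g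
        ... | inj₂ ℓ≡r with ≤⇒∃ p<r | ≤⇒∃ (≤-trans (s≤s p′≤p) p<r)
        ...   | i , i-def | j₂ , j-def = Tight.exchange ℓ≡r i j₂ i-def j-def

      improve : Goal
      improve with room
      ... | v , v∉ with long-cycles j X v∉ rich
      ...   | ds , |ds| , long , uD , disD , few , v₂ , v₂∉X , v₂∉D
        with WithLong.find-end ds |ds| long (X ++ concat ds) refl uniq₂ few {v₂} v₂∉
        where
        uniq₂ : Unique (X ++ concat ds)
        uniq₂ = Unique-++⁺ uniq uD (λ x∈ d∈ → disD d∈ x∈)
        v₂∉ : v₂ ∉ X ++ concat ds
        v₂∉ v∈ with ∈-++⁻ X v∈
        ... | inj₁ v∈X = v₂∉X v∈X
        ... | inj₂ v∈D = v₂∉D v∈D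
      ...     | inj₁ g   = g
      ...     | inj₂ end with start-second ds |ds| long _ few end | choose-cycle
      ...       | inj₁ g      | _                 = g
      ...       | inj₂ second | C , C∈ , A-many = Exchanges.finish second C∈ A-many

    step : Goal
    step with stuck?
    ... | inj₁ g = g
    ... | inj₂ stuck with facts? stuck
    ...   | inj₁ g     = g
    ...   | inj₂ facts = WithFacts.improve stuck facts

-- The lexicographic descent

opaque
  k≥6-arith : ∀ t j k → suc t + j ≡ k → 6 ≤ k → 5 ≤ t + j
  k≥6-arith t j k h1 h2 =
    linear 0 (≤-reflexive (sym h1) ⊕ h2) (solve (t ∷ j ∷ k ∷ []))

module Descent {n : ℕ} (G : Graph n) (q ρ s k : ℕ) (6≤k : 6 ≤ k)
               (r≤ : 3 * suc ρ ≤ 3 + q) (≤r : 3 + q ≤ 3 * suc ρ + 2)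
               (dense : 2 * k * (3 + q) < 3 * s) (large : 4 * k * (3 + q) + 3 ≤ 3 * n)
               (degree : ∀ v → s ≤ total (adj G v))
               (codegree : ∀ u v → adj G u v ≡ true → s ≤ suc (total (common (adj G) u v))) where

  Goal : Set
  Goal = ∃ λ cs → length cs ≡ k × All (LongCycles.Long G (suc q)) cs × Unique (concat cs)

  open Finish G q ρ Goal s r≤ ≤r degree codegree

  unused-vertex : ∀ cs → All Good cs → length cs < k → ∃ λ v → v ∉ concat cs
  unused-vertex cs good t<k with ≤⇒∃ t<k
  ... | j , eq = outside-length (concat cs) (subst (_< n) (+-identityʳ _)
    (room-arith (length cs) j q ρ (length (concat cs)) 0 n (length-concat L cs (All.map (proj₂ ∘ proj₂) good)) r≤ (s≤s z≤n)
      (subst (λ k → 4 * k * (3 + q) + 3 ≤ 3 * n) (sym eq) large)))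

  Family : ℕ → List (List V) → Set
  Family t cs = length cs ≡ t × All Good cs × Unique (concat cs)

  -- The innermost recursion, on r - |P|. A partial cycle that reaches r vertices is no longer a
  -- single vertex, hence a cycle, and moves into the family.
  lengthen : ∀ t y → t < k → (∀ cs → Family (suc t) cs → Goal) →
             (∀ cs → Family t cs → length (concat cs) < y → Goal) →
             ∀ {z} → Acc _<_ z → ∀ cs {h l} P → length cs ≡ t → All Good cs → Partial h l P → length P < r →
             Unique (concat cs ++ P) → length (concat cs) ≡ y → r ∸ length P ≡ z → Goal
  lengthen t y t<k more′ smaller′ (acc rz) cs P refl good partial p<r u refl eqz with ≤⇒∃ t<k
  ... | j , eqk = Search.step cs good P partial p<r u
      record { more = λ cs′ len good′ u′ → more′ cs′ (len , good′ , u′)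
             ; smaller = λ cs′ len good′ u′ → smaller′ cs′ (len , good′ , u′) ; longer = longer } j
      (subst (λ k → 2 * k * r < 3 * s) (sym eqk) dense) (subst (λ k → 4 * k * r + 3 ≤ 3 * n) (sym eqk) large)
      (k≥6-arith (length cs) j k eqk 6≤k) (λ cs′ len long u′ → cs′ , trans len eqk , long , u′)
    where
    longer : ∀ cs′ {h l P′} → length cs′ ≡ length cs → All Good cs′ → Partial h l P′ → Unique (concat cs′ ++ P′) →
             length (concat cs′) ≡ length (concat cs) → length P < length P′ → length P′ ≤ L → Goal
    longer cs′ {P′ = P′} len good′ partial′ u′ lenU p<p′ p′≤L with ≤-<-connex r (length P′)
    ... | inj₂ p′<r = lengthen t y t<k more′ smaller′ (rz (≤-trans (∸-monoʳ-< p<p′ (<⇒≤ p′<r)) (≤-reflexive eqz)))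
          cs′ P′ len good′ partial′ p′<r u′ lenU refl
    ... | inj₁ r≤p′ with partial-cases partial′
    ...   | inj₁ cyc        = more′ (P′ ∷ cs′) (cong suc len , (cyc , r≤p′ , p′≤L) All.∷ good′ ,
                                Unique-resp-↭ (↭.++-comm (concat cs′) P′) u′)
    ...   | inj₂ (refl , _) = contradiction r≤p′ λ { (s≤s ()) }

  shrink : ∀ t → t < k → (∀ cs → Family (suc t) cs → Goal) → ∀ {y} → Acc _<_ y → ∀ cs → Family t cs → length (concat cs) ≡ y → Goal
  shrink t t<k more′ {y} (acc ry) cs (len , good , u) eqy with unused-vertex cs good (≤-trans (s≤s (≤-reflexive len)) t<k)
  ... | v , v∉ = lengthen t y t<k more′ (λ cs′ fam lt → shrink t t<k more′ (ry lt) cs′ fam refl) (<-wellFounded _)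
    cs (v ∷ []) len good (stop v , inj₂ refl) (s≤s (s≤s z≤n))
    (Unique-++⁺ u (All.[] AP.∷ AP.[]) (λ { x∈ (here refl) → v∉ x∈ })) eqy refl

  enlarge : ∀ x t → t + x ≡ k → ∀ cs → Family t cs → Goal
  enlarge zero    t eq cs (len , good , u) =
    cs , trans len (trans (sym (+-identityʳ t)) eq) , All.map (λ { (c , lo , _) → c , lo }) good , u
  enlarge (suc x) t eq cs fam = shrink t (≤-trans (s≤s (m≤m+n t x)) (≤-reflexive (trans (sym (+-suc t x)) eq)))
    (enlarge x (suc t) (trans (sym (+-suc t x)) eq)) (<-wellFounded _) cs fam refl

  goal : Goal
  goal = enlarge k 0 refl [] (refl , All.[] , AP.[])

-- Lists of vertices as cycles

module _ {n : ℕ} (G : Graph n) where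
  open Walks G

  lookup-edge : ∀ {x y ys l} → Walk x (y ∷ ys) l → ∀ i → a (lookup (y ∷ ys) (inject₁ i)) (lookup (y ∷ ys) (Fin.suc i)) ≡ true
  lookup-edge (e ◅ stop _)    Fin.zero    = e
  lookup-edge (e ◅ (_ ◅ _))   Fin.zero    = e
  lookup-edge (e ◅ w@(stop _))  (Fin.suc ())
  lookup-edge (e ◅ w@(_ ◅ _)) (Fin.suc i) = lookup-edge w i

  lookup-last : ∀ {x y ys l} → Walk x (y ∷ ys) l → lookup (y ∷ ys) (fromℕ (length ys)) ≡ l
  lookup-last (stop _)          = refl
  lookup-last (e ◅ w@(stop _))  = refl
  lookup-last (e ◅ w@(_ ◅ _))   = lookup-last w

  lookup-first : ∀ {x y ys l} → Walk x (y ∷ ys) l → y ≡ x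
  lookup-first (stop _) = refl
  lookup-first (_ ◅ _)  = refl

  toCycle : ∀ xs → IsCycle xs → Unique xs → 3 ≤ length xs →
            Σ (Cycle G) λ C → cycleSize C ≡ length xs × (∀ i → Cycle.vert C i ∈ xs)
  toCycle (y ∷ ys) (h , l , w , close) u (s≤s 2≤) = record
    { len = length ys ; long = 2≤ ; vert = lookup (y ∷ ys) ; inj = lookup-injective u ; step = lookup-edge w
    ; closing = trans (cong₂ a (lookup-last w) (lookup-first w)) close } , refl , lookup∈ (y ∷ ys)

concat-disjoint : ∀ {A : Set} (xss : List (List A)) → Unique (concat xss) → ∀ i j → i ≢ j →
                  ∀ {x} → x ∈ lookup xss i → x ∉ lookup xss j
concat-disjoint (xs ∷ xss) u Fin.zero    Fin.zero    i≢j _   _   = i≢j refl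
concat-disjoint (xs ∷ xss) u Fin.zero    (Fin.suc j) _   x∈i x∈j = Unique-disjoint xs u x∈i (∈-concat⁺′ x∈j (lookup∈ xss j))
concat-disjoint (xs ∷ xss) u (Fin.suc i) Fin.zero    _   x∈i x∈j = Unique-disjoint xs u x∈j (∈-concat⁺′ x∈i (lookup∈ xss i))
concat-disjoint (xs ∷ xss) u (Fin.suc i) (Fin.suc j) i≢j x∈i x∈j =
  concat-disjoint xss (Unique-++ʳ xs u) i j (i≢j ∘ cong Fin.suc) x∈i x∈j

concat-unique : ∀ {A : Set} (xss : List (List A)) → Unique (concat xss) → ∀ i → Unique (lookup xss i)
concat-unique (xs ∷ xss) u Fin.zero    = Unique-++ˡ xs u
concat-unique (xs ∷ xss) u (Fin.suc i) = concat-unique xss (Unique-++ʳ xs u) i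

toCycles : ∀ {n q k} (G : Graph n) → (∃ λ cs → length cs ≡ k × All (LongCycles.Long G (suc q)) cs × Unique (concat cs)) →
           Σ (Fin k → Cycle G) λ C → (∀ i → 3 + q ≤ cycleSize (C i)) × (∀ i j → i ≢ j → Disjoint (C i) (C j))
toCycles {q = q} G (cs , refl , long , u) = (λ i → proj₁ (cycle i)) ,
    (λ i → ≤-trans (proj₂ (All.lookup long (lookup∈ cs i))) (≤-reflexive (sym (proj₁ (proj₂ (cycle i)))))) ,
    λ i j i≢j x y eq → concat-disjoint cs u i j i≢j (proj₂ (proj₂ (cycle i)) x)
      (subst (_∈ lookup cs j) (sym eq) (proj₂ (proj₂ (cycle j)) y))
  where
  cycle : ∀ i → Σ (Cycle G) λ C → cycleSize C ≡ length (lookup cs i) × (∀ x → Cycle.vert C x ∈ lookup cs i)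
  cycle i = toCycle G (lookup cs i) (proj₁ (All.lookup long (lookup∈ cs i))) (concat-unique cs u i)
    (≤-trans (m≤m+n 3 q) (proj₂ (All.lookup long (lookup∈ cs i))))

-- The constants of the theorem

opaque
  third-lo : ∀ x y q → q ≡ x + y * 3 → 3 * suc y ≤ 3 + q
  third-lo x y q h1 =
    linear x (≤-reflexive (sym h1)) (solve (x ∷ y ∷ q ∷ []))
  third-hi : ∀ x y q → q ≡ x + y * 3 → x < 3 → 3 + q ≤ 3 * suc y + 2
  third-hi x y q h1 h2 =
    linear 0 (≤-reflexive h1 ⊕ h2) (solve (x ∷ y ∷ q ∷ []))
  third-up : ∀ x y N → N ≡ x + y * 3 → x < 3 → N < 3 * suc y
  third-up x y N h1 h2 =
    linear 0 (≤-reflexive h1 ⊕ h2) (solve (x ∷ y ∷ N ∷ []))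

theorem3 : (k r : ℕ) → 6 ≤ k → 3 ≤ r →
    {m : ℕ} (G : Graph (suc m)) → Minimal G →
    4 * k * r * suc m ≤ 3 * (2 * edgeCount (adj G)) →
    Σ (Fin k → Cycle G) (λ C →
    (∀ i → r ≤ cycleSize (C i)) × (∀ i j → i ≢ j → Disjoint (C i) (C j)))
theorem3 k r 6≤k 3≤r {m} G (delete , contract) dense with ≤⇒∃ 3≤r
-- With r = 3 + q, the tolerance `suc (q / 3)` is the integer part of r/3, and `suc (N / 3)` is the
-- least integer above 2kr/3, a common lower bound for the degrees and for the codegrees of edges
-- plus one.
... | q , refl = toCycles {q = q} G (Descent.goal G q (q / 3) (suc (N / 3)) k 6≤k
      (third-lo (q % 3) (q / 3) q (m≡m%n+[m/n]*n q 3)) (third-hi (q % 3) (q / 3) q (m≡m%n+[m/n]*n q 3) (m%n<n q 3))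
      (third-up (N % 3) (N / 3) N (m≡m%n+[m/n]*n N 3) (m%n<n N 3))
      (order-bound k (3 + q) m e dense (edgeCount≤ G))
      (λ v → above (total (adj G v)) (drop-bound k (3 + q) m e (edgeCount (deleteVertex (adj G) v)) (total (adj G v)) dense
        (edgeCount-delete G v) (delete v)))
      (λ u v uv → above (suc (total (common (adj G) u v))) (drop-bound k (3 + q) m e (edgeCount (contractEdge (adj G) u v))
        (suc (total (common (adj G) u v))) dense (edgeCount-contract G u v uv) (contract u v uv))))
  where
  N e : ℕ
  N = 2 * k * (3 + q)
  e = edgeCount (adj G)
  above : ∀ x → N < 3 * x → N / 3 < x
  above x lt = m<n*o⇒m/o<n (subst (N <_) (*-comm 3 x) lt)
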